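{- Let $T$ be a tree whose maximum split-set(s) have cardinality $m\in\{1,2\}$. Suppose that for each maximum split-set $M$ of $T$, every component of $T-M$ is uniquely radial. Then $i_{\operatorname{bn}}(T)=\gamma_{b}(T)+1$.
   Context: A broadcast on a connected graph $G=(V,E)$ is a function $f:V\to\{0,1,\dots,\operatorname{diam}(G)\}$ with $f(v)\le e(v)$ (the eccentricity of $v$) for all $v$ if $|V|\ge 2$, and $f(v)=1$ if $V=\{v\}$. Its cost is $\sigma(f)=\sum_{v}f(v)$, and $V_f^+=\{v:f(v)>0\}$. A vertex $u$ hears $f$ from $v\in V_f^+$ if $d(u,v)\le f(v)$; $f$ is dominating if every vertex hears $f$ from some vertex of $V_f^+$. $\gamma_b(G)$ is the minimum cost of a dominating broadcast; a dominating broadcast of that cost is a $\gamma_b$-broadcast. A tree $T$ is radial if $\gamma_b(T)=\operatorname{rad}(T)$, and uniquely radial if it is radial and has a unique $\gamma_b$-broadcast (equivalently, for trees of even diameter, every $\gamma_b$-broadcast has exactly one broadcasting vertex, namely the central vertex broadcasting with strength $\operatorname{rad}(T)$). A broadcast $f$ is bn-independent if every vertex $x$ that hears $f$ from more than one vertex of $V_f^+$ satisfies $d(x,u)\ge f(u)$ for all $u\in V_f^+$; it is maximal bn-independent if it is bn-independent and there is no bn-independent broadcast $g\neq f$ with $g(v)\ge f(v)$ for all $v$. $i_{\operatorname{bn}}(G)$ is the minimum cost of a maximal bn-independent broadcast on $G$. Split-sets: let $T$ be a tree with diametrical path $P$ and $M\subseteq E(P)$, $|M|=m\ge1$; let $T_1,\dots,T_{m+1}$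 be the components of $T-M$ and $P_i$ the subpath of $P$ in $T_i$. $M$ is a split-set if each $P_i$ has even, positive length and is a diametrical path of $T_i$; a maximum split-set is a split-set of maximum cardinality (this cardinality does not depend on the chosen diametrical path). -}

module Defs where

open import Data.Nat using (ℕ; zero; suc; _≤_; _<_; _∸_)
open import Data.Nat.Divisibility using (_∣_)
open import Data.Fin using (Fin)
open import Data.List using (List; []; _∷_; length; map; allFin; take; drop)
open import Data.Nat.ListAction using (sum)
open import Data.List.Membership.Propositional using (_∈_)
open import Data.List.Relation.Unary.All using (All)
open import Data.List.Relation.Unary.Linked using (Linked)
open import Data.List.Relation.Unary.Unique.Propositional using (Unique)
open import Data.Maybe using (Maybe; just; nothing)
open import Data.Product using (Σ; ∃; ∃-syntax; _×_; _,_)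
open import Data.Sum using (_⊎_)
open import Data.Unit using (⊤)
open import Relation.Nullary using (¬_)
open import Relation.Binary.PropositionalEquality using (_≡_; _≢_)

-- Graphs on (a subset of) the vertex set Fin n.
-- V is the vertex set (a predicate on Fin n), E the adjacency relation.
-- A whole graph has V = λ _ → ⊤; subgraphs (components of T - M)
-- are obtained by restricting V and E.

record Graph (n : ℕ) : Set₁ where
  field
    V : Fin n → Set
    E : Fin n → Fin n → Set
open Graph public

module _ {n : ℕ} (G : Graph n) where

  -- WalkL u v p : p is a walk (list of vertices) from u to v inside G.
  -- Its length (number of edges) is  length p ∸ 1.
  data WalkL : Fin n → Fin n → List (Fin n) → Set where
    one  : ∀ {u} → V G u → WalkL u u (u ∷ [])
    cons : ∀ {u w v p} → V G u → E G u w → WalkL w v p → WalkL u v (u ∷ p)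

  PathL : Fin n → Fin n → List (Fin n) → Set
  PathL u v p = WalkL u v p × Unique p

  Reach : Fin n → Fin n → Set
  Reach u v = ∃[ p ] WalkL u v p

  Within : Fin n → Fin n → ℕ → Set
  Within u v k = ∃[ p ] (WalkL u v p × length p ≤ suc k)

  Near : Fin n → Fin n → ℕ → Set
  Near u v k = ∃[ p ] (WalkL u v p × length p ≤ k)

  EccLe : Fin n → ℕ → Set
  EccLe v k = ∀ u → V G u → Within v u k

  EccGe : Fin n → ℕ → Set
  EccGe v k = ∃[ u ] (V G u × ¬ Near v u k)

  IsRad : ℕ → Set
  IsRad r = (∃[ v ] (V G v × EccLe v r)) × (∀ v → V G v → EccGe v r)

  IsDiam : ℕ → Set
  IsDiam D = (∃[ v ] (V G v × EccGe v D)) × (∀ v → V G v → EccLe v D)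

  IsDiamPath : List (Fin n) → Set
  IsDiamPath p = ∃[ u ] ∃[ v ] (PathL u v p × IsDiam (length p ∸ 1))

  Single : Set
  Single = ∃[ v ] (V G v × (∀ u → V G u → u ≡ v))

  Broadcast : (Fin n → ℕ) → Set
  Broadcast f = (∀ v → ¬ V G v → f v ≡ 0)
              × (∀ v → V G v → (Single → f v ≡ 1) × (¬ Single → EccGe v (f v)))

  cost : (Fin n → ℕ) → ℕ
  cost f = sum (map f (allFin n))

  Hears : (Fin n → ℕ) → Fin n → Fin n → Set
  Hears f x v = V G v × 0 < f v × Within v x (f v)

  Dominating : (Fin n → ℕ) → Set
  Dominating f = ∀ x → V G x → ∃[ v ] Hears f x v

  DomBroadcast : (Fin n → ℕ) → Set
  DomBroadcast f = Broadcast f × Dominating f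

  GammaBcast : (Fin n → ℕ) → Set
  GammaBcast f = DomBroadcast f × (∀ g → DomBroadcast g → cost f ≤ cost g)

  BnIndep : (Fin n → ℕ) → Set
  BnIndep f = ∀ x → V G x →
              (∃[ v ] ∃[ w ] (v ≢ w × Hears f x v × Hears f x w)) →
              ∀ u → V G u → 0 < f u → ¬ Near x u (f u)

  MaxBnIndep : (Fin n → ℕ) → Set
  MaxBnIndep f = Broadcast f × BnIndep f ×
                 (∀ g → Broadcast g → BnIndep g → (∀ v → f v ≤ g v) → ∀ v → g v ≡ f v)

  IbnBcast : (Fin n → ℕ) → Set
  IbnBcast f = MaxBnIndep f × (∀ g → MaxBnIndep g → cost f ≤ cost g)

  Radial : Set
  Radial = ∀ f r → GammaBcast f → IsRad r → cost f ≡ r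

  UniquelyRadial : Set
  UniquelyRadial = Radial × (∀ f g → GammaBcast f → GammaBcast g → ∀ v → f v ≡ g v)

  IsTree : Set
  IsTree = (∀ v → V G v)
         × (∀ u v → E G u v → E G v u)
         × (∀ v → ¬ E G v v)
         × (∀ u v → Reach u v)
         × (∀ u v p q → PathL u v p → PathL u v q → p ≡ q)

-- Split-sets.  A diametrical path P is a list p₀ … p_D; the set M of
-- edges of P is given by a strictly increasing list of edge indices
-- (index i stands for the edge p_i p_{i+1}); |M| = length of that list.

at : {A : Set} → List A → ℕ → Maybe A
at []       _       = nothing
at (x ∷ xs) zero    = just x
at (x ∷ xs) (suc i) = at xs i

module _ {n : ℕ} where

  CutEdge : List (Fin n) → List ℕ → Fin n → Fin n → Set
  CutEdge P M u v = ∃[ i ] (i ∈ M ×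
      ((at P i ≡ just u × at P (suc i) ≡ just v) ⊎ (at P i ≡ just v × at P (suc i) ≡ just u)))

  removeCuts : Graph n → List (Fin n) → List ℕ → Graph n
  removeCuts G P M = record { V = V G ; E = λ u v → E G u v × ¬ CutEdge P M u v }

  Comp : Graph n → Fin n → Graph n
  Comp G x = record { V = λ y → Reach G x y ; E = E G }

  -- p_j … p_k is one of the subpaths P_i of P in T - M
  Block : List (Fin n) → List ℕ → ℕ → ℕ → Set
  Block P M j k = j ≤ k
                × (j ≡ 0 ⊎ ∃[ c ] (c ∈ M × j ≡ suc c))
                × (suc k ≡ length P ⊎ k ∈ M)
                × (∀ c → c ∈ M → j ≤ c → k ≤ c)

  subpath : List (Fin n) → ℕ → ℕ → List (Fin n)
  subpath P j k = drop j (take (suc k) P)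

  SplitSet : Graph n → List (Fin n) → List ℕ → Set
  SplitSet T P M = IsDiamPath T P
                 × Linked _<_ M
                 × All (λ c → suc c < length P) M
                 × M ≢ []
                 × (∀ j k → Block P M j k →
                      (2 ∣ (k ∸ j)) × 0 < k ∸ j ×
                      (∀ x → at P j ≡ just x →
                         IsDiamPath (Comp (removeCuts T P M) x) (subpath P j k)))

  MaxSplitCard : Graph n → ℕ → Set
  MaxSplitCard T m = (∃[ P ] ∃[ M ] (SplitSet T P M × length M ≡ m))
                   × (∀ P M → SplitSet T P M → length M ≤ m)

{-# OPTIONS --safe #-}

-- A broadcast is seen as a family of balls (c , s) covering T.  If a union of at least two balls has diameter at
-- most twice the sum of their strengths, then (trees are 0-hyperbolic) a single ball with that sum as strength
-- contains it, so the balls merge at no cost.  Fix a diametrical path P, of length D.  A covering family of total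
-- strength less than D / 2 in which nothing merges is a row of balls centred on P that cut P into intervals of even
-- length, i.e. the components of T - M for a split-set M with one edge less than there are balls: otherwise two
-- neighbours at an end of P, three consecutive balls, or a ball with three neighbours would merge.  Hence
-- γ_b(T) = (D - m) / 2 when m is the largest size of a split-set, and for m ≤ 2 the ball around the middle of P is
-- a maximal bn-independent broadcast of cost γ_b(T) + 1.
--
-- Conversely let f be maximal bn-independent; it is dominating.  If cost f = γ_b(T), then no strength f c reaches
-- the eccentricity of c, so by maximality some ball meets the ball of c (otherwise f c could be raised).  After
-- merging, both lie in one component of T - M for a maximum split-set M, and f restricted to that component is a
-- γ_b-broadcast of a uniquely radial tree, which has only one broadcasting vertex.
module Submission where

open import Defs
open import Data.Empty using (⊥; ⊥-elim)
open import Data.Fin as Fin using (Fin)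
open import Data.Fin.Properties using () renaming (_≟_ to _≟ᶠ_; any? to anyᶠ?)
open import Data.List as List using (List; []; _∷_; length; map; _++_; allFin; drop; take)
open import Data.List.Membership.Propositional using (_∈_; _∉_)
open import Data.List.Membership.Propositional.Properties using (∈-allFin; ∈-∃++; ∈-++⁻; ∈-++⁺ʳ)
open import Data.List.Properties using (length-++; map-++)
open import Data.List.Relation.Binary.Permutation.Propositional using (_↭_; ↭-trans; ↭-sym; prep; ↭-refl)
open import Data.List.Relation.Binary.Permutation.Propositional.Properties using (∈-resp-↭; ↭-length; shift) renaming (map⁺ to ↭-map⁺)
open import Data.List.Relation.Unary.All using ([]; _∷_; lookup; All; tabulate)
open import Data.List.Relation.Unary.All.Properties using (¬Any⇒All¬)
open import Data.List.Relation.Unary.AllPairs using ([]; _∷_; AllPairs)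
open import Data.List.Relation.Unary.Any using (here; there; any?; Any)
open import Data.List.Relation.Unary.Linked using (Linked; []; [-]; _∷_)
open import Data.List.Relation.Unary.Unique.Propositional using (Unique)
open import Data.List.Relation.Unary.Unique.Propositional.Properties using (take⁺; drop⁺; allFin⁺)
open import Data.Maybe using (just; nothing)
open import Data.Maybe.Properties using (just-injective)
open import Data.Nat using (ℕ; zero; suc; _+_; _*_; _∸_; _≤_; _<_; z≤n; s≤s; _≤?_; _<ᵇ_; _≤ᵇ_; _<?_; _≟_; _⊓_)
open import Data.Nat.Divisibility using (_∣_; divides)
open import Data.Nat.ListAction using (sum)
open import Data.Nat.ListAction.Properties using (sum-↭; sum-++)
open import Data.Nat.Properties hiding (_≤?_; _<?_; _≟_)
open import Data.Product using (_×_; _,_; proj₁; proj₂; ∃; ∃-syntax)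
open import Data.Product.Properties using (≡-dec)
open import Data.Sum using (_⊎_; inj₁; inj₂) renaming ([_,_]′ to either)
open import Relation.Binary.Definitions using (tri<; tri≈; tri>)
open import Relation.Binary.PropositionalEquality
open import Relation.Nullary using (yes; no; ¬_; Dec)
open import Relation.Nullary.Decidable using (decidable-stable; _×-dec_; ¬?)

-- The merged family supplies the split-set, but the last step of the proof needs to know where the
-- balls of the original broadcast went. Merging therefore keeps exactly one trace of them: every
-- original ball lies inside a ball of the merged family, hence over a single component.
--
-- Whether some sublist can be merged, or whether a cheaper dominating broadcast exists, is never
-- decided. Such steps pass their result to a continuation into `⊥`. This loses nothing, since
-- whatever is extracted from them is decidable (an inequality or an equation of numbers, an
-- equality of balls) or is itself `⊥`.
--
-- Every vertex gets two coordinates with respect to P: the position of its foot on P and its height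
-- over that foot. In these coordinates all distance estimates become linear inequalities between
-- natural numbers, which is why a prover for linear arithmetic comes before any graph theory.

-- Linear arithmetic over the natural numbers by reflection

module LinearArithmetic where

  open import Data.Bool using (Bool; true; false; _∧_; not; if_then_else_; T)
  open import Data.Integer as ℤ using (ℤ; +_; -[1+_])
  open import Data.Maybe using (Maybe)
  open import Data.Nat.Solver using (module +-*-Solver)
  open import Data.Unit using (⊤; tt)
  open import Data.Vec as Vec using (Vec; []; _∷_)
  open import Data.Vec.N-ary using (N-ary; _$ⁿ_)

  open +-*-Solver using (solve; _:+_; _:*_; _:=_)

  infixl 6 _⊕_
  infixl 7 _⊗_
  infix 5 _≲_ _≐_
  infixr 4 _⇒_ ⊢_

  data Expr (n : ℕ) : Set where
    var : Fin n → Expr n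
    κ   : ℕ → Expr n
    _⊕_ : Expr n → Expr n → Expr n
    _⊗_ : ℕ → Expr n → Expr n

  data Rel (n : ℕ) : Set where
    _≲_ _≐_ : Expr n → Expr n → Rel n

  data Form (n : ℕ) : Set where
    _⇒_ : Rel n → Form n → Form n
    ⊢_  : Rel n → Form n
    ⊢⊥  : Form n

  private variable
    n : ℕ

  ⟦_⟧ : Expr n → Vec ℕ n → ℕ
  ⟦ var i ⟧ ρ = Vec.lookup ρ i
  ⟦ κ c ⟧ ρ = c
  ⟦ x ⊕ y ⟧ ρ = ⟦ x ⟧ ρ + ⟦ y ⟧ ρ
  ⟦ c ⊗ x ⟧ ρ = c * ⟦ x ⟧ ρ

  ⟦_⟧ᴿ : Rel n → Vec ℕ n → Set
  ⟦ x ≲ y ⟧ᴿ ρ = ⟦ x ⟧ ρ ≤ ⟦ y ⟧ ρ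
  ⟦ x ≐ y ⟧ᴿ ρ = ⟦ x ⟧ ρ ≡ ⟦ y ⟧ ρ

  ⟦_⟧ᶠ : Form n → Vec ℕ n → Set
  ⟦ h ⇒ φ ⟧ᶠ ρ = ⟦ h ⟧ᴿ ρ → ⟦ φ ⟧ᶠ ρ
  ⟦ ⊢ g ⟧ᶠ ρ = ⟦ g ⟧ᴿ ρ
  ⟦ ⊢⊥ ⟧ᶠ ρ = ⊥

  dot : Vec ℕ n → Vec ℕ n → ℕ
  dot [] [] = 0
  dot (c ∷ cs) (x ∷ ρ) = c * x + dot cs ρ

  zeros : Vec ℕ n
  zeros = Vec.replicate _ 0

  add : Vec ℕ n → Vec ℕ n → Vec ℕ n
  add = Vec.zipWith _+_

  scale : ℕ → Vec ℕ n → Vec ℕ n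
  scale c = Vec.map (c *_)

  unit : Fin n → Vec ℕ n
  unit Fin.zero = 1 ∷ zeros
  unit (Fin.suc i) = 0 ∷ unit i

  -- The leading coefficient is the constant term.
  norm : Expr n → Vec ℕ (suc n)
  norm (var i) = 0 ∷ unit i
  norm (κ c) = c ∷ zeros
  norm (x ⊕ y) = add (norm x) (norm y)
  norm (c ⊗ x) = scale c (norm x)

  dot-zeros : (ρ : Vec ℕ n) → dot zeros ρ ≡ 0
  dot-zeros [] = refl
  dot-zeros (x ∷ ρ) = dot-zeros ρ

  dot-unit : (i : Fin n) (ρ : Vec ℕ n) → dot (unit i) ρ ≡ Vec.lookup ρ i
  dot-unit Fin.zero (x ∷ ρ) rewrite dot-zeros ρ = trans (+-identityʳ _) (+-identityʳ x)
  dot-unit (Fin.suc i) (x ∷ ρ) = dot-unit i ρ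

  dot-add : (u v ρ : Vec ℕ n) → dot (add u v) ρ ≡ dot u ρ + dot v ρ
  dot-add [] [] [] = refl
  dot-add (c ∷ u) (e ∷ v) (x ∷ ρ) rewrite dot-add u v ρ = identity c e x (dot u ρ) (dot v ρ)
    where
    identity : ∀ c e x p q → (c + e) * x + (p + q) ≡ c * x + p + (e * x + q)
    identity = solve 5 (λ c e x p q → (c :+ e) :* x :+ (p :+ q) := c :* x :+ p :+ (e :* x :+ q)) refl

  dot-scale : (c : ℕ) (v ρ : Vec ℕ n) → dot (scale c v) ρ ≡ c * dot v ρ
  dot-scale c [] [] = sym (*-zeroʳ c)
  dot-scale c (e ∷ v) (x ∷ ρ) rewrite dot-scale c v ρ = identity c e x (dot v ρ)
    where
    identity : ∀ c e x p → c * e * x + c * p ≡ c * (e * x + p)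
    identity = solve 4 (λ c e x p → c :* e :* x :+ c :* p := c :* (e :* x :+ p)) refl

  norm-sound : (x : Expr n) (ρ : Vec ℕ n) → dot (norm x) (1 ∷ ρ) ≡ ⟦ x ⟧ ρ
  norm-sound (var i) ρ = dot-unit i ρ
  norm-sound (κ c) ρ rewrite dot-zeros ρ = trans (+-identityʳ _) (*-identityʳ c)
  norm-sound (x ⊕ y) ρ = trans (dot-add (norm x) (norm y) (1 ∷ ρ)) (cong₂ _+_ (norm-sound x ρ) (norm-sound y ρ))
  norm-sound (c ⊗ x) ρ = trans (dot-scale c (norm x) (1 ∷ ρ)) (cong (c *_) (norm-sound x ρ))

  -- Two sides with natural coefficients avoid subtraction, so the verified part needs no integers;
  -- these occur only in the search for a certificate.
  Ineq : ℕ → Set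
  Ineq n = Vec ℕ (suc n) × Vec ℕ (suc n)

  Holds : Vec ℕ n → Ineq n → Set
  Holds ρ (l , r) = dot l (1 ∷ ρ) ≤ dot r (1 ∷ ρ)

  AllHold : Vec ℕ n → List (Ineq n) → Set
  AllHold ρ [] = ⊤
  AllHold ρ (h ∷ hs) = Holds ρ h × AllHold ρ hs

  combine : List (Ineq n) → List ℕ → Ineq n
  combine ((l , r) ∷ hs) (c ∷ cs) with combine hs cs
  ... | L , R = add (scale c l) L , add (scale c r) R
  combine _ _ = zeros , zeros

  combine-holds : (ρ : Vec ℕ n) (hs : List (Ineq n)) → AllHold ρ hs → ∀ cs → Holds ρ (combine hs cs)
  combine-holds ρ [] ps cs = ≤-refl
  combine-holds ρ (_ ∷ _) ps [] = ≤-refl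
  combine-holds ρ ((l , r) ∷ hs) (p , ps) (c ∷ cs) with combine hs cs | combine-holds ρ hs ps cs
  ... | L , R | q = begin
      dot (add (scale c l) L) ρ′           ≡⟨ dot-add (scale c l) L ρ′ ⟩
      dot (scale c l) ρ′ + dot L ρ′        ≡⟨ cong (_+ dot L ρ′) (dot-scale c l ρ′) ⟩
      c * dot l ρ′ + dot L ρ′              ≤⟨ +-mono-≤ (*-monoʳ-≤ c p) q ⟩
      c * dot r ρ′ + dot R ρ′              ≡⟨ cong (_+ dot R ρ′) (dot-scale c r ρ′) ⟨
      dot (scale c r) ρ′ + dot R ρ′        ≡⟨ dot-add (scale c r) R ρ′ ⟨
      dot (add (scale c r) R) ρ′           ∎
    where
    open ≤-Reasoning
    ρ′ : Vec ℕ _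
    ρ′ = 1 ∷ ρ

  pointwise≤ : Vec ℕ n → Vec ℕ n → Bool
  pointwise≤ [] [] = true
  pointwise≤ (x ∷ u) (y ∷ v) = (x ≤ᵇ y) ∧ pointwise≤ u v

  ∧-split : ∀ a {b} → T (a ∧ b) → T a × T b
  ∧-split true t = tt , t

  dot-mono : (u v ρ : Vec ℕ n) → T (pointwise≤ u v) → dot u ρ ≤ dot v ρ
  dot-mono [] [] [] t = z≤n
  dot-mono (x ∷ u) (y ∷ v) (e ∷ ρ) t with ∧-split (x ≤ᵇ y) t
  ... | p , q = +-mono-≤ (*-monoˡ-≤ e (≤ᵇ⇒≤ x y p)) (dot-mono u v ρ q)

  -- Comparing coefficients is enough because the variables are natural numbers: a larger
  -- coefficient on the left can only make the left side larger.
  contradictory : Ineq n → Bool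
  contradictory (c ∷ L , e ∷ R) = (e <ᵇ c) ∧ pointwise≤ R L

  contradictory-sound : (ρ : Vec ℕ n) (h : Ineq n) → Holds ρ h → T (contradictory h) → ⊥
  contradictory-sound ρ (c ∷ L , e ∷ R) p t with ∧-split (e <ᵇ c) t
  ... | s , q = <⇒≱ (+-mono-<-≤ (*-monoˡ-< 1 (<ᵇ⇒< e c s)) (dot-mono R L ρ q)) p

  -- Fourier–Motzkin elimination.  A row (c ∷ cs , w) stands for c + Σ csᵢ xᵢ ≤ 0
  -- and w records the hypotheses of which it is a combination.  The search is not verified: only the
  -- certificate w it returns is checked.
  private
    Row : Set
    Row = List ℤ × List ℕ

    addRow : Row → Row → Row
    addRow (u , w) (u′ , w′) = List.zipWith ℤ._+_ u u′ , List.zipWith _+_ w w′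

    scaleRow : ℕ → Row → Row
    scaleRow k (u , w) = List.map ((+ k) ℤ.*_) u , List.map (k *_) w

    nonneg : ℤ → Bool
    nonneg (+ _) = true
    nonneg -[1+ _ ] = false

    positive : ℤ → Bool
    positive (+ suc _) = true
    positive _ = false

    closed : List Row → Maybe (List ℕ)
    closed [] = nothing
    closed ((c ∷ cs , w) ∷ rs) = if positive c ∧ List.foldr (λ e b → nonneg e ∧ b) true cs then just w else closed rs
    closed (_ ∷ rs) = closed rs

    rotate : Row → Row
    rotate (c ∷ _ ∷ cs , w) = c ∷ cs List.++ (+ 0 ∷ []) , w
    rotate r = r

    trivial : Row → Bool
    trivial (cs , _) = List.foldr (λ c b → nonneg (ℤ.- c) ∧ b) true cs

    coeff : Row → ℤ
    coeff (_ ∷ x ∷ _ , _) = x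
    coeff _ = + 0

    pairings : List Row → List Row → List Row
    pairings [] ns = []
    pairings (p ∷ ps) ns =
      List.map (λ m → addRow (scaleRow ℤ.∣ coeff m ∣ p) (scaleRow ℤ.∣ coeff p ∣ m)) ns
        List.++ pairings ps ns

    -- As variables are nonnegative, a row with nonnegative coefficient stays true when that term is
    -- dropped. Only a row with negative coefficient has to be paired with a positive one to get rid
    -- of it.
    eliminate : List Row → List Row
    eliminate rs = List.filterᵇ (λ r → not (trivial r))
      (List.map rotate (List.filterᵇ (λ r → nonneg (coeff r)) rs List.++
        pairings (List.filterᵇ (λ r → positive (coeff r)) rs)
                 (List.filterᵇ (λ r → not (nonneg (coeff r))) rs)))

    search : ℕ → List Row → List ℕ
    search k rs with closed rs
    ... | just w = w
    search zero rs | nothing = []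
    search (suc k) rs | nothing = search k (eliminate rs)

    rows : ℕ → ℕ → List (Ineq n) → List Row
    rows m i [] = []
    rows m i ((l , r) ∷ hs) =
      (Vec.toList (Vec.zipWith ℤ._⊖_ l r) , List.replicate i 0 List.++ 1 ∷ List.replicate (m ∸ suc i) 0) ∷ rows m (suc i) hs

  certificate : List (Ineq n) → List ℕ
  certificate {n} hs = search n (rows (List.length hs) 0 hs)

  refuted : List (Ineq n) → Bool
  refuted hs = contradictory (combine hs (certificate hs))

  refuted-sound : (ρ : Vec ℕ n) (hs : List (Ineq n)) → AllHold ρ hs → T (refuted hs) → ⊥
  refuted-sound ρ hs ps = contradictory-sound ρ (combine hs (certificate hs)) (combine-holds ρ hs ps (certificate hs))

  ineq : Expr n → Expr n → Ineq n
  ineq x y = norm x , norm y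

  valid : List (Ineq n) → Form n → Bool
  valid hs ((x ≲ y) ⇒ φ) = valid (ineq x y ∷ hs) φ
  valid hs ((x ≐ y) ⇒ φ) = valid (ineq x y ∷ ineq y x ∷ hs) φ
  valid hs (⊢ (x ≲ y)) = refuted (ineq (κ 1 ⊕ y) x ∷ hs)
  valid hs (⊢ (x ≐ y)) = refuted (ineq (κ 1 ⊕ y) x ∷ hs) ∧ refuted (ineq (κ 1 ⊕ x) y ∷ hs)
  valid hs ⊢⊥ = refuted hs

  ineq-holds : (ρ : Vec ℕ n) (x y : Expr n) → ⟦ x ⟧ ρ ≤ ⟦ y ⟧ ρ → Holds ρ (ineq x y)
  ineq-holds ρ x y = subst₂ _≤_ (sym (norm-sound x ρ)) (sym (norm-sound y ρ))

  ≤-by-refutation : (ρ : Vec ℕ n) (hs : List (Ineq n)) → AllHold ρ hs → ∀ x y →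
                    T (refuted (ineq (κ 1 ⊕ y) x ∷ hs)) → ⟦ x ⟧ ρ ≤ ⟦ y ⟧ ρ
  ≤-by-refutation ρ hs ps x y t with ⟦ x ⟧ ρ ≤? ⟦ y ⟧ ρ
  ... | yes p = p
  ... | no ¬p = ⊥-elim (refuted-sound ρ (ineq (κ 1 ⊕ y) x ∷ hs) (ineq-holds ρ (κ 1 ⊕ y) x (≰⇒> ¬p) , ps) t)

  valid-sound : (ρ : Vec ℕ n) (hs : List (Ineq n)) → AllHold ρ hs → ∀ φ → T (valid hs φ) → ⟦ φ ⟧ᶠ ρ
  valid-sound ρ hs ps ((x ≲ y) ⇒ φ) t p = valid-sound ρ (ineq x y ∷ hs) (ineq-holds ρ x y p , ps) φ t
  valid-sound ρ hs ps ((x ≐ y) ⇒ φ) t p =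
    valid-sound ρ (ineq x y ∷ ineq y x ∷ hs) (ineq-holds ρ x y (≤-reflexive p) , ineq-holds ρ y x (≤-reflexive (sym p)) , ps) φ t
  valid-sound ρ hs ps (⊢ (x ≲ y)) t = ≤-by-refutation ρ hs ps x y t
  valid-sound ρ hs ps (⊢ (x ≐ y)) t with ∧-split (refuted (ineq (κ 1 ⊕ y) x ∷ hs)) t
  ... | t₁ , t₂ = ≤-antisym (≤-by-refutation ρ hs ps x y t₁) (≤-by-refutation ρ hs ps y x t₂)
  valid-sound ρ hs ps ⊢⊥ t = refuted-sound ρ hs ps t

  Curried : ∀ n → (Vec ℕ n → Set) → Set
  Curried zero P = P []
  Curried (suc n) P = ∀ x → Curried n (λ ρ → P (x ∷ ρ))

  curried : ∀ n {P : Vec ℕ n → Set} → (∀ ρ → P ρ) → Curried n P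
  curried zero f = f []
  curried (suc n) f = λ x → curried n (λ ρ → f (x ∷ ρ))

  close : ∀ n → N-ary n (Expr n) (Form n) → Form n
  close n f = f $ⁿ Vec.map var (Vec.allFin n)

  -- After the formula, lin takes the values of its n variables and then proofs of its hypotheses.
  lin : ∀ n (f : N-ary n (Expr n) (Form n)) → {T (valid [] (close n f))} → Curried n ⟦ close n f ⟧ᶠ
  lin n f {t} = curried n (λ ρ → valid-sound ρ [] tt (close n f) t)

open LinearArithmetic using (lin; κ; _⊕_; _⊗_; _≲_; _≐_; _⇒_; ⊢_; ⊢⊥)

-- Walks, paths and loop erasure

module _ {n : ℕ} {G : Graph n} where

  walk-nonempty : ∀ {u v p} → WalkL G u v p → length p ≡ suc (length p ∸ 1)
  walk-nonempty (one _) = refl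
  walk-nonempty (cons _ _ _) = refl

  walk-++ : ∀ {u v w p q} → WalkL G u v p → WalkL G v w q → ∃[ r ] (WalkL G u w r × suc (length r) ≡ length p + length q)
  walk-++ (one _) W = _ , W , refl
  walk-++ (cons x e W) W′ with walk-++ W W′
  ... | _ , W″ , eq = _ , cons x e W″ , cong suc eq

  walk-snoc : ∀ {u v w p} → WalkL G u v p → E G v w → V G w → ∃[ r ] (WalkL G u w r × length r ≡ suc (length p))
  walk-snoc (one x) e y = _ , cons x e (one y) , refl
  walk-snoc (cons x e′ W) e y with walk-snoc W e y
  ... | _ , W′ , eq = _ , cons x e′ W′ , cong suc eq

  walk-reverse : (∀ u v → E G u v → E G v u) → ∀ {u v p} → WalkL G u v p → ∃[ r ] (WalkL G v u r × length r ≡ length p)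
  walk-reverse E-sym (one x) = _ , one x , refl
  walk-reverse E-sym (cons x e W) with walk-reverse E-sym W
  ... | _ , W′ , eq with walk-snoc W′ (E-sym _ _ e) x
  ... | _ , W″ , eq′ = _ , W″ , trans eq′ (cong suc eq)

  path-suffix : ∀ {u v w q} → PathL G w v q → u ∈ q → ∃[ r ] (PathL G u v r × length r ≤ length q)
  path-suffix (one x , U) (here refl) = _ , (one x , U) , ≤-refl
  path-suffix (cons x e W , U) (here refl) = _ , (cons x e W , U) , ≤-refl
  path-suffix (cons x e W , _ ∷ U) (there m) with path-suffix (W , U) m
  ... | r , P , le = r , P , m≤n⇒m≤1+n le

  path-cons : ∀ {u v w q} → V G u → E G u w → PathL G w v q → u ∉ q → PathL G u v (u ∷ q)
  path-cons x e (W , U) ∉q = cons x e W , ¬Any⇒All¬ _ ∉q ∷ U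

  loop-erase : ∀ {u v p} → WalkL G u v p → ∃[ q ] (PathL G u v q × length q ≤ length p)
  loop-erase (one x) = _ , (one x , [] ∷ []) , ≤-refl
  loop-erase (cons {u} x e W) with loop-erase W
  ... | q , P , le with any? (u ≟ᶠ_) q
  ...   | no ∉q = u ∷ q , path-cons x e P ∉q , s≤s le
  ...   | yes ∈q with path-suffix P ∈q
  ...     | r , P′ , le′ = r , P′ , ≤-trans le′ (m≤n⇒m≤1+n le)

-- A unimodal pattern of steps ±1, first down and then up, is the distance to a point of ℕ.
vshape : (g : ℕ → ℕ) (L : ℕ) →
         (∀ i → i < L → g (suc i) ≡ suc (g i) ⊎ g i ≡ suc (g (suc i))) →
         (∀ i → suc i < L → g (suc i) ≡ suc (g i) → g (suc i) ≡ suc (g (suc (suc i))) → ⊥) →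
         ∃[ a ] ∃[ h ] (a ≤ L × (∀ i → i ≤ a → g i + i ≡ h + a) × (∀ i → a ≤ i → i ≤ L → g i + a ≡ h + i))
vshape g zero step peak = 0 , g 0 , z≤n , (λ { zero _ → refl }) , (λ { zero _ _ → refl })
vshape g (suc L) step peak
  with vshape g L (λ i i<L → step i (m≤n⇒m≤1+n i<L)) (λ i i<L → peak i (m≤n⇒m≤1+n i<L))
... | a , h , a≤L , left , right = extend (m≤n⇒m<n∨m≡n a≤L) (step L ≤-refl)
  where
  keep : g (suc L) ≡ suc (g L) →
         ∃[ a ] ∃[ h ] (a ≤ suc L × (∀ i → i ≤ a → g i + i ≡ h + a) × (∀ i → a ≤ i → i ≤ suc L → g i + a ≡ h + i))
  keep up = a , h , m≤n⇒m≤1+n a≤L , left , right′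
    where
    right′ : ∀ i → a ≤ i → i ≤ suc L → g i + a ≡ h + i
    right′ i a≤i i≤ with m≤n⇒m<n∨m≡n i≤
    ... | inj₁ (s≤s i≤L) = right i a≤i i≤L
    ... | inj₂ refl = trans (cong (_+ a) up) (trans (cong suc (right L a≤L ≤-refl)) (sym (+-suc h L)))

  extend : a < L ⊎ a ≡ L → g (suc L) ≡ suc (g L) ⊎ g L ≡ suc (g (suc L)) →
           ∃[ a ] ∃[ h ] (a ≤ suc L × (∀ i → i ≤ a → g i + i ≡ h + a) × (∀ i → a ≤ i → i ≤ suc L → g i + a ≡ h + i))
  extend _ (inj₁ up) = keep up
  extend (inj₂ refl) (inj₂ down) = suc L , g (suc L) , ≤-refl , left′ , λ i le le′ → cong₂ _+_ (cong g (≤-antisym le′ le)) (≤-antisym le le′)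
    where
    left′ : ∀ i → i ≤ suc L → g i + i ≡ g (suc L) + suc L
    left′ i i≤ with m≤n⇒m<n∨m≡n i≤
    ... | inj₂ refl = refl
    ... | inj₁ (s≤s i≤L) = lin 5 (λ g h L g′ x → x ≐ h ⊕ L ⇒ g ⊕ L ≐ h ⊕ L ⇒ g ≐ κ 1 ⊕ g′ ⇒ ⊢ x ≐ g′ ⊕ (κ 1 ⊕ L))
                             (g L) h L (g (suc L)) (g i + i) (left i i≤L) (left L ≤-refl) down
  extend (inj₁ (s≤s {n = L′} a≤L′)) (inj₂ down) = ⊥-elim (peak L′ ≤-refl up down)
    where
    up : g L ≡ suc (g L′)
    up = lin 5 (λ g g′ a h L′ → g ⊕ a ≐ h ⊕ (κ 1 ⊕ L′) ⇒ g′ ⊕ a ≐ h ⊕ L′ ⇒ ⊢ g ≐ κ 1 ⊕ g′)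
           (g L) (g L′) a h L′ (right L a≤L ≤-refl) (right L′ a≤L′ (n≤1+n L′))

-- The metric of a tree: coordinates over a path and the four-point condition

module TreeDistance {n : ℕ} (T : Graph n) (tree : IsTree T) where

  private
    every : ∀ v → V T v
    every = proj₁ tree

    E-sym : ∀ u v → E T u v → E T v u
    E-sym = proj₁ (proj₂ tree)

    E-irrefl : ∀ v → ¬ E T v v
    E-irrefl = proj₁ (proj₂ (proj₂ tree))

    path! : ∀ {u v p q} → PathL T u v p → PathL T u v q → p ≡ q
    path! = proj₂ (proj₂ (proj₂ (proj₂ tree))) _ _ _ _

    geodesic-exists : ∀ u v → ∃[ p ] PathL T u v p
    geodesic-exists u v with loop-erase (proj₂ (proj₁ (proj₂ (proj₂ (proj₂ tree))) u v))
    ... | q , P , _ = q , P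

    path : Fin n → Fin n → List (Fin n)
    path u v = proj₁ (geodesic-exists u v)

    path-is : ∀ u v → PathL T u v (path u v)
    path-is u v = proj₂ (geodesic-exists u v)

  d : Fin n → Fin n → ℕ
  d u v = length (path u v) ∸ 1

  path-length : ∀ u v → length (path u v) ≡ suc (d u v)
  path-length u v = walk-nonempty (proj₁ (path-is u v))

  length-path : ∀ {u v p} → PathL T u v p → length p ≡ suc (d u v)
  length-path P = trans (cong length (path! P (path-is _ _))) (path-length _ _)

  geodesic : ∀ u v → ∃[ p ] (PathL T u v p × length p ≡ suc (d u v))
  geodesic u v = path u v , path-is u v , path-length u v

  walk-bound : ∀ {u v p} → WalkL T u v p → suc (d u v) ≤ length p
  walk-bound W with loop-erase W
  ... | q , P , le = subst (_≤ _) (length-path P) le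

  d-refl : ∀ u → d u u ≡ 0
  d-refl u = n≤0⇒n≡0 (≤-pred (walk-bound (one (every u))))

  d≡0⇒≡ : ∀ {u v} → d u v ≡ 0 → u ≡ v
  d≡0⇒≡ {u} {v} eq = short (proj₁ (path-is u v)) (trans (path-length u v) (cong suc eq))
    where
    short : ∀ {p} → WalkL T u v p → length p ≡ 1 → u ≡ v
    short (one _) _ = refl
    short (cons _ _ (one _)) ()
    short (cons _ _ (cons _ _ _)) ()

  d-sym : ∀ u v → d u v ≡ d v u
  d-sym u v = ≤-antisym (half u v) (half v u)
    where
    half : ∀ u v → d u v ≤ d v u
    half u v with walk-reverse E-sym (proj₁ (path-is v u))
    ... | r , W , eq = ≤-pred (subst (suc (d u v) ≤_) (trans eq (path-length v u)) (walk-bound W))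

  d-triangle : ∀ u v w → d u w ≤ d u v + d v w
  d-triangle u v w with walk-++ (proj₁ (path-is u v)) (proj₁ (path-is v w))
  ... | r , W , eq = lin 4 (λ r p q x → κ 1 ⊕ r ≐ (κ 1 ⊕ p) ⊕ (κ 1 ⊕ q) ⇒ κ 1 ⊕ x ≲ r ⇒ ⊢ x ≲ p ⊕ q)
                       (length r) (d u v) (d v w) (d u w)
                       (trans eq (cong₂ _+_ (path-length u v) (path-length v w))) (walk-bound W)

  d-edge : ∀ {u v} → E T u v → d u v ≡ 1
  d-edge {u} {v} e with d u v in eq | walk-bound (cons (every u) e (one (every v)))
  ... | zero | _ = ⊥-elim (E-irrefl v (subst (λ w → E T w v) (d≡0⇒≡ eq) e))
  ... | suc zero | _ = refl
  ... | suc (suc k) | s≤s (s≤s ())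

  toward : ∀ {u v k} → d u v ≡ suc k → ∃[ w ] (E T u w × d w v ≡ k)
  toward {u} {v} {k} eq = first (path-is u v) (trans (path-length u v) (cong suc eq))
    where
    first : ∀ {p} → PathL T u v p → length p ≡ suc (suc k) → ∃[ w ] (E T u w × d w v ≡ k)
    first (one _ , _) ()
    first (cons {w = w} _ e W , _ ∷ U) len = w , e , suc-injective (trans (sym (length-path (W , U))) (suc-injective len))

  between : ∀ u v i → i ≤ d u v → ∃[ w ] (d u w ≡ i × i + d w v ≡ d u v)
  between u v zero _ = u , d-refl u , refl
  between u v (suc i) le with between u v i (<⇒≤ le)
  ... | w , eq , eq′ with d w v in eqw
  ...   | zero = ⊥-elim (lin 2 (λ i x → i ⊕ κ 0 ≐ x ⇒ κ 1 ⊕ i ≲ x ⇒ ⊢⊥) i (d u v) eq′ le)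
  ...   | suc k with toward eqw
  ...     | w′ , e , eq″ = w′ ,
    lin 5 (λ uw′ uv i k w′v → uw′ ≲ i ⊕ κ 1 ⇒ i ⊕ (κ 1 ⊕ k) ≐ uv ⇒ w′v ≐ k ⇒ uv ≲ uw′ ⊕ w′v ⇒ ⊢ uw′ ≐ κ 1 ⊕ i)
      (d u w′) (d u v) i k (d w′ v) (subst₂ (λ x y → d u w′ ≤ x + y) eq (d-edge e) (d-triangle u w w′)) eq′ eq″ (d-triangle u w′ v)
    , lin 4 (λ uv i k w′v → i ⊕ (κ 1 ⊕ k) ≐ uv ⇒ w′v ≐ k ⇒ ⊢ κ 1 ⊕ i ⊕ w′v ≐ uv) (d u v) i k (d w′ v) eq′ eq″

  private
    shrink : ∀ {x y z} → x ≢ y → x ∈ path y z → d x z < d y z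
    shrink {x} {y} {z} x≢y x∈ = tail (path-is y z) x∈ (path-length y z)
      where
      tail : ∀ {p} → PathL T y z p → x ∈ p → length p ≡ suc (d y z) → d x z < d y z
      tail (one _ , _) (here eq) _ = ⊥-elim (x≢y eq)
      tail (cons _ _ _ , _) (here eq) _ = ⊥-elim (x≢y eq)
      tail (cons _ _ W , _ ∷ U) (there m) len with path-suffix (W , U) m
      ... | r , P , le = subst₂ _≤_ (length-path P) (suc-injective len) le

    -- If `x` is not on the path from `y` to `z`, prepending it gives the path from `x`, and
    -- symmetrically for `y`. Both vertices cannot lie on the path of the other, for each would then
    -- be closer to `z` than the other.
    branch : ∀ {x y} → E T x y → ∀ z → (path x z ≡ x ∷ path y z) ⊎ (path y z ≡ y ∷ path x z)
    branch {x} {y} e z with any? (x ≟ᶠ_) (path y z) | any? (y ≟ᶠ_) (path x z)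
    ... | no x∉ | _ = inj₁ (path! (path-is x z) (path-cons (every x) e (path-is y z) x∉))
    ... | yes _ | no y∉ = inj₂ (path! (path-is y z) (path-cons (every y) (E-sym x y e) (path-is x z) y∉))
    ... | yes x∈ | yes y∈ = ⊥-elim (<-asym (shrink x≢y x∈) (shrink (λ eq → x≢y (sym eq)) y∈))
      where
      x≢y : x ≢ y
      x≢y refl = E-irrefl x e

    cons-length : ∀ {x y z w} → path x z ≡ w ∷ path y z → d x z ≡ suc (d y z)
    cons-length {y = y} {z} eq = trans (cong (λ p → length p ∸ 1) eq) (path-length y z)

    head-unique : ∀ {x y z q} → path x z ≡ q → WalkL T y z q → x ≡ y
    head-unique {x} {y} {z} refl W = same (proj₁ (path-is x z)) W
      where
      same : ∀ {p} → WalkL T x z p → WalkL T y z p → x ≡ y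
      same (one _) (one _) = refl
      same (one _) (cons _ _ ())
      same (cons _ _ ()) (one _)
      same (cons _ _ _) (cons _ _ _) = refl

  d-edge-step : ∀ {x y} → E T x y → ∀ z → d x z ≡ suc (d y z) ⊎ d y z ≡ suc (d x z)
  d-edge-step e z with branch e z
  ... | inj₁ eq = inj₁ (cons-length eq)
  ... | inj₂ eq = inj₂ (cons-length eq)

  -- A neighbour of `x` that is closer to `z` is the second vertex of the path from `x` to `z`, and
  -- there is only one such path.
  parent-unique : ∀ {x y y′ z} → E T x y → E T x y′ → d x z ≡ suc (d y z) → d x z ≡ suc (d y′ z) → y ≡ y′
  parent-unique {x} {y} {y′} {z} e e′ eq eq′ with branch e z | branch e′ z
  ... | inj₂ c | _ = ⊥-elim (<-asym (≤-reflexive (sym (cons-length c))) (≤-reflexive (sym eq)))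
  ... | inj₁ _ | inj₂ c = ⊥-elim (<-asym (≤-reflexive (sym (cons-length c))) (≤-reflexive (sym eq′)))
  ... | inj₁ c | inj₁ c′ = head-unique (∷-injectiveʳ (trans (sym c) c′)) (proj₁ (path-is y′ z))
    where open import Data.List.Properties using (∷-injectiveʳ)

  within⇒d≤ : ∀ {u v k} → Within T u v k → d u v ≤ k
  within⇒d≤ (p , W , le) = ≤-pred (≤-trans (walk-bound W) le)

  d≤⇒within : ∀ {u v k} → d u v ≤ k → Within T u v k
  d≤⇒within {u} {v} le = path u v , proj₁ (path-is u v) , subst (_≤ _) (sym (path-length u v)) (s≤s le)

  ¬near⇒≤d : ∀ {u v k} → ¬ Near T u v k → k ≤ d u v
  ¬near⇒≤d {u} {v} {k} ¬near with k ≤? d u v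
  ... | yes le = le
  ... | no ≰ = ⊥-elim (¬near (path u v , proj₁ (path-is u v) , subst (_≤ k) (sym (path-length u v)) (≰⇒> ≰)))

  ≤d⇒¬near : ∀ {u v k} → k ≤ d u v → ¬ Near T u v k
  ≤d⇒¬near le (p , W , le′) = <⇒≱ (≤-trans (walk-bound W) le′) le

  -- Positions are plain numbers so that arithmetic on them carries no bounds; the values of `p`
  -- beyond `L` are junk.
  record Line (L : ℕ) : Set where
    field
      p     : ℕ → Fin n
      p-E   : ∀ i → i < L → E T (p i) (p (suc i))
      p-inj : ∀ i j → i ≤ L → j ≤ L → p i ≡ p j → i ≡ j

  nth : Fin n → List (Fin n) → ℕ → Fin n
  nth x [] _ = x
  nth x (y ∷ ys) zero = y
  nth x (y ∷ ys) (suc i) = nth x ys i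

  at-nth : ∀ x ys i → i < length ys → at ys i ≡ just (nth x ys i)
  at-nth x (y ∷ ys) zero _ = refl
  at-nth x (y ∷ ys) (suc i) (s≤s lt) = at-nth x ys i lt

  private
    nth-∈ : ∀ x ys i → i < length ys → nth x ys i ∈ ys
    nth-∈ x (y ∷ ys) zero _ = here refl
    nth-∈ x (y ∷ ys) (suc i) (s≤s lt) = there (nth-∈ x ys i lt)

    nth-E : ∀ x {u v ys} → WalkL T u v ys → ∀ i → suc i < length ys → E T (nth x ys i) (nth x ys (suc i))
    nth-E x (one _) i (s≤s ())
    nth-E x (cons _ e (one _)) zero _ = e
    nth-E x (cons _ e (cons _ _ _)) zero _ = e
    nth-E x (cons _ _ W) (suc i) (s≤s lt) = nth-E x W i lt

    nth-injective : ∀ x ys → Unique ys → ∀ i j → i < length ys → j < length ys → nth x ys i ≡ nth x ys j → i ≡ j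
    nth-injective x (y ∷ ys) U zero zero _ _ _ = refl
    nth-injective x (y ∷ ys) (ne ∷ U) zero (suc j) _ (s≤s lt) eq = ⊥-elim (lookup ne (nth-∈ x ys j lt) eq)
    nth-injective x (y ∷ ys) (ne ∷ U) (suc i) zero (s≤s lt) _ eq = ⊥-elim (lookup ne (nth-∈ x ys i lt) (sym eq))
    nth-injective x (y ∷ ys) (_ ∷ U) (suc i) (suc j) (s≤s lt) (s≤s lt′) eq = cong suc (nth-injective x ys U i j lt lt′ eq)

  nth-first : ∀ x {u v ys} → WalkL T u v ys → nth x ys 0 ≡ u
  nth-first x (one _) = refl
  nth-first x (cons _ _ _) = refl

  nth-last : ∀ x {u v ys L} → WalkL T u v ys → length ys ≡ suc L → nth x ys L ≡ v
  nth-last x (one _) refl = refl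
  nth-last x (cons _ _ W@(one _)) refl = nth-last x W refl
  nth-last x (cons _ _ W@(cons _ _ _)) refl = nth-last x W refl

  line : ∀ {u v ys L} → PathL T u v ys → length ys ≡ suc L → Line L
  line {u} {ys = ys} {L} (W , U) len = record
    { p     = nth u ys
    ; p-E   = λ i lt → nth-E u W i (subst (suc i <_) (sym len) (s≤s lt))
    ; p-inj = λ i j le le′ → nth-injective u ys U i j (subst (i <_) (sym len) (s≤s le)) (subst (j <_) (sym len) (s≤s le′))
    }

  -- A vertex z hangs at height h over the point at position a of the line.
  Coordinates : {L : ℕ} → Line L → Fin n → ℕ → ℕ → Set
  Coordinates {L} ℓ z a h = a ≤ L × (∀ i → i ≤ a → d z (p i) + i ≡ h + a) × (∀ i → a ≤ i → i ≤ L → d z (p i) + a ≡ h + i)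
    where open Line ℓ

  -- Along each edge the distance to `z` changes by exactly one, and a peak would be a vertex with
  -- two different neighbours closer to `z`. So the distances first fall and then rise.
  coordinates : ∀ {L} (ℓ : Line L) z → ∃[ a ] ∃[ h ] Coordinates ℓ z a h
  coordinates {L} ℓ z = vshape (λ i → d z (p i)) L step peak
    where
    open Line ℓ
    flip : ∀ {x y} → d x z ≡ suc (d y z) → d z x ≡ suc (d z y)
    flip {x} {y} eq = trans (d-sym z x) (trans eq (cong suc (d-sym y z)))

    step : ∀ i → i < L → d z (p (suc i)) ≡ suc (d z (p i)) ⊎ d z (p i) ≡ suc (d z (p (suc i)))
    step i lt with d-edge-step (p-E i lt) z
    ... | inj₁ eq = inj₂ (flip eq)
    ... | inj₂ eq = inj₁ (flip eq)

    peak : ∀ i → suc i < L → d z (p (suc i)) ≡ suc (d z (p i)) → d z (p (suc i)) ≡ suc (d z (p (suc (suc i)))) → ⊥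
    peak i lt eq eq′ with p-inj i (suc (suc i)) (≤-trans (n≤1+n i) (<⇒≤ lt)) lt
                            (parent-unique {z = z} (E-sym _ _ (p-E i (<⇒≤ lt))) (p-E (suc i) lt) (unflip eq) (unflip eq′))
      where
      unflip : ∀ {x y} → d z x ≡ suc (d z y) → d x z ≡ suc (d y z)
      unflip {x} {y} eq = trans (d-sym x z) (trans eq (cong suc (d-sym z y)))
    ... | ()

  -- Let `w` and `z` hang over positions a and b of the path from `x` to `y`, at heights h and k.
  -- Walking through the feet gives d w z at most h + |a - b| + k. If a is at most b, adding L = d x
  -- y yields (h + L - a) + (k + b), which is d w y + d z x; the other order gives the other
  -- alternative.
  four-point : ∀ w x y z → d w z + d x y ≤ d w x + d z y ⊎ d w z + d x y ≤ d w y + d z x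
  four-point w x y z with geodesic x y
  ... | ys , P , len = conclude
    where
    L : ℕ
    L = d x y
    ℓ : Line L
    ℓ = line P len
    open Line ℓ
    p0 : p 0 ≡ x
    p0 = nth-first x (proj₁ P)
    pL : p L ≡ y
    pL = nth-last x (proj₁ P) len

    ends : ∀ v {a h} → Coordinates ℓ v a h → d v x ≡ h + a × d v y + a ≡ h + L
    ends v (a≤L , left , right) =
      trans (cong (d v) (sym p0)) (trans (sym (+-identityʳ _)) (left 0 z≤n)) ,
      trans (cong (λ t → d v t + _) (sym pL)) (right L a≤L ≤-refl)

    over : ∀ v w {a h b k} → Coordinates ℓ v a h → Coordinates ℓ w b k → a ≤ b → d v w + a ≤ h + b + k
    over v w {a} {h} {b} {k} (a≤L , _ , right) (b≤L , left′ , _) a≤b =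
      lin 7 (λ a h b k vw vp pw → vw ≲ vp ⊕ pw ⇒ vp ⊕ a ≐ h ⊕ b ⇒ pw ⊕ b ≐ k ⊕ b ⇒ ⊢ vw ⊕ a ≲ h ⊕ b ⊕ k)
        a h b k (d v w) (d v (p b)) (d (p b) w) (d-triangle v (p b) w) (right b a≤b b≤L)
        (trans (cong (_+ b) (d-sym (p b) w)) (left′ b ≤-refl))

    conclude : d w z + d x y ≤ d w x + d z y ⊎ d w z + d x y ≤ d w y + d z x
    conclude with coordinates ℓ w | coordinates ℓ z
    ... | a , h , C | b , k , C′ with ends w C | ends z C′ | ≤-total a b
    ...   | wx , wy | zx , zy | inj₁ a≤b =
      inj₂ (lin 8 (λ a h b k wz L wy zx → wz ⊕ a ≲ h ⊕ b ⊕ k ⇒ wy ⊕ a ≐ h ⊕ L ⇒ zx ≐ k ⊕ b ⇒ ⊢ wz ⊕ L ≲ wy ⊕ zx)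
              a h b k (d w z) L (d w y) (d z x) (over w z C C′ a≤b) wy zx)
    ...   | wx , wy | zx , zy | inj₂ b≤a =
      inj₁ (lin 8 (λ a h b k wz L wx zy → wz ⊕ b ≲ k ⊕ a ⊕ h ⇒ zy ⊕ b ≐ k ⊕ L ⇒ wx ≐ h ⊕ a ⇒ ⊢ wz ⊕ L ≲ wx ⊕ zy)
              a h b k (d w z) L (d w x) (d z y) (subst (λ t → t + b ≤ k + a + h) (d-sym z w) (over z w C′ C b≤a)) zy wx)

-- Balls in a tree: the Helly property and merging

module Balls {n : ℕ} (T : Graph n) (tree : IsTree T) where

  open TreeDistance T tree

  Ball : Set
  Ball = Fin n × ℕ

  infix 4 _∈ᵇ_
  _∈ᵇ_ : Fin n → Ball → Set
  x ∈ᵇ (c , s) = d x c ≤ s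

  total : List Ball → ℕ
  total C = sum (map proj₂ C)

  total-↭ : ∀ {C} X Y → C ↭ X ++ Y → total C ≡ total X + total Y
  total-↭ X Y π =
    trans (sum-↭ (↭-map⁺ proj₂ π)) (trans (cong sum (map-++ proj₂ X Y)) (sum-++ (map proj₂ X) (map proj₂ Y)))

  d-triangle₂ : ∀ x u v y → d x y ≤ d x u + d u v + d v y
  d-triangle₂ x u v y = ≤-trans (d-triangle x v y) (+-monoˡ-≤ (d v y) (d-triangle x u v))

  -- Vertices are added one at a time. If the new vertex `z` is too far from the current centre `c`,
  -- the centre moves towards `z` until it is at distance exactly `r`. For an older vertex `x` the
  -- four-point condition on the new centre, `c`, `z` and `x` keeps the distance within `r`: one
  -- alternative uses the bound on d x z, the other that `x` was near `c`.
  helly : ∀ r (S : Fin n → Set) → (∀ x → Dec (S x)) → (∀ x y → S x → S y → d x y ≤ 2 * r) →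
          Fin n → ∃[ c ] (∀ x → S x → x ∈ᵇ (c , r))
  helly r S S? diam c₀ with go (allFin n)
    where
    go : ∀ vs → ∃[ c ] (∀ x → x ∈ vs → S x → x ∈ᵇ (c , r))
    go [] = c₀ , λ _ ()
    go (z ∷ vs) with go vs | S? z
    ... | c , near | no ¬z = c , λ { x (here refl) Sx → ⊥-elim (¬z Sx) ; x (there m) Sx → near x m Sx }
    ... | c , near | yes Sz with d z c ≤? r
    ...   | yes z≤ = c , λ { x (here refl) Sx → z≤ ; x (there m) Sx → near x m Sx }
    ...   | no z≰ with between c z (d c z ∸ r) (m∸n≤m (d c z) r)
    ...     | c′ , cc′ , c′z = c′ , near′
      where
      t : ℕ
      t = d c z ∸ r
      t+r : t + r ≡ d c z
      t+r = m∸n+n≡m (<⇒≤ (subst (r <_) (d-sym z c) (≰⇒> z≰)))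
      z≡ : d z c′ ≡ r
      z≡ = lin 5 (λ t r cz c′z zc′ → t ⊕ r ≐ cz ⇒ t ⊕ c′z ≐ cz ⇒ zc′ ≐ c′z ⇒ ⊢ zc′ ≐ r)
             t r (d c z) (d c′ z) (d z c′) t+r c′z (d-sym z c′)
      near′ : ∀ x → x ∈ z ∷ vs → S x → x ∈ᵇ (c′ , r)
      near′ x (here refl) Sx = ≤-reflexive z≡
      near′ x (there m) Sx with four-point c′ c z x
      ... | inj₁ le = lin 8 (λ xc′ c′x cz c′c cc′ xz t r → xc′ ≐ c′x ⇒ c′c ≐ cc′ ⇒ cc′ ≐ t ⇒ t ⊕ r ≐ cz ⇒ xz ≲ 2 ⊗ r ⇒
                                c′x ⊕ cz ≲ c′c ⊕ xz ⇒ ⊢ xc′ ≲ r)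
                        (d x c′) (d c′ x) (d c z) (d c′ c) (d c c′) (d x z) t r
                        (d-sym x c′) (d-sym c′ c) cc′ t+r (diam x z Sx Sz) le
      ... | inj₂ le = lin 8 (λ xc′ c′x cz zc′ c′z xc t r → xc′ ≐ c′x ⇒ c′z ≐ zc′ ⇒ zc′ ≐ r ⇒ t ⊕ r ≐ cz ⇒ xc ≲ r ⇒
                                c′x ⊕ cz ≲ c′z ⊕ xc ⇒ ⊢ xc′ ≲ r)
                        (d x c′) (d c′ x) (d c z) (d z c′) (d c′ z) (d x c) t r
                        (d-sym x c′) (d-sym c′ z) z≡ t+r (near x m Sx) le
  ... | c , near = c , λ x → near x (∈-allFin x)

  Covers : List Ball → Fin n → Set
  Covers X x = Any (x ∈ᵇ_) X

  Mergeable : List Ball → Set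
  Mergeable X = ∀ x y → Covers X x → Covers X y → d x y ≤ 2 * total X

  -- A single ball is always mergeable, hence the bound 2. The permutation allows any selection of
  -- balls to be moved to the front.
  Irreducible : List Ball → Set
  Irreducible C = ∀ X Y → C ↭ X ++ Y → 2 ≤ length X → ¬ Mergeable X

  Positive : List Ball → Set
  Positive C = ∀ {b} → b ∈ C → 0 < proj₂ b

  Refines : List Ball → List Ball → Set
  Refines C C′ = ∀ {b} → b ∈ C → ∃[ b′ ] (b′ ∈ C′ × (∀ {x} → x ∈ᵇ b → x ∈ᵇ b′))

  private
    ∈⇒covers : ∀ {X b x} → b ∈ X → x ∈ᵇ b → Covers X x
    ∈⇒covers (here refl) x∈ = here x∈
    ∈⇒covers (there m) x∈ = there (∈⇒covers m x∈)
  ∈⇒≤total : ∀ {X b} → b ∈ X → proj₂ b ≤ total X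
  ∈⇒≤total (here refl) = m≤m+n _ _
  ∈⇒≤total {c ∷ X} (there m) = ≤-trans (∈⇒≤total m) (m≤n+m _ (proj₂ c))

  -- The continuation is applied to `C` itself. Should it ever exploit the irreducibility of `C`, it
  -- must present a mergeable part, and the same continuation is then applied to the family in which
  -- that part is one ball. Each merge shortens the list, so this ends.
  reduction : ∀ k C → length C ≤ k → Positive C →
              (∀ C′ → Irreducible C′ → Positive C′ → Refines C C′ → total C′ ≡ total C → ⊥) → ⊥
  reduction k C len pos K = K C irreducible pos (λ {b} m → b , m , λ x∈ → x∈) refl
    where
    irreducible : Irreducible C
    irreducible [] Y π ()
    irreducible X@(b ∷ _) Y π two mergeable
      with helly (total X) (Covers X) (λ x → any? (λ b → d x (proj₁ b) ≤? proj₂ b) X) mergeable (proj₁ b)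
    ... | c , near = descend k (subst (_≤ k) (trans (↭-length π) (length-++ X)) len)
      where
      C₁ : List Ball
      C₁ = (c , total X) ∷ Y
      pos₁ : Positive C₁
      pos₁ (here refl) = ≤-trans (pos (∈-resp-↭ (↭-sym π) (here refl))) (m≤m+n _ _)
      pos₁ (there m) = pos (∈-resp-↭ (↭-sym π) (∈-++⁺ʳ X m))
      refines₁ : Refines C C₁
      refines₁ m with ∈-++⁻ X (∈-resp-↭ π m)
      ... | inj₁ m∈X = _ , here refl , λ {x} x∈ → near x (∈⇒covers m∈X x∈)
      ... | inj₂ m∈Y = _ , there m∈Y , λ x∈ → x∈
      descend : ∀ k → length X + length Y ≤ k → ⊥
      descend zero ()
      descend (suc k) le = reduction k C₁
        (lin 3 (λ x y k → κ 2 ≲ x ⇒ x ⊕ y ≲ κ 1 ⊕ k ⇒ ⊢ κ 1 ⊕ y ≲ k) (length X) (length Y) k two le) pos₁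
        (λ C′ irr pos′ ref tot → K C′ irr pos′
           (λ m → let (_ , m₁ , inc₁) = refines₁ m ; (b₂ , m₂ , inc₂) = ref m₁ in b₂ , m₂ , λ x∈ → inc₂ (inc₁ x∈))
           (trans tot (sym (total-↭ X Y π))))

  extract : ∀ {X C : List Ball} → Unique X → (∀ {b} → b ∈ X → b ∈ C) → ∃[ Y ] C ↭ X ++ Y
  extract {[]} {C} U sub = C , ↭-refl
  extract {x ∷ X} (x∉ ∷ U) sub with ∈-∃++ (sub (here refl))
  ... | as , bs , refl with extract {X} {as ++ bs} U sub′
    where
    sub′ : ∀ {b} → b ∈ X → b ∈ as ++ bs
    sub′ m with ∈-resp-↭ (shift x as bs) (sub (there m))
    ... | here refl = ⊥-elim (lookup x∉ m refl)
    ... | there m′ = m′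
  ... | Y , π = Y , ↭-trans (shift x as bs) (prep x π)

  irreducible-⊆ : ∀ {X C} → Irreducible C → Unique X → (∀ {b} → b ∈ X → b ∈ C) → 2 ≤ length X → ¬ Mergeable X
  irreducible-⊆ irr U sub two with extract U sub
  ... | Y , π = irr _ Y π two

  unique-total : ∀ {X C} → Unique X → (∀ {b} → b ∈ X → b ∈ C) → total X ≤ total C
  unique-total {X} U sub with extract U sub
  ... | Y , π = subst (total X ≤_) (sym (total-↭ X Y π)) (m≤m+n (total X) (total Y))

  Close : ℕ → Ball → Ball → Set
  Close k b b′ = ∀ x y → x ∈ᵇ b → y ∈ᵇ b′ → d x y ≤ 2 * k

  -- Two vertices of one ball are within twice its strength, so only pairs of different balls need a
  -- hypothesis. In `go` the bound `k` remains the total of the whole list while the list shrinks.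
  close⇒mergeable : ∀ X → AllPairs (Close (total X)) X → Mergeable X
  close⇒mergeable X close x y = go (total X) X close ≤-refl
    where
    one-sided : ∀ {b X x y} k → All (Close k b) X → x ∈ᵇ b → Covers X y → d x y ≤ 2 * k
    one-sided k (c ∷ _) x∈ (here y∈) = c _ _ x∈ y∈
    one-sided k (_ ∷ cs) x∈ (there m) = one-sided k cs x∈ m

    go : ∀ k X → AllPairs (Close k) X → total X ≤ k → Covers X x → Covers X y → d x y ≤ 2 * k
    go k ((c , s) ∷ X) (_ ∷ _) le (here x∈) (here y∈) =
      lin 7 (λ xy xc cy yc s t k → xy ≲ xc ⊕ cy ⇒ cy ≐ yc ⇒ xc ≲ s ⇒ yc ≲ s ⇒ s ⊕ t ≲ k ⇒ ⊢ xy ≲ 2 ⊗ k)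
        (d x y) (d x c) (d c y) (d y c) s (total X) k (d-triangle x c y) (d-sym c y) x∈ y∈ le
    go k (b ∷ X) (cs ∷ _) le (here x∈) (there m) = one-sided k cs x∈ m
    go k (b ∷ X) (cs ∷ _) le (there m) (here y∈) = subst (_≤ 2 * k) (d-sym y x) (one-sided k cs y∈ m)
    go k ((c , s) ∷ X) (_ ∷ close) le (there m) (there m′) = go k X close (≤-trans (m≤n+m _ s) le) m m′

  close-centres : ∀ k {c s c′ s′} → d c c′ + s + s′ ≤ 2 * k → Close k (c , s) (c′ , s′)
  close-centres k {c} {s} {c′} {s′} le x y x∈ y∈ =
    lin 8 (λ xy xc cc′ c′y yc′ s s′ k → xy ≲ xc ⊕ cc′ ⊕ c′y ⇒ c′y ≐ yc′ ⇒ xc ≲ s ⇒ yc′ ≲ s′ ⇒ cc′ ⊕ s ⊕ s′ ≲ 2 ⊗ k ⇒ ⊢ xy ≲ 2 ⊗ k)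
      (d x y) (d x c) (d c c′) (d c′ y) (d y c′) s s′ k (d-triangle₂ x c c′ y) (d-sym c′ y) x∈ y∈ le

  module _ {C : List Ball} (irr : Irreducible C) (pos : Positive C) where

    private
      from₂ : ∀ {P : Ball → Set} {b b′} → P b → P b′ → ∀ {x} → x ∈ b ∷ b′ ∷ [] → P x
      from₂ p p′ (here refl) = p
      from₂ p p′ (there (here refl)) = p′

    no-close-pair : ∀ {b b′} → b ∈ C → b′ ∈ C → b ≢ b′ → ¬ Close (proj₂ b + proj₂ b′) b b′
    no-close-pair {b} {b′} m m′ ne close =
      irreducible-⊆ irr ((ne ∷ []) ∷ [] ∷ []) (from₂ {_∈ C} m m′) (s≤s (s≤s z≤n))
        (close⇒mergeable (b ∷ b′ ∷ [])
          ((subst (λ k → Close k b b′) (cong (proj₂ b +_) (sym (+-identityʳ _))) close ∷ []) ∷ [] ∷ []))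

    no-close-triple : ∀ {b₁ b₂ b₃} → b₁ ∈ C → b₂ ∈ C → b₃ ∈ C → b₁ ≢ b₂ → b₁ ≢ b₃ → b₂ ≢ b₃ →
                      let k = proj₂ b₁ + (proj₂ b₂ + (proj₂ b₃ + 0)) in
                      Close k b₁ b₂ → Close k b₁ b₃ → Close k b₂ b₃ → ⊥
    no-close-triple m₁ m₂ m₃ ne₁₂ ne₁₃ ne₂₃ c₁₂ c₁₃ c₂₃ =
      irreducible-⊆ irr ((ne₁₂ ∷ ne₁₃ ∷ []) ∷ (ne₂₃ ∷ []) ∷ [] ∷ [])
        (λ { (here refl) → m₁ ; (there (here refl)) → m₂ ; (there (there (here refl))) → m₃ }) (s≤s (s≤s z≤n))
        (close⇒mergeable _ ((c₁₂ ∷ c₁₃ ∷ []) ∷ (c₂₃ ∷ []) ∷ [] ∷ []))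

    -- The centres of two intersecting balls are at most s + s′ apart, so their union has diameter
    -- at most 2 (s + s′) and they merge.
    disjoint : ∀ {b b′ x} → b ∈ C → b′ ∈ C → b ≢ b′ → x ∈ᵇ b → x ∈ᵇ b′ → ⊥
    disjoint {c , s} {c′ , s′} {x} m m′ ne x∈ x∈′ = no-close-pair m m′ ne (close-centres (s + s′)
      (lin 6 (λ cc′ cx xc xc′ s s′ → cc′ ≲ cx ⊕ xc′ ⇒ cx ≐ xc ⇒ xc ≲ s ⇒ xc′ ≲ s′ ⇒ ⊢ cc′ ⊕ s ⊕ s′ ≲ 2 ⊗ (s ⊕ s′))
        (d c c′) (d c x) (d x c) (d x c′) s s′ (d-triangle c x c′) (d-sym c x) x∈ x∈′))

    -- Three balls touching a fourth one merge with it: the strength of the third pays for the two gaps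
    -- on the way between the other two.
    no-star : ∀ {c s b₁ b₂ b₃} → (c , s) ∈ C → b₁ ∈ C → b₂ ∈ C → b₃ ∈ C →
              (c , s) ≢ b₁ → (c , s) ≢ b₂ → (c , s) ≢ b₃ → b₁ ≢ b₂ → b₁ ≢ b₃ → b₂ ≢ b₃ →
              d (proj₁ b₁) c ≤ suc (s + proj₂ b₁) → d (proj₁ b₂) c ≤ suc (s + proj₂ b₂) → d (proj₁ b₃) c ≤ suc (s + proj₂ b₃) → ⊥
    no-star {c} {s} {c₁ , s₁} {c₂ , s₂} {c₃ , s₃} m m₁ m₂ m₃ ne₁ ne₂ ne₃ ne₁₂ ne₁₃ ne₂₃ le₁ le₂ le₃ =
      irreducible-⊆ irr ((ne₁ ∷ ne₂ ∷ ne₃ ∷ []) ∷ (ne₁₂ ∷ ne₁₃ ∷ []) ∷ (ne₂₃ ∷ []) ∷ [] ∷ [])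
        (λ { (here refl) → m ; (there (here refl)) → m₁ ; (there (there (here refl))) → m₂
           ; (there (there (there (here refl)))) → m₃ }) (s≤s (s≤s z≤n))
        (close⇒mergeable _ ( (spoke c₁ s₁ s₂ s₃ (pos m₂) le₁ eq₁₂₃ ∷ spoke c₂ s₂ s₁ s₃ (pos m₁) le₂ eq₂₁₃ ∷ spoke c₃ s₃ s₁ s₂ (pos m₁) le₃ eq₃₁₂ ∷ [])
                           ∷ (rim c₁ c₂ s₁ s₂ s₃ (pos m₃) le₁ le₂ eq₁₂₃ ∷ rim c₁ c₃ s₁ s₃ s₂ (pos m₂) le₁ le₃ eq₁₃₂ ∷ [])
                           ∷ (rim c₂ c₃ s₂ s₃ s₁ (pos m₁) le₂ le₃ eq₂₃₁ ∷ []) ∷ [] ∷ []))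
      where
      k : ℕ
      k = s + (s₁ + (s₂ + (s₃ + 0)))
      eq₁₂₃ : k ≡ s + s₁ + s₂ + s₃
      eq₁₂₃ = lin 4 (λ s x y z → ⊢ s ⊕ (x ⊕ (y ⊕ (z ⊕ κ 0))) ≐ s ⊕ x ⊕ y ⊕ z) s s₁ s₂ s₃
      eq₁₃₂ : k ≡ s + s₁ + s₃ + s₂
      eq₁₃₂ = lin 4 (λ s x y z → ⊢ s ⊕ (x ⊕ (y ⊕ (z ⊕ κ 0))) ≐ s ⊕ x ⊕ z ⊕ y) s s₁ s₂ s₃
      eq₂₁₃ : k ≡ s + s₂ + s₁ + s₃
      eq₂₁₃ = lin 4 (λ s x y z → ⊢ s ⊕ (x ⊕ (y ⊕ (z ⊕ κ 0))) ≐ s ⊕ y ⊕ x ⊕ z) s s₁ s₂ s₃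
      eq₂₃₁ : k ≡ s + s₂ + s₃ + s₁
      eq₂₃₁ = lin 4 (λ s x y z → ⊢ s ⊕ (x ⊕ (y ⊕ (z ⊕ κ 0))) ≐ s ⊕ y ⊕ z ⊕ x) s s₁ s₂ s₃
      eq₃₁₂ : k ≡ s + s₃ + s₁ + s₂
      eq₃₁₂ = lin 4 (λ s x y z → ⊢ s ⊕ (x ⊕ (y ⊕ (z ⊕ κ 0))) ≐ s ⊕ z ⊕ x ⊕ y) s s₁ s₂ s₃
      spoke : ∀ c′ s₁ s₂ s₃ → 0 < s₂ → d c′ c ≤ suc (s + s₁) → k ≡ s + s₁ + s₂ + s₃ → Close k (c , s) (c′ , s₁)
      spoke c′ s₁ s₂ s₃ p le eq = close-centres k
        (lin 7 (λ cc′ c′c s s₁ s₂ s₃ k → cc′ ≐ c′c ⇒ κ 1 ≲ s₂ ⇒ c′c ≲ κ 1 ⊕ (s ⊕ s₁) ⇒ k ≐ s ⊕ s₁ ⊕ s₂ ⊕ s₃ ⇒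
                  ⊢ cc′ ⊕ s ⊕ s₁ ≲ 2 ⊗ k)
          (d c c′) (d c′ c) s s₁ s₂ s₃ k (d-sym c c′) p le eq)
      rim : ∀ c₁ c₂ s₁ s₂ s₃ → 0 < s₃ → d c₁ c ≤ suc (s + s₁) → d c₂ c ≤ suc (s + s₂) → k ≡ s + s₁ + s₂ + s₃ →
            Close k (c₁ , s₁) (c₂ , s₂)
      rim c₁ c₂ s₁ s₂ s₃ p le₁ le₂ eq = close-centres k
        (lin 9 (λ c₁₂ c₁ c₂′ c₂ s s₁ s₂ s₃ k → c₁₂ ≲ c₁ ⊕ c₂′ ⇒ c₂′ ≐ c₂ ⇒ κ 1 ≲ s₃ ⇒ c₁ ≲ κ 1 ⊕ (s ⊕ s₁) ⇒ c₂ ≲ κ 1 ⊕ (s ⊕ s₂) ⇒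
                  k ≐ s ⊕ s₁ ⊕ s₂ ⊕ s₃ ⇒ ⊢ c₁₂ ⊕ s₁ ⊕ s₂ ≲ 2 ⊗ k)
          (d c₁ c₂) (d c₁ c) (d c c₂) (d c₂ c) s s₁ s₂ s₃ k (d-triangle c₁ c c₂) (d-sym c c₂) p le₁ le₂ eq)

-- Positions and heights over a diametrical path, and fillings of the path

module DiametralLine {n : ℕ} (T : Graph n) (tree : IsTree T) (D : ℕ) (ℓ : TreeDistance.Line T tree D)
                     (diam : ∀ x y → TreeDistance.d T tree x y ≤ D) where

  open Balls T tree
  open TreeDistance T tree
  open Line ℓ

  pos : Fin n → ℕ
  pos z = proj₁ (coordinates ℓ z)

  ht : Fin n → ℕ
  ht z = proj₁ (proj₂ (coordinates ℓ z))

  pos≤D : ∀ z → pos z ≤ D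
  pos≤D z = proj₁ (proj₂ (proj₂ (coordinates ℓ z)))

  d-left : ∀ z i → i ≤ pos z → d z (p i) + i ≡ ht z + pos z
  d-left z = proj₁ (proj₂ (proj₂ (proj₂ (coordinates ℓ z))))

  d-right : ∀ z i → pos z ≤ i → i ≤ D → d z (p i) + pos z ≡ ht z + i
  d-right z = proj₂ (proj₂ (proj₂ (proj₂ (coordinates ℓ z))))

  -- Otherwise `z` would be at distance more than `D` from the end `p D`.
  ht≤pos : ∀ z → ht z ≤ pos z
  ht≤pos z = lin 4 (λ zp a h D → zp ⊕ a ≐ h ⊕ D ⇒ zp ≲ D ⇒ ⊢ h ≲ a) (d z (p D)) (pos z) (ht z) D
               (d-right z D (pos≤D z) ≤-refl) (diam z (p D))

  ht+pos≤D : ∀ z → ht z + pos z ≤ D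
  ht+pos≤D z = lin 4 (λ zp a h D → zp ⊕ κ 0 ≐ h ⊕ a ⇒ zp ≲ D ⇒ ⊢ h ⊕ a ≲ D) (d z (p 0)) (pos z) (ht z) D
                 (d-left z 0 z≤n) (diam z (p 0))

  pos-p×ht-p : ∀ i → i ≤ D → pos (p i) ≡ i × ht (p i) ≡ 0
  pos-p×ht-p i i≤D with ≤-total i (pos (p i))
  ... | inj₁ i≤ =
    lin 4 (λ q i h a → q ≐ κ 0 ⇒ q ⊕ i ≐ h ⊕ a ⇒ i ≲ a ⇒ ⊢ a ≐ i) (d (p i) (p i)) i (ht (p i)) (pos (p i)) (d-refl (p i)) (d-left (p i) i i≤) i≤ ,
    lin 4 (λ q i h a → q ≐ κ 0 ⇒ q ⊕ i ≐ h ⊕ a ⇒ i ≲ a ⇒ ⊢ h ≐ κ 0) (d (p i) (p i)) i (ht (p i)) (pos (p i)) (d-refl (p i)) (d-left (p i) i i≤) i≤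
  ... | inj₂ ≤i =
    lin 4 (λ q i h a → q ≐ κ 0 ⇒ q ⊕ a ≐ h ⊕ i ⇒ a ≲ i ⇒ ⊢ a ≐ i) (d (p i) (p i)) i (ht (p i)) (pos (p i)) (d-refl (p i)) (d-right (p i) i ≤i i≤D) ≤i ,
    lin 4 (λ q i h a → q ≐ κ 0 ⇒ q ⊕ a ≐ h ⊕ i ⇒ a ≲ i ⇒ ⊢ h ≐ κ 0) (d (p i) (p i)) i (ht (p i)) (pos (p i)) (d-refl (p i)) (d-right (p i) i ≤i i≤D) ≤i

  pos-p : ∀ {i} → i ≤ D → pos (p i) ≡ i
  pos-p i≤D = proj₁ (pos-p×ht-p _ i≤D)

  ht-p : ∀ {i} → i ≤ D → ht (p i) ≡ 0
  ht-p i≤D = proj₂ (pos-p×ht-p _ i≤D)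

  d-foot : ∀ z → d z (p (pos z)) ≡ ht z
  d-foot z = +-cancelʳ-≡ (pos z) _ _ (d-left z (pos z) ≤-refl)

  foot : ∀ z → ht z ≡ 0 → z ≡ p (pos z)
  foot z eq = d≡0⇒≡ (trans (d-foot z) eq)

  d-p : ∀ {i j} → i ≤ j → j ≤ D → i + d (p i) (p j) ≡ j
  d-p {i} {j} i≤j j≤D = lin 5 (λ a h i j x → a ≐ i ⇒ h ≐ κ 0 ⇒ x ⊕ a ≐ h ⊕ j ⇒ ⊢ i ⊕ x ≐ j)
    (pos (p i)) (ht (p i)) i j (d (p i) (p j)) (pos-p i≤D) (ht-p i≤D) (d-right (p i) j (subst (_≤ j) (sym (pos-p i≤D)) i≤j) j≤D)
    where
    i≤D : i ≤ D
    i≤D = ≤-trans i≤j j≤D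

  -- A walk between vertices hanging over different points passes through those points.
  apart : ∀ {x y} → pos x < pos y → ht x + pos y + ht y ≤ d x y + pos x
  apart {x} {y} lt = conclude (four-point x y (p 0) (p D))
    where
    xD : d x (p D) + pos x ≡ ht x + D
    xD = d-right x D (pos≤D x) ≤-refl
    x0 : d x (p 0) + 0 ≡ ht x + pos x
    x0 = d-left x 0 z≤n
    yD : d y (p D) + pos y ≡ ht y + D
    yD = d-right y D (pos≤D y) ≤-refl
    y0 : d y (p 0) + 0 ≡ ht y + pos y
    y0 = d-left y 0 z≤n
    conclude : d x (p D) + d y (p 0) ≤ d x y + d (p D) (p 0) ⊎ d x (p D) + d y (p 0) ≤ d x (p 0) + d (p D) y → _
    conclude (inj₁ le) =
      lin 9 (λ xD y0 xy D0 D a h b k → xD ⊕ y0 ≲ xy ⊕ D0 ⇒ xD ⊕ a ≐ h ⊕ D ⇒ y0 ⊕ κ 0 ≐ k ⊕ b ⇒ D0 ≲ D ⇒ ⊢ h ⊕ b ⊕ k ≲ xy ⊕ a)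
        (d x (p D)) (d y (p 0)) (d x y) (d (p D) (p 0)) D (pos x) (ht x) (pos y) (ht y) le xD y0 (diam (p D) (p 0))
    conclude (inj₂ le) = ⊥-elim
      (lin 10 (λ xD y0 x0 Dy yD D a h b k → xD ⊕ y0 ≲ x0 ⊕ Dy ⇒ Dy ≐ yD ⇒ xD ⊕ a ≐ h ⊕ D ⇒ y0 ⊕ κ 0 ≐ k ⊕ b ⇒ x0 ⊕ κ 0 ≐ h ⊕ a ⇒
                yD ⊕ b ≐ k ⊕ D ⇒ κ 1 ⊕ a ≲ b ⇒ ⊢⊥)
        (d x (p D)) (d y (p 0)) (d x (p 0)) (d (p D) y) (d y (p D)) D (pos x) (ht x) (pos y) (ht y) le (d-sym (p D) y) xD y0 x0 yD lt)

  -- What hangs over `pos y` can be entered from elsewhere only through its foot.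
  through : ∀ {x y} → pos x ≢ pos y → d x (p (pos y)) + ht y ≤ d x y
  through {x} {y} ne with <-cmp (pos x) (pos y)
  ... | tri< lt _ _ = lin 6 (λ a h b k xy xp → h ⊕ b ⊕ k ≲ xy ⊕ a ⇒ xp ⊕ a ≐ h ⊕ b ⇒ ⊢ xp ⊕ k ≲ xy)
                        (pos x) (ht x) (pos y) (ht y) (d x y) (d x (p (pos y))) (apart lt) (d-right x (pos y) (<⇒≤ lt) (pos≤D y))
  ... | tri≈ _ eq _ = ⊥-elim (ne eq)
  ... | tri> _ _ gt = lin 7 (λ a h b k xy yx xp → k ⊕ a ⊕ h ≲ yx ⊕ b ⇒ xp ⊕ b ≐ h ⊕ a ⇒ yx ≐ xy ⇒ ⊢ xp ⊕ k ≲ xy)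
                        (pos x) (ht x) (pos y) (ht y) (d x y) (d y x) (d x (p (pos y))) (apart gt) (d-left x (pos y) (<⇒≤ gt)) (d-sym y x)

  infix 4 _within_,_
  _within_,_ : Fin n → ℕ → ℕ → Set
  z within j , k = j ≤ pos z × pos z ≤ k

  -- The path from `z` to the centre continues to the end of the stretch on the far side, which is
  -- `s` further away.
  d-centre : ∀ {z j s} → z within j , j + 2 * s → j + 2 * s ≤ D → d z (p j) ≤ 2 * s → d z (p (j + 2 * s)) ≤ 2 * s → d z (p (j + s)) ≤ s
  d-centre {z} {j} {s} (j≤ , ≤k) k≤D le₁ le₂ with ≤-total (j + s) (pos z)
  ... | inj₁ ≤a = lin 6 (λ x y a h j s → x ⊕ (j ⊕ s) ≐ h ⊕ a ⇒ y ⊕ j ≐ h ⊕ a ⇒ y ≲ 2 ⊗ s ⇒ ⊢ x ≲ s)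
                    (d z (p (j + s))) (d z (p j)) (pos z) (ht z) j s (d-left z (j + s) ≤a) (d-left z j j≤) le₁
  ... | inj₂ a≤ = lin 6 (λ x y a h j s → x ⊕ a ≐ h ⊕ (j ⊕ s) ⇒ y ⊕ a ≐ h ⊕ (j ⊕ 2 ⊗ s) ⇒ y ≲ 2 ⊗ s ⇒ ⊢ x ≲ s)
                    (d z (p (j + s))) (d z (p (j + 2 * s))) (pos z) (ht z) j s
                    (d-right z (j + s) a≤ (≤-trans (+-monoʳ-≤ j (m≤m+n s _)) k≤D)) (d-right z (j + 2 * s) ≤k k≤D) le₂

  p-centre : ∀ {i j s} → j ≤ i → i ≤ j + 2 * s → j + 2 * s ≤ D → d (p i) (p (j + s)) ≤ s
  p-centre {i} {j} {s} j≤i i≤k k≤D with ≤-total (j + s) i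
  ... | inj₁ ≤i = lin 5 (λ x y i j s → (j ⊕ s) ⊕ x ≐ i ⇒ y ≐ x ⇒ i ≲ j ⊕ 2 ⊗ s ⇒ ⊢ y ≲ s) (d (p (j + s)) (p i)) (d (p i) (p (j + s))) i j s
                    (d-p ≤i (≤-trans i≤k k≤D)) (d-sym (p i) (p (j + s))) i≤k
  ... | inj₂ i≤ = lin 4 (λ x i j s → i ⊕ x ≐ j ⊕ s ⇒ j ≲ i ⇒ ⊢ x ≲ s) (d (p i) (p (j + s))) i j s
                    (d-p i≤ (≤-trans (+-monoʳ-≤ j (m≤m+n s _)) k≤D)) j≤i

  Filled : ℕ → ℕ → Set
  Filled j s = ∀ z → z within j , j + 2 * s → z ∈ᵇ (p (j + s) , s)

  near-centre⇒within : ∀ {z j s} → j + 2 * s ≤ D → z ∈ᵇ (p (j + s) , s) → z within j , j + 2 * s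
  near-centre⇒within {z} {j} {s} k≤D le with ≤-total (j + s) (pos z)
  ... | inj₁ ≤a = ≤-trans (m≤m+n j s) ≤a ,
    lin 5 (λ x a h j s → x ⊕ (j ⊕ s) ≐ h ⊕ a ⇒ x ≲ s ⇒ ⊢ a ≲ j ⊕ 2 ⊗ s) (d z (p (j + s))) (pos z) (ht z) j s (d-left z (j + s) ≤a) le
  ... | inj₂ a≤ =
    lin 5 (λ x a h j s → x ⊕ a ≐ h ⊕ (j ⊕ s) ⇒ x ≲ s ⇒ ⊢ j ≲ a) (d z (p (j + s))) (pos z) (ht z) j s
      (d-right z (j + s) a≤ (≤-trans (+-monoʳ-≤ j (m≤m+n s _)) k≤D)) le ,
    ≤-trans a≤ (+-monoʳ-≤ j (m≤m+n s _))

  via-foot : ∀ x {i} → i ≤ D → d x (p i) ≡ ht x + d (p (pos x)) (p i)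
  via-foot x {i} i≤D with ≤-total i (pos x)
  ... | inj₁ i≤ = lin 6 (λ x h a i u v → x ⊕ i ≐ h ⊕ a ⇒ i ⊕ u ≐ a ⇒ v ≐ u ⇒ ⊢ x ≐ h ⊕ v)
                    (d x (p i)) (ht x) (pos x) i (d (p i) (p (pos x))) (d (p (pos x)) (p i))
                    (d-left x i i≤) (d-p i≤ (pos≤D x)) (d-sym (p (pos x)) (p i))
  ... | inj₂ ≤i = lin 5 (λ x h a i u → x ⊕ a ≐ h ⊕ i ⇒ a ⊕ u ≐ i ⇒ ⊢ x ≐ h ⊕ u)
                    (d x (p i)) (ht x) (pos x) i (d (p (pos x)) (p i)) (d-right x i ≤i i≤D) (d-p ≤i i≤D)

  -- A sequence of consecutive tiles from position j to the end of the line; a tile of strength s spans 2 s edges,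
  -- is followed by one edge that belongs to no tile, and everything hanging over it lies in the ball at its centre.
  data Filling : ℕ → List ℕ → Set where
    last : ∀ {j s} → 0 < s → j + 2 * s ≡ D → Filled j s → Filling j (s ∷ [])
    next : ∀ {j s ss} → 0 < s → j + 2 * s < D → Filled j s → Filling (suc (j + 2 * s)) ss → Filling j (s ∷ ss)

  -- The last two indices are the left end and the strength of a tile in the sequence that starts at
  -- `j`. A sequence stores strengths only, so left ends are recomputed from them.
  data Tile : ℕ → List ℕ → ℕ → ℕ → Set where
    here  : ∀ {j s ss} → Tile j (s ∷ ss) j s
    there : ∀ {j s ss l t} → Tile (suc (j + 2 * s)) ss l t → Tile j (s ∷ ss) l t

  -- A tile of strength s occupies 2 s + 1 of the positions 0, ..., D. For `j` = 0 this turns cost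
  -- into cuts: tiles of total strength q with m edges between them satisfy D = 2 q + m.
  filling-length : ∀ {j ss} → Filling j ss → j + 2 * sum ss + length ss ≡ suc D
  filling-length {j} (last {s = s} _ eq _) = lin 3 (λ j s D → j ⊕ 2 ⊗ s ≐ D ⇒ ⊢ j ⊕ 2 ⊗ (s ⊕ κ 0) ⊕ κ 1 ≐ κ 1 ⊕ D) j s D eq
  filling-length {j} (next {s = s} {ss} _ _ _ F) =
    lin 5 (λ j s t l D → κ 1 ⊕ (j ⊕ 2 ⊗ s) ⊕ 2 ⊗ t ⊕ l ≐ κ 1 ⊕ D ⇒ ⊢ j ⊕ 2 ⊗ (s ⊕ t) ⊕ (κ 1 ⊕ l) ≐ κ 1 ⊕ D)
      j s (sum ss) (length ss) D (filling-length F)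

  tile-filled : ∀ {j ss l t} → Filling j ss → Tile j ss l t → 0 < t × l + 2 * t ≤ D × Filled l t
  tile-filled (last 0<s eq f) here = 0<s , ≤-reflexive eq , f
  tile-filled (next 0<s lt f _) here = 0<s , <⇒≤ lt , f
  tile-filled (next _ _ _ F) (there t) = tile-filled F t

  tile-≥ : ∀ {j ss l t} → Tile j ss l t → j ≤ l
  tile-≥ here = ≤-refl
  tile-≥ {j} (there t) = ≤-trans (≤-trans (m≤m+n j _) (n≤1+n _)) (tile-≥ t)

  find-tile : ∀ {j ss} → Filling j ss → ∀ z → j ≤ pos z → ∃[ l ] ∃[ t ] (Tile j ss l t × z within l , l + 2 * t)
  find-tile (last {j} {s} _ eq _) z j≤ = j , s , here , j≤ , subst (pos z ≤_) (sym eq) (pos≤D z)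
  find-tile (next {j} {s} _ _ _ F) z j≤ with ≤-<-connex (pos z) (j + 2 * s)
  ... | inj₁ ≤k = j , s , here , j≤ , ≤k
  ... | inj₂ k< with find-tile F z k<
  ...   | l , t , tile , in-tile = l , t , there tile , in-tile

  tile-unique : ∀ {j ss l t l′ t′ z} → Tile j ss l t → Tile j ss l′ t′ → z within l , l + 2 * t → z within l′ , l′ + 2 * t′ → l ≡ l′ × t ≡ t′
  tile-unique here here _ _ = refl , refl
  tile-unique here (there t) (_ , ≤k) (l≤ , _) = ⊥-elim (<⇒≱ (≤-trans (tile-≥ t) l≤) ≤k)
  tile-unique (there t) here (l≤ , _) (_ , ≤k) = ⊥-elim (<⇒≱ (≤-trans (tile-≥ t) l≤) ≤k)
  tile-unique (there t) (there t′) in₁ in₂ = tile-unique t t′ in₁ in₂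

-- An irreducible cheap covering is a row of tiles

module Tiling {n : ℕ} (T : Graph n) (tree : IsTree T) (D : ℕ) (ℓ : TreeDistance.Line T tree D)
              (diam : ∀ x y → TreeDistance.d T tree x y ≤ D)
              (C : List (Balls.Ball T tree)) (irr : Balls.Irreducible T tree C) (positive : Balls.Positive T tree C)
              (cover : ∀ x → ∃[ b ] (b ∈ C × Balls._∈ᵇ_ T tree x b)) (cheap : 2 * Balls.total T tree C < D) where

  open DiametralLine T tree D ℓ diam
  open Balls T tree
  open TreeDistance T tree
  open Line ℓ

  -- Let q = `p (suc e)`. A vertex x of the ball hangs over a position up to `e`, since otherwise
  -- the ball would contain q. If `e` were less than 2 s, then `ht≤pos` would put x within 2 s of q.
  -- Every vertex of `b′` is within twice its own strength of q, so the two balls would merge.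
  first-long : ∀ {c s b′ e} → (c , s) ∈ C → b′ ∈ C → (c , s) ≢ b′ → pos c ≤ e → e < D →
               ¬ p (suc e) ∈ᵇ (c , s) → p (suc e) ∈ᵇ b′ → 2 * s ≤ e
  first-long {c} {s} {c′ , s′} {e} m m′ ne c≤e e<D out in′ = decidable-stable (2 * s ≤? e) λ ≰ →
    let q = p (suc e)
        far = subst (s <_) (d-sym q c) (≰⇒> out)
        to-q = λ x (x∈ : x ∈ᵇ (c , s)) → either {C = d x q ≤ 2 * s}
          (λ x≤e → lin 5 (λ xq a h e s → xq ⊕ a ≐ h ⊕ (κ 1 ⊕ e) ⇒ h ≲ a ⇒ κ 1 ⊕ e ≲ 2 ⊗ s ⇒ ⊢ xq ≲ 2 ⊗ s)
                     (d x q) (pos x) (ht x) e s (d-right x (suc e) (m≤n⇒m≤1+n x≤e) e<D) (ht≤pos x) (≰⇒> ≰))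
          (λ e<x → ⊥-elim
            (lin 9 (λ a h b k cx xc cq e s → h ⊕ b ⊕ k ≲ cx ⊕ a ⇒ cq ⊕ a ≐ h ⊕ (κ 1 ⊕ e) ⇒ κ 1 ⊕ s ≲ cq ⇒ cx ≐ xc ⇒ xc ≲ s ⇒ κ 1 ⊕ e ≲ b ⇒ ⊢⊥)
              (pos c) (ht c) (pos x) (ht x) (d c x) (d x c) (d c q) e s (apart (≤-trans (s≤s c≤e) e<x))
              (d-right c (suc e) (m≤n⇒m≤1+n c≤e) e<D) far (d-sym c x) x∈ e<x)) (≤-<-connex (pos x) e)
    in no-close-pair irr positive m m′ ne λ x y x∈ y∈ →
      lin 7 (λ xy xq qc c′y yc′ s s′ → xy ≲ xq ⊕ qc ⊕ c′y ⇒ c′y ≐ yc′ ⇒ xq ≲ 2 ⊗ s ⇒ qc ≲ s′ ⇒ yc′ ≲ s′ ⇒ ⊢ xy ≲ 2 ⊗ (s ⊕ s′))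
        (d x y) (d x q) (d q c′) (d c′ y) (d y c′) s s′ (d-triangle₂ x q c′ y) (d-sym c′ y) (to-q x x∈) in′ y∈

  -- Mirror image of `first-long`, with `ht+pos≤D` in place of `ht≤pos`.
  last-long : ∀ {c s b′ i} → (c , s) ∈ C → b′ ∈ C → (c , s) ≢ b′ → suc i ≤ pos c →
              ¬ p i ∈ᵇ (c , s) → p i ∈ᵇ b′ → 2 * s + suc i ≤ D
  last-long {c} {s} {c′ , s′} {i} m m′ ne i<c out in′ = decidable-stable (2 * s + suc i ≤? D) λ ≰ →
    let q = p i
        far = subst (s <_) (d-sym q c) (≰⇒> out)
        to-q = λ x (x∈ : x ∈ᵇ (c , s)) → either {C = d x q ≤ 2 * s}
          (λ x≤i → ⊥-elim
            (lin 8 (λ a h b k xc cq i s → k ⊕ a ⊕ h ≲ xc ⊕ b ⇒ cq ⊕ i ≐ h ⊕ a ⇒ κ 1 ⊕ s ≲ cq ⇒ xc ≲ s ⇒ b ≲ i ⇒ ⊢⊥)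
              (pos c) (ht c) (pos x) (ht x) (d x c) (d c q) i s (apart (≤-trans (s≤s x≤i) i<c))
              (d-left c i (<⇒≤ i<c)) far x∈ x≤i))
          (λ i<x → lin 6 (λ xq a h i s D → xq ⊕ i ≐ h ⊕ a ⇒ h ⊕ a ≲ D ⇒ κ 1 ⊕ D ≲ 2 ⊗ s ⊕ (κ 1 ⊕ i) ⇒ ⊢ xq ≲ 2 ⊗ s)
                      (d x q) (pos x) (ht x) i s D (d-left x i (<⇒≤ i<x)) (ht+pos≤D x) (≰⇒> ≰)) (≤-<-connex (pos x) i)
    in no-close-pair irr positive m m′ ne λ x y x∈ y∈ →
      lin 7 (λ xy xq qc c′y yc′ s s′ → xy ≲ xq ⊕ qc ⊕ c′y ⇒ c′y ≐ yc′ ⇒ xq ≲ 2 ⊗ s ⇒ qc ≲ s′ ⇒ yc′ ≲ s′ ⇒ ⊢ xy ≲ 2 ⊗ (s ⊕ s′))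
        (d x y) (d x q) (d q c′) (d c′ y) (d y c′) s s′ (d-triangle₂ x q c′ y) (d-sym c′ y) (to-q x x∈) in′ y∈

  -- The equation says that `e` is the last position reached by the middle ball. A centre at height
  -- h loses h positions on either side, so h > 0 makes up for the two edges between the middle ball
  -- and its neighbours: the outer balls are close. A middle and an outer ball are separated by one
  -- edge, for which the strength of the third ball pays.
  middle-flat : ∀ {b₀ c s b′ i e} → b₀ ∈ C → (c , s) ∈ C → b′ ∈ C → b₀ ≢ (c , s) → b₀ ≢ b′ → (c , s) ≢ b′ →
                suc i ≤ pos c → p i ∈ᵇ b₀ → p (suc i) ∈ᵇ (c , s) →
                e + ht c ≡ pos c + s → pos c ≤ e → e < D → p (suc e) ∈ᵇ b′ → ht c ≡ 0
  middle-flat {c₀ , s₀} {c} {s} {c′ , s′} {i} {e} m₀ m m′ ne₀ ne₀′ ne i<c in₀ in₁ end c≤e e<D in′ = decidable-stable (ht c ≟ 0) λ h≢0 →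
    let i≤e = ≤-trans (<⇒≤ i<c) c≤e
        in₀′ = subst (_≤ s₀) (d-sym (p i) c₀) in₀
        in₁′ = subst (_≤ s) (d-sym (p (suc i)) c) in₁
        k = s₀ + (s + (s′ + 0))
    in no-close-triple irr positive m₀ m m′ ne₀ ne₀′ ne
      (close-centres k
        (lin 8 (λ c₀c c₀q one rc s₀ s s′ i → c₀c ≲ c₀q ⊕ one ⊕ rc ⇒ c₀q ≲ s₀ ⇒ i ⊕ one ≐ κ 1 ⊕ i ⇒ rc ≲ s ⇒ κ 1 ≲ s′ ⇒
                     ⊢ c₀c ⊕ s₀ ⊕ s ≲ 2 ⊗ (s₀ ⊕ (s ⊕ (s′ ⊕ κ 0))))
           (d c₀ c) (d c₀ (p i)) (d (p i) (p (suc i))) (d (p (suc i)) c) s₀ s s′ i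
           (d-triangle₂ c₀ (p i) (p (suc i)) c) in₀′ (d-p (n≤1+n i) (≤-trans (s≤s i≤e) e<D)) in₁ (positive m′)))
      (close-centres k
        (lin 12 (λ c₀c′ c₀q qr rc′ s₀ s s′ i e cr h a → c₀c′ ≲ c₀q ⊕ qr ⊕ rc′ ⇒ c₀q ≲ s₀ ⇒ i ⊕ qr ≐ κ 1 ⊕ e ⇒ rc′ ≲ s′ ⇒
                       cr ≲ s ⇒ cr ⊕ (κ 1 ⊕ i) ≐ h ⊕ a ⇒ e ⊕ h ≐ a ⊕ s ⇒ κ 1 ≲ h ⇒
                       ⊢ c₀c′ ⊕ s₀ ⊕ s′ ≲ 2 ⊗ (s₀ ⊕ (s ⊕ (s′ ⊕ κ 0))))
           (d c₀ c′) (d c₀ (p i)) (d (p i) (p (suc e))) (d (p (suc e)) c′) s₀ s s′ i e (d c (p (suc i))) (ht c) (pos c)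
           (d-triangle₂ c₀ (p i) (p (suc e)) c′) in₀′ (d-p (m≤n⇒m≤1+n i≤e) e<D) in′ in₁′ (d-left c (suc i) i<c) end (n≢0⇒n>0 h≢0)))
      (close-centres k
        (lin 9 (λ cc′ cr rc′ s₀ s s′ e h a → cc′ ≲ cr ⊕ rc′ ⇒ rc′ ≲ s′ ⇒ cr ⊕ a ≐ h ⊕ (κ 1 ⊕ e) ⇒ e ⊕ h ≐ a ⊕ s ⇒ κ 1 ≲ s₀ ⇒
                     ⊢ cc′ ⊕ s ⊕ s′ ≲ 2 ⊗ (s₀ ⊕ (s ⊕ (s′ ⊕ κ 0))))
           (d c c′) (d c (p (suc e))) (d (p (suc e)) c′) s₀ s s′ e (ht c) (pos c)
           (d-triangle c (p (suc e)) c′) in′ (d-right c (suc e) (m≤n⇒m≤1+n c≤e) e<D) end (positive m₀)))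

  module _ {j s : ℕ} (m : (p (j + s) , s) ∈ C) (k≤D : j + 2 * s ≤ D) where

    -- If the central ball of a tile misses a vertex `z` over it, another ball must cover the
    -- beginning of the missed part. That ball touches the central one, and by disjointness it
    -- cannot contain the foot of `z`, so it stays within the branch over `pos z`.
    record Hanging (z : Fin n) : Set where
      field
        w     : Fin n
        r     : ℕ
        in-C  : (w , r) ∈ C
        other : (p (j + s) , s) ≢ (w , r)
        touch : d w (p (j + s)) ≤ suc (s + r)
        above : ∀ x → x ∈ᵇ (w , r) → pos x ≡ pos z

      avoids : ∀ {i b′} → i ≤ D → p i ∈ᵇ b′ → i ≢ pos z → (w , r) ≢ b′
      avoids i≤D in′ ne refl = ne (trans (sym (pos-p i≤D)) (above _ in′))

    private
      c≤D : j + s ≤ D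
      c≤D = ≤-trans (+-monoʳ-≤ j (m≤m+n s _)) k≤D

      first-outside : ∀ z → z within j , j + 2 * s → ¬ z ∈ᵇ (p (j + s) , s) → ∃[ y ] (pos y ≡ pos z × d y (p (j + s)) ≡ suc s)
      first-outside z (j≤ , ≤k) out =
        let q = p (pos z)
            o = p (j + s)
            q∈b = p-centre j≤ ≤k k≤D
            -- The foot `q` lies in the ball around `o`; `t` steps up the branch from there lead to
            -- distance exactly `suc s` from `o`.
            t = suc s ∸ d q o
            t+ = m∸n+n≡m (m≤n⇒m≤1+n q∈b)
            qz = trans (d-sym q z) (d-foot z)
            (y , qy , yz) = between q z t (lin 6 (λ t x s zo zq qz → t ⊕ x ≐ κ 1 ⊕ s ⇒ κ 1 ⊕ s ≲ zo ⇒ zo ≲ zq ⊕ x ⇒ zq ≐ qz ⇒ ⊢ t ≲ qz)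
                                 t (d q o) s (d z o) (d z q) (d q z) t+ (≰⇒> out) (d-triangle z q o) (d-sym z q))
            pos-y = decidable-stable (pos y ≟ pos z) λ ne →
              lin 7 (λ yf h yz t qz x s → yf ⊕ h ≲ yz ⇒ t ⊕ yz ≐ qz ⇒ qz ≐ h ⇒ t ⊕ x ≐ κ 1 ⊕ s ⇒ x ≲ s ⇒ ⊢⊥)
                (d y q) (ht z) (d y z) t (d q z) (d q o) s (through ne) yz qz t+ q∈b
            yo = lin 7 (λ yo hy x yq qy t s → yo ≐ hy ⊕ x ⇒ yq ≐ hy ⇒ yq ≐ qy ⇒ qy ≐ t ⇒ t ⊕ x ≐ κ 1 ⊕ s ⇒ ⊢ yo ≐ κ 1 ⊕ s)
               (d y o) (ht y) (d q o) (d y q) (d q y) t s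
               (subst (λ i → d y o ≡ ht y + d (p i) o) pos-y (via-foot y c≤D)) (subst (λ i → d y (p i) ≡ ht y) pos-y (d-foot y))
               (d-sym y q) qy t+
        in y , pos-y , yo

    hanging : ∀ z → z within j , j + 2 * s → ¬ z ∈ᵇ (p (j + s) , s) → Hanging z
    hanging z z-in@(j≤ , ≤k) out =
      let q = p (pos z)
          o = p (j + s)
          (y , pos-y , yo) = first-outside z z-in out
          ((w , r) , m′ , y∈) = cover y
          other = λ (eq : (o , s) ≡ (w , r)) → <⇒≱ (≤-reflexive (sym yo)) (subst (y ∈ᵇ_) (sym eq) y∈)
          q∉w = λ (q∈w : d q w ≤ r) → disjoint irr positive m m′ other (p-centre j≤ ≤k k≤D) q∈w
          -- A centre over another position could reach `y` only through `q`, which would then lie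
          -- in two balls.
          pos-w = decidable-stable (pos w ≟ pos z) λ ne → q∉w
            (lin 6 (λ qw wq h wy yw r → qw ≐ wq ⇒ wq ⊕ h ≲ wy ⇒ wy ≐ yw ⇒ yw ≲ r ⇒ ⊢ qw ≲ r)
               (d q w) (d w q) (ht y) (d w y) (d y w) r (d-sym q w)
               (subst (λ i → d w (p i) + ht y ≤ d w y) pos-y (through (λ eq → ne (trans eq pos-y)))) (d-sym w y) y∈)
      in record
        { w = w ; r = r ; in-C = m′ ; other = other
        ; touch = lin 6 (λ wo wy yw yo s r → wo ≲ wy ⊕ yo ⇒ wy ≐ yw ⇒ yw ≲ r ⇒ yo ≐ κ 1 ⊕ s ⇒ ⊢ wo ≲ κ 1 ⊕ (s ⊕ r))
                    (d w o) (d w y) (d y w) (d y o) s r (d-triangle w y o) (d-sym w y) y∈ yo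
        ; above = λ x x∈ → decidable-stable (pos x ≟ pos z) λ ne → q∉w
            (lin 6 (λ qw h wq xf xw r → wq ≐ h ⇒ qw ≐ wq ⇒ xf ⊕ h ≲ xw ⇒ xw ≲ r ⇒ ⊢ qw ≲ r)
                        (d q w) (ht w) (d w q) (d x q) (d x w) r (subst (λ i → d w (p i) ≡ ht w) pos-w (d-foot w)) (d-sym q w)
                        (subst (λ i → d x (p i) + ht w ≤ d x w) pos-w (through (λ eq → ne (trans eq pos-w)))) x∈)
        }

    -- For a tile at an end of P the diameter bounds the heights, which is the source of the last
    -- hypothesis: all that hangs over the tile, in particular a hanging ball, is within 2 s + 1 of
    -- the neighbouring position `p i`. Then the hanging ball, the tile and the neighbour would
    -- merge.
    filled-end : ∀ {i b′} → i ≤ D → b′ ∈ C → (p (j + s) , s) ≢ b′ → p i ∈ᵇ b′ → d (p i) (p (j + s)) ≤ suc s →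
                 (∀ z → z within j , j + 2 * s → i ≢ pos z) →
                 (∀ z → z within j , j + 2 * s → d z (p i) ≤ suc (2 * s)) → Filled j s
    filled-end {i} {c′ , s′} i≤D m′ ne in′ touch′ apart-i end z within-z = decidable-stable (d z (p (j + s)) ≤? s) λ out →
      let open Hanging (hanging z within-z out)
          k = r + (s + (s′ + 0))
          o = p (j + s)
      in no-close-triple irr positive in-C m m′ (λ eq → other (sym eq)) (avoids i≤D in′ (apart-i z within-z)) ne
        (close-centres k
          (lin 4 (λ wo r s s′ → wo ≲ κ 1 ⊕ (s ⊕ r) ⇒ κ 1 ≲ s′ ⇒ ⊢ wo ⊕ r ⊕ s ≲ 2 ⊗ (r ⊕ (s ⊕ (s′ ⊕ κ 0)))) (d w o) r s s′ touch (positive m′)))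
        (λ x y x∈ y∈ →
          lin 8 (λ xy xq qc′ c′y yc′ r s s′ → xy ≲ xq ⊕ qc′ ⊕ c′y ⇒ xq ≲ κ 1 ⊕ 2 ⊗ s ⇒ qc′ ≲ s′ ⇒ c′y ≐ yc′ ⇒ yc′ ≲ s′ ⇒ κ 1 ≲ r ⇒
                  ⊢ xy ≲ 2 ⊗ (r ⊕ (s ⊕ (s′ ⊕ κ 0))))
            (d x y) (d x (p i)) (d (p i) c′) (d c′ y) (d y c′) r s s′ (d-triangle₂ x (p i) c′ y)
            (end x (subst (λ a → j ≤ a × a ≤ j + 2 * s) (sym (above x x∈)) within-z)) in′ (d-sym c′ y) y∈ (positive in-C))
        (close-centres k
          (lin 7 (λ oc′ oq qo qc′ r s s′ → oc′ ≲ oq ⊕ qc′ ⇒ oq ≐ qo ⇒ qo ≲ κ 1 ⊕ s ⇒ qc′ ≲ s′ ⇒ κ 1 ≲ r ⇒ ⊢ oc′ ⊕ s ⊕ s′ ≲ 2 ⊗ (r ⊕ (s ⊕ (s′ ⊕ κ 0))))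
               (d o c′) (d o (p i)) (d (p i) o) (d (p i) c′) r s s′ (d-triangle o (p i) c′) (d-sym o (p i)) touch′ in′ (positive in-C)))

    private
      touching : ∀ c s′ i → p i ∈ᵇ (c , s′) → d (p i) (p (j + s)) ≤ suc s → d c (p (j + s)) ≤ suc (s + s′)
      touching c s′ i le le′ = lin 6 (λ co cq qc qo s s′ → co ≲ cq ⊕ qo ⇒ cq ≐ qc ⇒ qc ≲ s′ ⇒ qo ≲ κ 1 ⊕ s ⇒ ⊢ co ≲ κ 1 ⊕ (s ⊕ s′))
        (d c (p (j + s))) (d c (p i)) (d (p i) c) (d (p i) (p (j + s))) s s′ (d-triangle c (p i) (p (j + s))) (d-sym c (p i)) le le′

    -- Away from the ends the diameter bounds the heights too weakly, but the tile has a neighbour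
    -- on either side along P. A hanging ball would be a third one, which `no-star` excludes.
    filled-middle : ∀ {i i′ b₀ b′} → i ≤ D → i′ ≤ D → b₀ ∈ C → b′ ∈ C → (p (j + s) , s) ≢ b₀ → (p (j + s) , s) ≢ b′ → b₀ ≢ b′ →
                    p i ∈ᵇ b₀ → p i′ ∈ᵇ b′ → d (p i) (p (j + s)) ≤ suc s → d (p i′) (p (j + s)) ≤ suc s →
                    (∀ z → z within j , j + 2 * s → i ≢ pos z) →
                    (∀ z → z within j , j + 2 * s → i′ ≢ pos z) → Filled j s
    filled-middle {i} {i′} {c₀ , s₀} {c′ , s′} i≤D i′≤D m₀ m′ ne₀ ne′ ne₀′ in₀ in′ touch₀ touch′ apart-i apart-i′ z within-z =
      decidable-stable (d z (p (j + s)) ≤? s) λ out →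
      let open Hanging (hanging z within-z out) in
      no-star irr positive m in-C m₀ m′ other ne₀ ne′ (avoids i≤D in₀ (apart-i z within-z))
        (avoids i′≤D in′ (apart-i′ z within-z)) ne₀′ touch (touching c₀ s₀ i in₀ touch₀) (touching c′ s′ i′ in′ touch′)

  data Tiles : ℕ → List ℕ → Set where
    last : ∀ {j s} → (p (j + s) , s) ∈ C → j + 2 * s ≡ D → Filled j s → Tiles j (s ∷ [])
    next : ∀ {j s ss} → (p (j + s) , s) ∈ C → j + 2 * s < D → Filled j s → Tiles (suc (j + 2 * s)) ss → Tiles j (s ∷ ss)

  private
    -- The state of a scan along P: either nothing has been passed, or some ball reaches up to the
    -- previous position and no further.
    data Left : ℕ → Set where
      start : Left 0
      after : ∀ {i b₀} → b₀ ∈ C → p i ∈ᵇ b₀ → ¬ p (suc i) ∈ᵇ b₀ → Left (suc i)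

    before-tile : ∀ {i s} → suc i + 2 * s ≤ D → d (p i) (p (suc i + s)) ≡ suc s
    before-tile {i} {s} le = lin 3 (λ x i s → i ⊕ x ≐ κ 1 ⊕ i ⊕ s ⇒ ⊢ x ≐ κ 1 ⊕ s) (d (p i) (p (suc i + s))) i s
      (d-p (≤-trans (n≤1+n i) (m≤m+n (suc i) s)) (≤-trans (+-monoʳ-≤ (suc i) (m≤m+n s _)) le))

    beyond-tile : ∀ {j s} → j + 2 * s < D → d (p (suc (j + 2 * s))) (p (j + s)) ≡ suc s
    beyond-tile {j} {s} lt = lin 4 (λ x y j s → (j ⊕ s) ⊕ y ≐ κ 1 ⊕ (j ⊕ 2 ⊗ s) ⇒ x ≐ y ⇒ ⊢ x ≐ κ 1 ⊕ s)
      (d (p (suc (j + 2 * s))) (p (j + s))) (d (p (j + s)) (p (suc (j + 2 * s)))) j s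
      (d-p (≤-trans (+-monoʳ-≤ j (m≤m+n s _)) (n≤1+n _)) lt) (d-sym (p (suc (j + 2 * s))) (p (j + s)))

    place : ∀ {c j s} → (c , s) ∈ C → ht c ≡ 0 → pos c ≡ j + s → (p (j + s) , s) ∈ C
    place {c} {j} {s} m h≡0 a≡ = subst (λ x → (x , s) ∈ C) (trans (foot c h≡0) (cong p a≡)) m

    ball-≢ : ∀ {x b b₀} → x ∈ᵇ b → ¬ x ∈ᵇ b₀ → b₀ ≢ b
    ball-≢ in₁ out refl = out in₁

    left-out : ∀ {i b₀ c s} → b₀ ∈ C → p i ∈ᵇ b₀ → ¬ p (suc i) ∈ᵇ b₀ → (c , s) ∈ C → p (suc i) ∈ᵇ (c , s) → s < d c (p i)
    left-out {i} {c = c} {s} m₀ in₀ out₀ m in₁ =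
      ≰⇒> λ le → disjoint irr positive m₀ m (ball-≢ in₁ out₀) in₀ (subst (_≤ s) (d-sym c (p i)) le)

    reaches : ∀ {i c s} → suc i ≤ D → s < d c (p i) → p (suc i) ∈ᵇ (c , s) → suc i ≤ pos c
    reaches {i} {c} {s} i<D far in₁ = ≰⇒> λ a≤i →
      lin 7 (λ x y z a h i s → x ⊕ a ≐ h ⊕ i ⇒ y ⊕ a ≐ h ⊕ (κ 1 ⊕ i) ⇒ y ≐ z ⇒ z ≲ s ⇒ κ 1 ⊕ s ≲ x ⇒ ⊢⊥)
        (d c (p i)) (d c (p (suc i))) (d (p (suc i)) c) (pos c) (ht c) i s (d-right c i a≤i (<⇒≤ i<D))
        (d-right c (suc i) (m≤n⇒m≤1+n a≤i) i<D) (d-sym c (p (suc i))) in₁ far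

    -- Leaving the ball after position `i` means that its centre hangs over a position up to `i`;
    -- from there on the distance to the centre only grows.
    convex : ∀ {b i k} → p i ∈ᵇ b → ¬ p (suc i) ∈ᵇ b → i < k → k < D → ¬ p (suc k) ∈ᵇ b
    convex {c , s} {i} {k} in₀ out i<k k<D in′ = either {C = ⊥}
      (λ i<a → out (≤-trans (lin 6 (λ x y y′ a h i → y ⊕ (κ 1 ⊕ i) ≐ h ⊕ a ⇒ x ⊕ i ≐ h ⊕ a ⇒ y′ ≐ y ⇒ ⊢ y′ ≲ x)
         (d c (p i)) (d c (p (suc i))) (d (p (suc i)) c) (pos c) (ht c) i (d-left c (suc i) i<a) (d-left c i (<⇒≤ i<a)) (d-sym (p (suc i)) c))
         (subst (_≤ s) (d-sym (p i) c) in₀)))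
      (λ a≤i → out (≤-trans (lin 7 (λ y y′ z a h i k → y ⊕ a ≐ h ⊕ (κ 1 ⊕ i) ⇒ z ⊕ a ≐ h ⊕ (κ 1 ⊕ k) ⇒ κ 1 ⊕ i ≲ k ⇒ y′ ≐ y ⇒ ⊢ y′ ≲ z)
         (d c (p (suc i))) (d (p (suc i)) c) (d c (p (suc k))) (pos c) (ht c) i k (d-right c (suc i) (m≤n⇒m≤1+n a≤i) (≤-trans i<k (<⇒≤ k<D)))
         (d-right c (suc k) (≤-trans a≤i (<⇒≤ (≤-trans i<k (n≤1+n k)))) k<D) i<k (d-sym (p (suc i)) c))
         (subst (_≤ s) (d-sym (p (suc k)) c) in′)))
      (<-≤-connex i (pos c))

    -- Since the ball contains `p 0`, ht c + pos c is at most s, so its last position e = pos c + s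
    -- - ht c is at most 2 s - 2 ht c. With 2 s ≤ e from `first-long`, the centre lies on P at
    -- position s.
    start-tile : ∀ {c s e} → (c , s) ∈ C → p 0 ∈ᵇ (c , s) → e + ht c ≡ pos c + s → e < D →
                 e ≡ 2 * s × (p s , s) ∈ C × Filled 0 s
    start-tile {c} {s} {e} m in₀ end e<D =
      let ((c′ , s′) , m′ , in′) = cover (p (suc e))
          h+a = lin 5 (λ x y a h s → y ⊕ κ 0 ≐ h ⊕ a ⇒ x ≐ y ⇒ x ≲ s ⇒ ⊢ h ⊕ a ≲ s) (d (p 0) c) (d c (p 0)) (pos c) (ht c) s
                  (d-left c 0 z≤n) (d-sym (p 0) c) in₀
          a≤e = lin 4 (λ e h a s → e ⊕ h ≐ a ⊕ s ⇒ h ⊕ a ≲ s ⇒ ⊢ a ≲ e) e (ht c) (pos c) s end h+a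
          out = λ (le : d (p (suc e)) c ≤ s) →
            lin 6 (λ x y e h a s → y ⊕ a ≐ h ⊕ (κ 1 ⊕ e) ⇒ x ≐ y ⇒ x ≲ s ⇒ e ⊕ h ≐ a ⊕ s ⇒ ⊢⊥)
              (d (p (suc e)) c) (d c (p (suc e))) e (ht c) (pos c) s (d-right c (suc e) (m≤n⇒m≤1+n a≤e) e<D) (d-sym (p (suc e)) c) le end
          ne = λ (eq : (c , s) ≡ (c′ , s′)) → out (subst (p (suc e) ∈ᵇ_) (sym eq) in′)
          2s≤e = first-long m m′ ne a≤e e<D out in′
          h≡0 = lin 4 (λ e h a s → e ⊕ h ≐ a ⊕ s ⇒ h ⊕ a ≲ s ⇒ 2 ⊗ s ≲ e ⇒ ⊢ h ≐ κ 0) e (ht c) (pos c) s end h+a 2s≤e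
          a≡s = lin 4 (λ e h a s → e ⊕ h ≐ a ⊕ s ⇒ h ⊕ a ≲ s ⇒ 2 ⊗ s ≲ e ⇒ ⊢ a ≐ s) e (ht c) (pos c) s end h+a 2s≤e
          e≡2s = lin 4 (λ e h a s → e ⊕ h ≐ a ⊕ s ⇒ h ⊕ a ≲ s ⇒ 2 ⊗ s ≲ e ⇒ ⊢ e ≐ 2 ⊗ s) e (ht c) (pos c) s end h+a 2s≤e
          m″ = place m h≡0 a≡s
          2s<D = subst (_< D) e≡2s e<D
          in″ = subst (λ i → p (suc i) ∈ᵇ (c′ , s′)) e≡2s in′
      in e≡2s , m″ , filled-end m″ (<⇒≤ 2s<D) 2s<D m′
           (ball-≢ in″ (<⇒≱ (≤-reflexive (sym (beyond-tile {0} 2s<D))))) in″ (≤-reflexive (beyond-tile {0} 2s<D))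
           (λ z (_ , ≤k) eq → <⇒≱ (s≤s ≤k) (≤-reflexive eq))
           (λ z (_ , ≤k) → lin 4 (λ x a h s → x ⊕ a ≐ h ⊕ (κ 1 ⊕ 2 ⊗ s) ⇒ h ≲ a ⇒ ⊢ x ≲ κ 1 ⊕ 2 ⊗ s)
              (d z (p (suc (2 * s)))) (pos z) (ht z) s (d-right z (suc (2 * s)) (m≤n⇒m≤1+n ≤k) 2s<D) (ht≤pos z))

    middle-tile : ∀ {i b₀ c s e} → suc i ≤ D → b₀ ∈ C → p i ∈ᵇ b₀ → ¬ p (suc i) ∈ᵇ b₀ →
                  (c , s) ∈ C → p (suc i) ∈ᵇ (c , s) → e + ht c ≡ pos c + s → pos c ≤ e → e < D →
                  e ≡ suc i + 2 * s × (p (suc i + s) , s) ∈ C × Filled (suc i) s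
    middle-tile {i} {b₀} {c} {s} {e} i<D m₀ in₀ out₀ m in₁ end a≤e e<D =
      let ((c′ , s′) , m′ , in′) = cover (p (suc e))
          far = left-out m₀ in₀ out₀ m in₁
          i<a = reaches i<D far in₁
          out = λ (le : d (p (suc e)) c ≤ s) →
            lin 6 (λ x y e h a s → y ⊕ a ≐ h ⊕ (κ 1 ⊕ e) ⇒ x ≐ y ⇒ x ≲ s ⇒ e ⊕ h ≐ a ⊕ s ⇒ ⊢⊥)
              (d (p (suc e)) c) (d c (p (suc e))) e (ht c) (pos c) s (d-right c (suc e) (m≤n⇒m≤1+n a≤e) e<D) (d-sym (p (suc e)) c) le end
          ne = λ (eq : (c , s) ≡ (c′ , s′)) → out (subst (p (suc e) ∈ᵇ_) (sym eq) in′)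
          b₀≢b′ = λ (eq : b₀ ≡ (c′ , s′)) → convex in₀ out₀ (≤-trans i<a a≤e) e<D (subst (p (suc e) ∈ᵇ_) (sym eq) in′)
          h≡0 = middle-flat m₀ m m′ (ball-≢ in₁ out₀) b₀≢b′ ne i<a in₀ in₁ end a≤e e<D in′
          h+a = d-left c (suc i) i<a
          -- The centre is on the line, and its ball contains position `suc i` but not `i`.
          a≡ = lin 7 (λ x y z a h i s → y ⊕ (κ 1 ⊕ i) ≐ h ⊕ a ⇒ z ≐ y ⇒ z ≲ s ⇒ κ 1 ⊕ s ≲ x ⇒ x ⊕ i ≐ h ⊕ a ⇒ h ≐ κ 0 ⇒ ⊢ a ≐ κ 1 ⊕ i ⊕ s)
                 (d c (p i)) (d c (p (suc i))) (d (p (suc i)) c) (pos c) (ht c) i s h+a (d-sym (p (suc i)) c) in₁ far (d-left c i (<⇒≤ i<a)) h≡0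
          e≡ = lin 5 (λ e h a i s → e ⊕ h ≐ a ⊕ s ⇒ h ≐ κ 0 ⇒ a ≐ κ 1 ⊕ i ⊕ s ⇒ ⊢ e ≐ κ 1 ⊕ i ⊕ 2 ⊗ s) e (ht c) (pos c) i s end h≡0 a≡
          m″ = place m h≡0 a≡
          k<D = subst (_< D) e≡ e<D
          in″ = subst (λ i → p (suc i) ∈ᵇ (c′ , s′)) e≡ in′
      in e≡ , m″ , filled-middle m″ (<⇒≤ k<D) (<⇒≤ i<D) k<D m₀ m′
           (ball-≢ in₀ (<⇒≱ (≤-reflexive (sym (before-tile (<⇒≤ k<D))))))
           (ball-≢ in″ (<⇒≱ (≤-reflexive (sym (beyond-tile {suc i} k<D))))) b₀≢b′ in₀ in″
           (≤-reflexive (before-tile (<⇒≤ k<D))) (≤-reflexive (beyond-tile {suc i} k<D))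
           (λ z (j≤ , _) eq → <⇒≱ j≤ (≤-reflexive (sym eq)))
           (λ z (_ , ≤k) eq → <⇒≱ (s≤s ≤k) (≤-reflexive eq))

    -- Everything is squeezed between the bound of `last-long` and the reach of the ball: 2 s + (i +
    -- 1) ≤ D ≤ e = pos c + s - ht c ≤ (i + 1) + 2 s - 2 ht c.
    end-tile : ∀ {i b₀ c s e} → suc i ≤ D → b₀ ∈ C → p i ∈ᵇ b₀ → ¬ p (suc i) ∈ᵇ b₀ →
               (c , s) ∈ C → p (suc i) ∈ᵇ (c , s) → e + ht c ≡ pos c + s → D ≤ e → Tiles (suc i) (s ∷ [])
    end-tile {i} {b₀} {c} {s} {e} i<D m₀ in₀ out₀ m in₁ end D≤e =
      let far = left-out m₀ in₀ out₀ m in₁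
          i<a = reaches i<D far in₁
          long = last-long m m₀ (λ eq → ball-≢ in₁ out₀ (sym eq)) i<a (λ le → <⇒≱ far (subst (_≤ s) (d-sym (p i) c) le)) in₀
          h+a = lin 6 (λ x y a h i s → y ⊕ (κ 1 ⊕ i) ≐ h ⊕ a ⇒ x ≐ y ⇒ x ≲ s ⇒ ⊢ h ⊕ a ≲ κ 1 ⊕ i ⊕ s) (d (p (suc i)) c) (d c (p (suc i))) (pos c) (ht c) i s
                  (d-left c (suc i) i<a) (d-sym (p (suc i)) c) in₁
          h≡0 = lin 6 (λ e h a i s D → e ⊕ h ≐ a ⊕ s ⇒ D ≲ e ⇒ h ⊕ a ≲ κ 1 ⊕ i ⊕ s ⇒ 2 ⊗ s ⊕ (κ 1 ⊕ i) ≲ D ⇒ ⊢ h ≐ κ 0) e (ht c) (pos c) i s D end D≤e h+a long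
          a≡ = lin 6 (λ e h a i s D → e ⊕ h ≐ a ⊕ s ⇒ D ≲ e ⇒ h ⊕ a ≲ κ 1 ⊕ i ⊕ s ⇒ 2 ⊗ s ⊕ (κ 1 ⊕ i) ≲ D ⇒ ⊢ a ≐ κ 1 ⊕ i ⊕ s) e (ht c) (pos c) i s D end D≤e h+a long
          D≡ = lin 6 (λ e h a i s D → e ⊕ h ≐ a ⊕ s ⇒ D ≲ e ⇒ h ⊕ a ≲ κ 1 ⊕ i ⊕ s ⇒ 2 ⊗ s ⊕ (κ 1 ⊕ i) ≲ D ⇒ ⊢ κ 1 ⊕ i ⊕ 2 ⊗ s ≐ D) e (ht c) (pos c) i s D end D≤e h+a long
          m″ = place m h≡0 a≡
          k≤D = ≤-reflexive D≡
      in last m″ D≡ (filled-end m″ k≤D (<⇒≤ i<D) m₀ (ball-≢ in₀ (<⇒≱ (≤-reflexive (sym (before-tile k≤D))))) in₀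
           (≤-reflexive (before-tile k≤D)) (λ z (j≤ , _) eq → <⇒≱ j≤ (≤-reflexive (sym eq)))
           (λ z (j≤ , _) → lin 6 (λ x a h i s D → x ⊕ i ≐ h ⊕ a ⇒ h ⊕ a ≲ D ⇒ κ 1 ⊕ i ⊕ 2 ⊗ s ≐ D ⇒ ⊢ x ≲ κ 1 ⊕ 2 ⊗ s)
              (d z (p i)) (pos z) (ht z) i s D (d-left z i (<⇒≤ j≤)) (ht+pos≤D z) D≡))

    ht≤strength : ∀ {j c s} → j ≤ pos c → p j ∈ᵇ (c , s) → ht c ≤ s
    ht≤strength {j} {c} {s} j≤a in₁ = lin 6 (λ x y a h j s → y ⊕ j ≐ h ⊕ a ⇒ x ≐ y ⇒ x ≲ s ⇒ j ≲ a ⇒ ⊢ h ≲ s)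
      (d (p j) c) (d c (p j)) (pos c) (ht c) j s (d-left c j j≤a) (d-sym (p j) c) in₁ j≤a

    right-end : ∀ {c s} → ht c ≤ s → pos c + (s ∸ ht c) + ht c ≡ pos c + s
    right-end {c} h≤s = trans (+-assoc (pos c) _ _) (cong (pos c +_) (m∸n+n≡m h≤s))

    after-tile : ∀ {j s} → j + 2 * s < D → (p (j + s) , s) ∈ C → Left (suc (j + 2 * s))
    after-tile {j} {s} lt m = after m (p-centre (m≤m+n j _) ≤-refl (<⇒≤ lt)) (<⇒≱ (≤-reflexive (sym (beyond-tile {j} lt))))

    -- Here `cheap` enters: the first ball reaches at most position 2 s, so it cannot cover all of
    -- P.
    start-short : ∀ {c s e} → (c , s) ∈ C → p 0 ∈ᵇ (c , s) → e + ht c ≡ pos c + s → e < D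
    start-short {c} {s} {e} m in₀ end =
      lin 8 (λ x y e h a s t D → y ⊕ κ 0 ≐ h ⊕ a ⇒ x ≐ y ⇒ x ≲ s ⇒ e ⊕ h ≐ a ⊕ s ⇒ s ≲ t ⇒ κ 1 ⊕ 2 ⊗ t ≲ D ⇒ ⊢ κ 1 ⊕ e ≲ D)
        (d (p 0) c) (d c (p 0)) e (ht c) (pos c) s (total C) D (d-left c 0 z≤n) (d-sym (p 0) c) in₀ end (∈⇒≤total m) cheap

    -- `k` is fuel: each tile moves `j` forward by at least one position.
    tile : ∀ k j → j ≤ D → D < k + j → Left j → ∃ (Tiles j)
    tile zero j j≤D D< _ = ⊥-elim (<⇒≱ D< j≤D)
    tile (suc k) .0 j≤D D< start =
      let ((c , s) , m , in₀) = cover (p 0)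
          end = right-end (ht≤strength z≤n in₀)
          e<D = start-short m in₀ end
          (e≡ , m′ , filled) = start-tile m in₀ end e<D
          lt = subst (_< D) e≡ e<D
          (ss , tiles) = tile k (suc (2 * s)) lt
            (lin 3 (λ D k s → κ 1 ⊕ D ≲ κ 1 ⊕ k ⊕ κ 0 ⇒ ⊢ κ 1 ⊕ D ≲ k ⊕ (κ 1 ⊕ 2 ⊗ s)) D k s D<) (after-tile lt m′)
      in s ∷ ss , next m′ lt filled tiles
    tile (suc k) .(suc i) j≤D D< (after {i} m₀ in₀ out₀) =
      let ((c , s) , m , in₁) = cover (p (suc i))
          i<a = reaches j≤D (left-out m₀ in₀ out₀ m in₁) in₁
          h≤s = ht≤strength i<a in₁
          end = right-end h≤s
      in either
        (λ e<D →
          let (e≡ , m′ , filled) = middle-tile j≤D m₀ in₀ out₀ m in₁ end (m≤m+n (pos c) _) e<D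
              lt = subst (_< D) e≡ e<D
              (ss , tiles) = tile k (suc (suc i + 2 * s)) lt
                (lin 4 (λ D k s i → κ 1 ⊕ D ≲ κ 1 ⊕ k ⊕ (κ 1 ⊕ i) ⇒ ⊢ κ 1 ⊕ D ≲ k ⊕ (κ 1 ⊕ (κ 1 ⊕ i ⊕ 2 ⊗ s))) D k s i D<) (after-tile lt m′)
          in s ∷ ss , next m′ lt filled tiles)
        (λ D≤e → s ∷ [] , end-tile j≤D m₀ in₀ out₀ m in₁ end D≤e)
        (<-≤-connex (pos c + (s ∸ ht c)) D)

  tiles : ∃ (Tiles 0)
  tiles = tile (suc D) 0 z≤n (s≤s (m≤m+n D 0)) start

  private
    filling : ∀ {j ss} → Tiles j ss → Filling j ss
    filling (last m eq f) = last (positive m) eq f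
    filling (next m lt f t) = next (positive m) lt f (filling t)

    tile-ball : ∀ {j ss l t} → Tiles j ss → Tile j ss l t → (p (l + t) , t) ∈ C
    tile-ball (last m _ _) here = m
    tile-ball (next m _ _ _) here = m
    tile-ball (next _ _ _ ts) (there t) = tile-ball ts t

    balls : ℕ → List ℕ → List Ball
    balls j [] = []
    balls j (s ∷ ss) = (p (j + s) , s) ∷ balls (suc (j + 2 * s)) ss

    balls-total : ∀ j ss → total (balls j ss) ≡ sum ss
    balls-total j [] = refl
    balls-total j (s ∷ ss) = cong (s +_) (balls-total _ ss)

    ∈-balls : ∀ {j ss b} → b ∈ balls j ss → ∃[ l ] ∃[ t ] (Tile j ss l t × b ≡ (p (l + t) , t))
    ∈-balls {j} {s ∷ ss} (here refl) = j , s , here , refl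
    ∈-balls {j} {s ∷ ss} (there m) with ∈-balls {suc (j + 2 * s)} m
    ... | l , t , tile , eq = l , t , there tile , eq

    balls-⊆ : ∀ {j ss b} → Tiles j ss → b ∈ balls j ss → b ∈ C
    balls-⊆ {j} ts m with ∈-balls {j} m
    ... | l , t , tile , refl = tile-ball ts tile

    balls-unique : ∀ {j ss} → Filling j ss → Unique (balls j ss)
    balls-unique (last _ _ _) = [] ∷ []
    balls-unique (next {j} {s} _ lt _ F) = tabulate distinct ∷ balls-unique F
      where
      distinct : ∀ {b} → b ∈ balls (suc (j + 2 * s)) _ → (p (j + s) , s) ≢ b
      distinct m eq with ∈-balls {suc (j + 2 * s)} m
      ... | l , t , tile , eq′ = <⇒≱ (≤-trans (s≤s (+-monoʳ-≤ j (m≤m+n s _))) (≤-trans (tile-≥ tile) (m≤m+n l t)))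
        (≤-reflexive (sym (p-inj (j + s) (l + t) (≤-trans (+-monoʳ-≤ j (m≤m+n s _)) (<⇒≤ lt))
          (≤-trans (+-monoʳ-≤ l (m≤m+n t _)) (proj₁ (proj₂ (tile-filled F tile)))) (cong proj₁ (trans eq eq′)))))

  tiling : ∃[ ss ] (Filling 0 ss × sum ss ≤ total C ×
                    (∀ {b} → b ∈ C → ∃[ l ] ∃[ t ] (Tile 0 ss l t × (∀ {x} → x ∈ᵇ b → x within l , l + 2 * t))))
  tiling =
    let (ss , ts) = tiles
        F = filling ts
    in ss , F , subst (_≤ total C) (balls-total 0 ss) (unique-total (balls-unique F) (balls-⊆ {0} ts)) , λ {b} m →
      let (c , s) = b
          (l , t , tile , in-tile) = find-tile F c z≤n
          (_ , k≤D , f) = tile-filled F tile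
          -- The centre of `b` lies over some tile and hence in its central ball, so by disjointness
          -- `b` is that ball.
          same = decidable-stable (≡-dec Fin._≟_ _≟_ b (p (l + t) , t)) λ ne →
                   disjoint irr positive m (tile-ball ts tile) ne (subst (_≤ s) (sym (d-refl c)) z≤n) (f c in-tile)
      in l , t , tile , λ {x} x∈ → near-centre⇒within k≤D (subst (x ∈ᵇ_) same x∈)

-- Components of T - M as stretches of positions, and split-sets from fillings

module _ {n : ℕ} {G : Graph n} where

  reach-edge : ∀ {x u v} → (∀ v → V G v) → Reach G x u → E G u v → Reach G x v
  reach-edge every (_ , W) e with walk-snoc W e (every _)
  ... | _ , W′ , _ = _ , W′

  walk⇒comp : ∀ {x u v q} → (∀ v → V G v) → WalkL G u v q → Reach G x u → WalkL (Comp G x) u v q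
  walk⇒comp every (one _) R = one R
  walk⇒comp every (cons _ e W) R = cons R e (walk⇒comp every W (reach-edge every R e))

  comp⇒walk : ∀ {x u v q} → (∀ v → V G v) → WalkL (Comp G x) u v q → WalkL G u v q
  comp⇒walk every (one _) = one (every _)
  comp⇒walk every (cons _ e W) = cons (every _) e (comp⇒walk every W)

uncut-walk : ∀ {n} {T : Graph n} P M {u v q} → WalkL (removeCuts T P M) u v q → WalkL T u v q
uncut-walk P M (one x) = one x
uncut-walk P M (cons x (e , _) W) = cons x e (uncut-walk P M W)

module SplitSets {n : ℕ} (T : Graph n) (tree : IsTree T) {u v : Fin n} {P : List (Fin n)} {D : ℕ}
                 (path : PathL T u v P) (len : length P ≡ suc D)
                 (diam : ∀ x y → TreeDistance.d T tree x y ≤ D) where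

  open TreeDistance T tree

  axis : Line D
  axis = line path len

  open Line axis public
  open DiametralLine T tree D axis diam public
  open Balls T tree using (_∈ᵇ_)

  private
    every : ∀ v → V T v
    every = proj₁ tree

  at-p : ∀ {i} → i ≤ D → at P i ≡ just (p i)
  at-p {i} i≤D = at-nth u P i (subst (i <_) (sym len) (s≤s i≤D))

  at-just : ∀ {i y} → at P i ≡ just y → i ≤ D × y ≡ p i
  at-just {i} eq = let lt = bound P i eq in ≤-pred (subst (i <_) len lt) , just-injective (trans (sym eq) (at-nth u P i lt))
    where
    bound : ∀ {y} (ys : List (Fin n)) i → at ys i ≡ just y → i < length ys
    bound (_ ∷ _) zero _ = s≤s z≤n
    bound (_ ∷ ys) (suc i) eq = s≤s (bound ys i eq)

  sub-walk : ∀ {l k} → l ≤ k → k ≤ D → WalkL T (p l) (p k) (subpath P l k)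
  sub-walk {l} {k} l≤k k≤D = go (proj₁ path) l k l≤k (subst (k <_) (sym len) (s≤s k≤D))
    where
    go : ∀ {x y ys} → WalkL T x y ys → ∀ l k → l ≤ k → k < length ys → WalkL T (nth u ys l) (nth u ys k) (drop l (take (suc k) ys))
    go (one x) zero zero _ _ = one x
    go (one x) _ (suc k) _ (s≤s ())
    go (cons x e W) zero zero _ _ = one x
    go W@(cons {w = w} x e W₁) zero (suc k) _ (s≤s lt) =
      cons x (subst (E T _) (sym (nth-first u W₁)) e) (go W₁ zero k z≤n lt)
    go (cons x e W) (suc l) (suc k) (s≤s le) (s≤s lt) = go W l k le lt

  sub-path : ∀ {l k} → l ≤ k → k ≤ D → PathL T (p l) (p k) (subpath P l k)
  sub-path {l} {k} l≤k k≤D = sub-walk l≤k k≤D , drop⁺ l (take⁺ (suc k) (proj₂ path))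

  sub-length : ∀ {l k} → l ≤ k → k ≤ D → length (subpath P l k) ≡ suc (d (p l) (p k))
  sub-length l≤k k≤D = length-path (sub-path l≤k k≤D)

  -- A geodesic that leaves the stretch would cross `p l`, or `p k`, once on the way out and again
  -- on the way back.
  within-convex : ∀ {l k y w z} → l ≤ k → k ≤ D → y within l , k → z within l , k → d y w + d w z ≡ d y z → w within l , k
  within-convex {l} {k} {y} {w} {z} l≤k k≤D (l≤y , y≤k) (l≤z , z≤k) eq =
    ≮⇒≥ (λ w<l →
      lin 14 (λ yw wy wz yz yl lz zl l w h y hy z hz →
          h ⊕ y ⊕ hy ≲ wy ⊕ w ⇒ h ⊕ z ⊕ hz ≲ wz ⊕ w ⇒ yw ⊕ wz ≐ yz ⇒ yw ≐ wy ⇒ yz ≲ yl ⊕ lz ⇒ lz ≐ zl ⇒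
          yl ⊕ l ≐ hy ⊕ y ⇒ zl ⊕ l ≐ hz ⊕ z ⇒ κ 1 ⊕ w ≲ l ⇒ ⊢⊥)
        (d y w) (d w y) (d w z) (d y z) (d y (p l)) (d (p l) z) (d z (p l)) l (pos w) (ht w) (pos y) (ht y) (pos z) (ht z)
        (apart (≤-trans w<l l≤y)) (apart (≤-trans w<l l≤z)) eq (d-sym y w) (d-triangle y (p l) z) (d-sym (p l) z)
        (d-left y l l≤y) (d-left z l l≤z) w<l) ,
    ≮⇒≥ (λ k<w →
      lin 14 (λ yw zw wz yz yk kz zk k w h y hy z hz →
          hy ⊕ w ⊕ h ≲ yw ⊕ y ⇒ hz ⊕ w ⊕ h ≲ zw ⊕ z ⇒ yw ⊕ wz ≐ yz ⇒ zw ≐ wz ⇒ yz ≲ yk ⊕ kz ⇒ kz ≐ zk ⇒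
          yk ⊕ y ≐ hy ⊕ k ⇒ zk ⊕ z ≐ hz ⊕ k ⇒ κ 1 ⊕ k ≲ w ⇒ ⊢⊥)
        (d y w) (d z w) (d w z) (d y z) (d y (p k)) (d (p k) z) (d z (p k)) k (pos w) (ht w) (pos y) (ht y) (pos z) (ht z)
        (apart (≤-trans (s≤s y≤k) k<w)) (apart (≤-trans (s≤s z≤k) k<w)) eq (d-sym z w) (d-triangle y (p k) z) (d-sym (p k) z)
        (d-right y k y≤k k≤D) (d-right z k z≤k k≤D) k<w)

  -- Only edges of P change the position, so removing edges of P separates the tree exactly between
  -- positions.
  edge-along : ∀ {y w} → E T y w → pos y < pos w → y ≡ p (pos y) × w ≡ p (suc (pos y)) × pos w ≡ suc (pos y)
  edge-along {y} {w} e lt =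
    let far = apart lt
        one = d-edge e
        flat = lin 5 (λ hy w hw yw y → hy ⊕ w ⊕ hw ≲ yw ⊕ y ⇒ yw ≐ κ 1 ⇒ κ 1 ⊕ y ≲ w ⇒ ⊢ hy ≐ κ 0) (ht y) (pos w) (ht w) (d y w) (pos y) far one lt
        flat′ = lin 5 (λ hy w hw yw y → hy ⊕ w ⊕ hw ≲ yw ⊕ y ⇒ yw ≐ κ 1 ⇒ κ 1 ⊕ y ≲ w ⇒ ⊢ hw ≐ κ 0) (ht y) (pos w) (ht w) (d y w) (pos y) far one lt
        up = lin 5 (λ hy w hw yw y → hy ⊕ w ⊕ hw ≲ yw ⊕ y ⇒ yw ≐ κ 1 ⇒ κ 1 ⊕ y ≲ w ⇒ ⊢ w ≐ κ 1 ⊕ y) (ht y) (pos w) (ht w) (d y w) (pos y) far one lt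
    in foot y flat , trans (foot w flat′) (cong p up) , up

  -- The subpath p l … p k between two consecutive removed edges, or an end of P.
  record Section (M : List ℕ) (l k : ℕ) : Set where
    field
      l≤k   : l ≤ k
      k≤D   : k ≤ D
      left  : l ≡ 0 ⊎ ∃[ c ] (c ∈ M × l ≡ suc c)
      right : k ≡ D ⊎ k ∈ M
      uncut : ∀ c → c ∈ M → l ≤ c → k ≤ c

  module _ {M : List ℕ} {l k : ℕ} (S : Section M l k) where

    open Section S

    first-within : p l within l , k
    first-within = subst (λ i → l ≤ i × i ≤ k) (sym (pos-p (≤-trans l≤k k≤D))) (≤-refl , l≤k)

    last-within : p k within l , k
    last-within = subst (λ i → l ≤ i × i ≤ k) (sym (pos-p k≤D)) (l≤k , ≤-refl)

    private
      G : Graph n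
      G = removeCuts T P M

      not-cut : ∀ {y w} → y within l , k → w within l , k → ¬ CutEdge P M y w
      not-cut (l≤y , y≤k) (l≤w , w≤k) (i , i∈M , inj₁ (eq , eq′)) =
        let (i≤D , y≡) = at-just eq ; (i<D , w≡) = at-just eq′
        in <⇒≱ (subst (_≤ k) (trans (cong pos w≡) (pos-p i<D)) w≤k) (uncut i i∈M (subst (l ≤_) (trans (cong pos y≡) (pos-p i≤D)) l≤y))
      not-cut (l≤y , y≤k) (l≤w , w≤k) (i , i∈M , inj₂ (eq , eq′)) =
        let (i≤D , w≡) = at-just eq ; (i<D , y≡) = at-just eq′
        in <⇒≱ (subst (_≤ k) (trans (cong pos y≡) (pos-p i<D)) y≤k) (uncut i i∈M (subst (l ≤_) (trans (cong pos w≡) (pos-p i≤D)) l≤w))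

      geodesic-in : ∀ {y z q} → WalkL T y z q → length q ≡ suc (d y z) → y within l , k → z within l , k → WalkL G y z q
      geodesic-in (one x) _ _ _ = one x
      geodesic-in {y} {z} (cons {w = w} {p = q} x e W) eq y-in z-in =
        let between-yz = lin 4 (λ yw wz yz q → yz ≲ yw ⊕ wz ⇒ κ 1 ⊕ q ≐ κ 1 ⊕ yz ⇒ κ 1 ⊕ wz ≲ q ⇒ yw ≐ κ 1 ⇒ ⊢ yw ⊕ wz ≐ yz)
                           (d y w) (d w z) (d y z) (length q) (d-triangle y w z) eq (walk-bound W) (d-edge e)
            shorter = lin 4 (λ yw wz yz q → yz ≲ yw ⊕ wz ⇒ κ 1 ⊕ q ≐ κ 1 ⊕ yz ⇒ κ 1 ⊕ wz ≲ q ⇒ yw ≐ κ 1 ⇒ ⊢ q ≐ κ 1 ⊕ wz)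
                           (d y w) (d w z) (d y z) (length q) (d-triangle y w z) eq (walk-bound W) (d-edge e)
            w-in = within-convex l≤k k≤D y-in z-in between-yz
        in cons x (e , not-cut y-in w-in) (geodesic-in W shorter w-in z-in)

      -- The two edges of P that lead out of the stretch are either removed or do not exist because
      -- P ends there.
      stays : ∀ {y w} → E G y w → y within l , k → w within l , k
      stays {y} {w} (e , ¬cut) (l≤y , y≤k) =
        (≮⇒≥ λ w<l →
          let (w≡ , y≡ , step) = edge-along (proj₁ (proj₂ tree) y w e) (≤-trans w<l l≤y)
              l≡ = ≤-antisym (subst (l ≤_) step l≤y) w<l
          in either
            (λ l≡0 → n≮0 (subst (pos w <_) l≡0 w<l))
            (λ (c , c∈M , l≡sc) → let c≡ = suc-injective (trans (sym l≡sc) l≡) in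
              ¬cut (pos w , subst (_∈ M) c≡ c∈M , inj₂ (trans (at-p (pos≤D w)) (cong just (sym w≡)) ,
                trans (at-p (subst (_≤ D) step (pos≤D y))) (cong just (sym y≡)))))
            left) ,
        (≮⇒≥ λ k<w →
          let (y≡ , w≡ , step) = edge-along e (≤-trans (s≤s y≤k) k<w)
              k≡ = ≤-antisym (≤-pred (subst (suc k ≤_) step k<w)) y≤k
          in either
            (λ k≡D → <⇒≱ k<w (subst (pos w ≤_) (sym k≡D) (pos≤D w)))
            (λ k∈M →
              ¬cut (pos y , subst (_∈ M) k≡ k∈M , inj₁ (trans (at-p (pos≤D y)) (cong just (sym y≡)) ,
                trans (at-p (subst (_≤ D) step (pos≤D w))) (cong just (sym w≡)))))
            right)

    component : Graph n
    component = Comp G (p l)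

    reach⇒within : ∀ {y} → V component y → y within l , k
    reach⇒within (_ , W) = go W first-within
      where
      go : ∀ {x y q} → WalkL G x y q → x within l , k → y within l , k
      go (one _) x-in = x-in
      go (cons _ e W) x-in = go W (stays e x-in)

    within⇒reach : ∀ {y} → y within l , k → V component y
    within⇒reach {y} y-in = let (q , (W , _) , eq) = geodesic (p l) y in q , geodesic-in W eq first-within y-in

    -- Components are convex, so their distances, diameters and radii can be computed in the tree.
    component-geodesic : ∀ {y z q} → WalkL T y z q → length q ≡ suc (d y z) → y within l , k → z within l , k → WalkL component y z q
    component-geodesic W eq y-in z-in = walk⇒comp every (geodesic-in W eq y-in z-in) (within⇒reach y-in)

    component-within : ∀ {y z j} → y within l , k → z within l , k → d y z ≤ j → Within component y z j
    component-within {y} {z} y-in z-in le =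
      let (q , (W , _) , eq) = geodesic y z in q , component-geodesic W eq y-in z-in , subst (_≤ _) (sym eq) (s≤s le)

    component-d : ∀ {y z j} → Within component y z j → d y z ≤ j
    component-d (q , W , le) = within⇒d≤ (q , uncut-walk P M (comp⇒walk every W) , le)

    component-¬near : ∀ {y z j} → j ≤ d y z → ¬ Near component y z j
    component-¬near le (q , W , le′) = ≤d⇒¬near le (q , uncut-walk P M (comp⇒walk every W) , le′)

    component-path : PathL component (p l) (p k) (subpath P l k)
    component-path = component-geodesic (sub-walk l≤k k≤D) (sub-length l≤k k≤D) first-within last-within , proj₂ (sub-path l≤k k≤D)

    length-subpath : length (subpath P l k) ∸ 1 ≡ k ∸ l
    length-subpath = trans (cong (_∸ 1) (sub-length l≤k k≤D)) (trans (sym (m+n∸m≡n l _)) (cong (_∸ l) (d-p l≤k k≤D)))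

  centre-within : ∀ {l t} → l + 2 * t ≤ D → p (l + t) within l , l + 2 * t
  centre-within {l} {t} k≤D = subst (λ i → l ≤ i × i ≤ l + 2 * t) (sym (pos-p (≤-trans c≤k k≤D))) (m≤m+n l t , c≤k)
    where
    c≤k : l + t ≤ l + 2 * t
    c≤k = +-monoʳ-≤ l (m≤m+n t _)

  module _ {M : List ℕ} {l t : ℕ} (S : Section M l (l + 2 * t)) (filled : Filled l t) where

    private
      k≤D : l + 2 * t ≤ D
      k≤D = Section.k≤D S

      width : d (p l) (p (l + 2 * t)) ≡ 2 * t
      width = +-cancelˡ-≡ l _ _ (d-p (m≤m+n l _) k≤D)

    filled-diameter : ∀ y z → y within l , l + 2 * t → z within l , l + 2 * t → d y z ≤ 2 * t
    filled-diameter y z y-in z-in = lin 5 (λ yz yo oz zo t → yz ≲ yo ⊕ oz ⇒ oz ≐ zo ⇒ yo ≲ t ⇒ zo ≲ t ⇒ ⊢ yz ≲ 2 ⊗ t)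
      (d y z) (d y (p (l + t))) (d (p (l + t)) z) (d z (p (l + t))) t (d-triangle y (p (l + t)) z) (d-sym (p (l + t)) z) (filled y y-in) (filled z z-in)

    component-diameter : IsDiam (component S) (2 * t)
    component-diameter =
      (p l , within⇒reach S (first-within S) , p (l + 2 * t) , within⇒reach S (last-within S) , component-¬near S (≤-reflexive (sym width))) ,
      λ y Vy z Vz → component-within S (reach⇒within S Vy) (reach⇒within S Vz)
        (filled-diameter y z (reach⇒within S Vy) (reach⇒within S Vz))

    component-diam-path : IsDiamPath (component S) (subpath P l (l + 2 * t))
    component-diam-path = p l , p (l + 2 * t) , component-path S ,
      subst (IsDiam (component S)) (sym (trans (length-subpath S) (m+n∸m≡n l _))) component-diameter

    component-radius : IsRad (component S) t
    component-radius =
      (p (l + t) , within⇒reach S (centre-within k≤D) , λ y Vy →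
        component-within S (centre-within k≤D) (reach⇒within S Vy) (subst (_≤ t) (d-sym y (p (l + t))) (filled y (reach⇒within S Vy)))) ,
      λ y Vy → let (l≤y , y≤k) = reach⇒within S Vy in either
        (λ c≤y → p l , within⇒reach S (first-within S) , component-¬near S
          (lin 5 (λ x h a l t → x ⊕ l ≐ h ⊕ a ⇒ l ⊕ t ≲ a ⇒ ⊢ t ≲ x) (d y (p l)) (ht y) (pos y) l t (d-left y l l≤y) c≤y))
        (λ y≤c → p (l + 2 * t) , within⇒reach S (last-within S) , component-¬near S
          (lin 5 (λ x h a l t → x ⊕ a ≐ h ⊕ (l ⊕ 2 ⊗ t) ⇒ a ≲ l ⊕ t ⇒ ⊢ t ≲ x) (d y (p (l + 2 * t))) (ht y) (pos y) l t
            (d-right y (l + 2 * t) y≤k k≤D) y≤c))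
        (≤-total (l + t) (pos y))

  cuts : ∀ {j ss} → Filling j ss → List ℕ
  cuts (last _ _ _) = []
  cuts (next {j} {s} _ _ _ F) = j + 2 * s ∷ cuts F

  cuts-length : ∀ {j ss} (F : Filling j ss) → suc (length (cuts F)) ≡ length ss
  cuts-length (last _ _ _) = refl
  cuts-length (next _ _ _ F) = cong suc (cuts-length F)

  cuts-≥ : ∀ {j ss c} (F : Filling j ss) → c ∈ cuts F → j ≤ c
  cuts-≥ (next {j} _ _ _ F) (here refl) = m≤m+n j _
  cuts-≥ (next {j} _ _ _ F) (there m) = ≤-trans (≤-trans (m≤m+n j _) (n≤1+n _)) (cuts-≥ F m)

  cuts-< : ∀ {j ss c} (F : Filling j ss) → c ∈ cuts F → c < D
  cuts-< (next _ lt _ F) (here refl) = lt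
  cuts-< (next _ _ _ F) (there m) = cuts-< F m

  cuts-linked : ∀ {j ss} (F : Filling j ss) → Linked _<_ (cuts F)
  cuts-linked (last _ _ _) = []
  cuts-linked (next _ _ _ (last _ _ _)) = [-]
  cuts-linked (next _ _ _ F@(next _ _ _ _)) = cuts-≥ F (here refl) ∷ cuts-linked F

  tile-right : ∀ {j ss l t} (F : Filling j ss) → Tile j ss l t → l + 2 * t ≡ D ⊎ l + 2 * t ∈ cuts F
  tile-right (last _ eq _) here = inj₁ eq
  tile-right (next _ _ _ F) here = inj₂ (here refl)
  tile-right (next _ _ _ F) (there tile) with tile-right F tile
  ... | inj₁ eq = inj₁ eq
  ... | inj₂ m = inj₂ (there m)

  tile-left : ∀ {j ss l t} (F : Filling j ss) → Tile j ss l t → l ≡ j ⊎ ∃[ c ] (c ∈ cuts F × l ≡ suc c)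
  tile-left F here = inj₁ refl
  tile-left (next _ _ _ F) (there tile) with tile-left F tile
  ... | inj₁ refl = inj₂ (_ , here refl , refl)
  ... | inj₂ (c , m , eq) = inj₂ (c , there m , eq)

  tile-uncut : ∀ {j ss l t} (F : Filling j ss) → Tile j ss l t → ∀ c → c ∈ cuts F → l ≤ c → l + 2 * t ≤ c
  tile-uncut (next _ _ _ F) here c (here refl) _ = ≤-refl
  tile-uncut (next _ _ _ F) here c (there m) _ = ≤-trans (n≤1+n _) (cuts-≥ F m)
  tile-uncut (next _ _ _ F) (there tile) c (here refl) l≤ = ⊥-elim (<⇒≱ (tile-≥ tile) l≤)
  tile-uncut (next _ _ _ F) (there tile) c (there m) l≤ = tile-uncut F tile c m l≤

  tile-section : ∀ {ss l t} (F : Filling 0 ss) → Tile 0 ss l t → Section (cuts F) l (l + 2 * t)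
  tile-section {l = l} F tile = record
    { l≤k = m≤m+n l _ ; k≤D = proj₁ (proj₂ (tile-filled F tile)) ; left = tile-left F tile ; right = tile-right F tile ; uncut = tile-uncut F tile }

  -- `SplitSet` quantifies over all pairs of positions that satisfy `Block`; for the cuts of a
  -- filling these are exactly the ends of tiles.
  block-tile : ∀ {j ss l k} (F : Filling j ss) → l ≤ k → (l ≡ j ⊎ ∃[ c ] (c ∈ cuts F × l ≡ suc c)) → (k ≡ D ⊎ k ∈ cuts F) →
               (∀ c → c ∈ cuts F → l ≤ c → k ≤ c) → ∃[ t ] (Tile j ss l t × k ≡ l + 2 * t)
  block-tile (last {s = s} _ eq _) l≤k (inj₁ refl) (inj₁ refl) _ = s , here , sym eq
  block-tile (next {j} {s} _ lt _ F) l≤k (inj₁ refl) right uncut = s , here , ≤-antisym k≤ (k≥ right)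
    where
    k≤ = uncut (j + 2 * s) (here refl) (m≤m+n j _)
    k≥ : _ ⊎ _ → _
    k≥ (inj₁ refl) = <⇒≤ lt
    k≥ (inj₂ (here refl)) = ≤-refl
    k≥ (inj₂ (there m)) = ≤-trans (n≤1+n _) (cuts-≥ F m)
  block-tile {l = l} {k} (next {j} {s} _ lt _ F) l≤k (inj₂ (c , c∈ , l≡)) right uncut =
    let (t , tile , eq) = block-tile F l≤k (left c∈) (inner right) (λ c m → uncut c (there m)) in t , there tile , eq
    where
    left : c ∈ j + 2 * s ∷ cuts F → l ≡ suc (j + 2 * s) ⊎ ∃[ c ] (c ∈ cuts F × l ≡ suc c)
    left (here refl) = inj₁ l≡
    left (there m) = inj₂ (c , m , l≡)
    c≥ : c ∈ j + 2 * s ∷ cuts F → j + 2 * s ≤ c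
    c≥ (here refl) = ≤-refl
    c≥ (there m) = ≤-trans (n≤1+n _) (cuts-≥ F m)
    inner : k ≡ D ⊎ k ∈ j + 2 * s ∷ cuts F → k ≡ D ⊎ k ∈ cuts F
    inner (inj₁ eq) = inj₁ eq
    inner (inj₂ (here refl)) = ⊥-elim (<⇒≱ (subst (j + 2 * s <_) (sym l≡) (s≤s (c≥ c∈))) l≤k)
    inner (inj₂ (there m)) = inj₂ m

  split-set : ∀ {ss} (F : Filling 0 ss) → IsDiamPath T P → 2 ≤ length ss → SplitSet T P (cuts F)
  split-set F diam-path two =
    diam-path , cuts-linked F , tabulate (λ m → subst (_ <_) (sym len) (s≤s (cuts-< F m))) ,
    (λ eq → <⇒≱ two (≤-reflexive (trans (sym (cuts-length F)) (cong (λ M → suc (length M)) eq)))) ,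
    λ j k (j≤k , left , right , uncut) →
      let (t , tile , k≡) = block-tile F j≤k left (either {C = k ≡ D ⊎ k ∈ cuts F} (λ eq → inj₁ (suc-injective (trans eq len))) inj₂ right) uncut
          (0<t , _ , filled) = tile-filled F tile
          span = trans (cong (_∸ j) k≡) (m+n∸m≡n j (2 * t))
      in divides t (trans span (*-comm 2 t)) , subst (0 <_) (sym span) (≤-trans 0<t (m≤m+n t _)) ,
         λ x at-j → subst₂ (λ x k → IsDiamPath (Comp (removeCuts T P (cuts F)) x) (subpath P j k))
                      (sym (proj₂ (at-just at-j))) (sym k≡) (component-diam-path (tile-section F tile) filled)

-- Costs of strength functions

weight : ∀ {n} → (Fin n → ℕ) → ℕ
weight {n} f = sum (map f (allFin n))

module _ {n : ℕ} where

  weight-+ : (f g : Fin n → ℕ) → weight (λ v → f v + g v) ≡ weight f + weight g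
  weight-+ f g = go (allFin n)
    where
    go : ∀ vs → sum (map (λ v → f v + g v) vs) ≡ sum (map f vs) + sum (map g vs)
    go [] = refl
    go (v ∷ vs) = lin 5 (λ a b x y z → z ≐ x ⊕ y ⇒ ⊢ a ⊕ b ⊕ z ≐ a ⊕ x ⊕ (b ⊕ y)) (f v) (g v) _ _ _ (go vs)

  weight-mono : {f g : Fin n → ℕ} → (∀ v → f v ≤ g v) → weight f ≤ weight g
  weight-mono {f} {g} le = go (allFin n)
    where
    go : ∀ vs → sum (map f vs) ≤ sum (map g vs)
    go [] = z≤n
    go (v ∷ vs) = +-mono-≤ (le v) (go vs)

  ≤-weight : (f : Fin n → ℕ) (v : Fin n) → f v ≤ weight f
  ≤-weight f v = go (∈-allFin v)
    where
    go : ∀ {vs} → v ∈ vs → f v ≤ sum (map f vs)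
    go (here refl) = m≤m+n _ _
    go (there {x = w} m) = ≤-trans (go m) (m≤n+m _ (f w))

  spike : Fin n → ℕ → Fin n → ℕ
  spike c s v with v ≟ᶠ c
  ... | yes _ = s
  ... | no _ = 0

  spike-centre : ∀ c s → spike c s c ≡ s
  spike-centre c s with c ≟ᶠ c
  ... | yes _ = refl
  ... | no ne = ⊥-elim (ne refl)

  spike-other : ∀ {c s v} → v ≢ c → spike c s v ≡ 0
  spike-other {c} {v = v} ne with v ≟ᶠ c
  ... | yes eq = ⊥-elim (ne eq)
  ... | no _ = refl

  spike-support : ∀ {c s v} → 0 < spike c s v → v ≡ c
  spike-support {c} {s} {v} lt with v ≟ᶠ c
  ... | yes eq = eq
  spike-support () | no _

  weight-spike : ∀ c s → weight (spike c s) ≡ s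
  weight-spike c s = once (allFin⁺ n) (∈-allFin c)
    where
    none : ∀ {vs} → c ∉ vs → sum (map (spike c s) vs) ≡ 0
    none {[]} _ = refl
    none {v ∷ vs} c∉ = cong₂ _+_ (spike-other (λ eq → c∉ (here (sym eq)))) (none (λ m → c∉ (there m)))
    once : ∀ {vs} → Unique vs → c ∈ vs → sum (map (spike c s) vs) ≡ s
    once (c∉ ∷ _) (here refl) = trans (cong₂ _+_ (spike-centre c s) (none (λ m → lookup c∉ m refl))) (+-identityʳ s)
    once (v∉ ∷ U) (there m) = cong₂ _+_ (spike-other (λ eq → lookup v∉ m eq)) (once U m)

  module _ {S : Fin n → Set} (S? : ∀ v → Dec (S v)) (f : Fin n → ℕ) where

    inside outside : Fin n → ℕ
    inside v with S? v
    ... | yes _ = f v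
    ... | no _ = 0
    outside v with S? v
    ... | yes _ = 0
    ... | no _ = f v

    inside-∈ : ∀ {v} → S v → inside v ≡ f v
    inside-∈ {v} Sv with S? v
    ... | yes _ = refl
    ... | no ¬Sv = ⊥-elim (¬Sv Sv)

    inside-∉ : ∀ {v} → ¬ S v → inside v ≡ 0
    inside-∉ {v} ¬Sv with S? v
    ... | yes Sv = ⊥-elim (¬Sv Sv)
    ... | no _ = refl

    outside-∉ : ∀ {v} → ¬ S v → outside v ≡ f v
    outside-∉ {v} ¬Sv with S? v
    ... | yes Sv = ⊥-elim (¬Sv Sv)
    ... | no _ = refl

    weight-split : weight f ≡ weight inside + weight outside
    weight-split = trans (≤-antisym (weight-mono λ v → ≤-reflexive (sym (split v))) (weight-mono λ v → ≤-reflexive (split v)))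
                     (weight-+ inside outside)
      where
      split : ∀ v → inside v + outside v ≡ f v
      split v with S? v
      ... | yes _ = +-identityʳ (f v)
      ... | no _ = refl

  support : (Fin n → ℕ) → List (Fin n) → List (Fin n × ℕ)
  support f [] = []
  support f (v ∷ vs) with f v
  ... | zero = support f vs
  ... | suc k = (v , suc k) ∷ support f vs

  support-total : ∀ f vs → sum (map proj₂ (support f vs)) ≡ sum (map f vs)
  support-total f [] = refl
  support-total f (v ∷ vs) with f v
  ... | zero = support-total f vs
  ... | suc k = cong (suc k +_) (support-total f vs)

  support-positive : ∀ f vs {b} → b ∈ support f vs → 0 < proj₂ b
  support-positive f (v ∷ vs) m with f v
  support-positive f (v ∷ vs) m | zero = support-positive f vs m
  support-positive f (v ∷ vs) (here refl) | suc k = s≤s z≤n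
  support-positive f (v ∷ vs) (there m) | suc k = support-positive f vs m

  ∈-support : ∀ f vs {v} → v ∈ vs → 0 < f v → (v , f v) ∈ support f vs
  ∈-support f (w ∷ vs) (here refl) lt with f w
  ... | suc k = here refl
  ∈-support f (w ∷ vs) (there m) lt with f w
  ... | zero = ∈-support f vs m lt
  ... | suc k = there (∈-support f vs m lt)

-- Broadcasts of minimum cost, up to double negation

module _ {n : ℕ} {G : Graph n} where

  -- Descent on the cost, which `k` bounds: either `h` is minimal or a cheaper dominating broadcast
  -- takes its place. The choice is not decided, hence the continuation.
  ¬¬gamma : ∀ k h → DomBroadcast G h → cost G h ≤ k → (∀ h′ → GammaBcast G h′ → cost G h′ ≤ cost G h → ⊥) → ⊥
  ¬¬gamma zero h dom le K = K h (dom , λ g _ → ≤-trans le z≤n) ≤-refl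
  ¬¬gamma (suc k) h dom le K = K h (dom , λ g dom′ → decidable-stable (cost G h ≤? cost G g) λ ≰ →
    ¬¬gamma k g dom′ (≤-pred (≤-trans (≰⇒> ≰) le)) λ h′ γ le′ → K h′ γ (≤-trans le′ (<⇒≤ (≰⇒> ≰)))) ≤-refl

  -- `Radial` gives the cost of γ_b-broadcasts only. Below a competitor cheaper than `h` there would
  -- be a γ_b-broadcast, of cost `r`, which contradicts that `h` costs at most `r`.
  radial⇒gamma : ∀ {r h} → Radial G → IsRad G r → DomBroadcast G h → cost G h ≤ r → GammaBcast G h
  radial⇒gamma {r} {h} radial rad dom le = dom , λ g dom′ → decidable-stable (cost G h ≤? cost G g) λ ≰ →
    ¬¬gamma (cost G g) g dom′ ≤-refl λ h′ γ le′ →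
      <⇒≱ (≰⇒> ≰) (≤-trans le (subst (_≤ cost G g) (radial h′ r γ rad) le′))

-- Broadcasts on a tree with at least two vertices

module Broadcasts {n : ℕ} (T : Graph n) (tree : IsTree T) (multiple : ¬ Single T) where

  open TreeDistance T tree

  private
    every : ∀ v → V T v
    every = proj₁ tree

  farthest : ∀ v → ∃[ u ] (∀ w → d v w ≤ d v u)
  farthest v = let (u , far) = go (allFin n) in u , λ w → far (∈-allFin w)
    where
    go : ∀ vs → ∃[ u ] (∀ {w} → w ∈ vs → d v w ≤ d v u)
    go [] = v , λ ()
    go (x ∷ vs) with go vs
    ... | u , far with ≤-total (d v x) (d v u)
    ...   | inj₁ le = u , λ { (here refl) → le ; (there m) → far m }
    ...   | inj₂ le = x , λ { (here refl) → ≤-refl ; (there m) → ≤-trans (far m) le }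

  broadcast : ∀ {f} → (∀ v → ∃[ u ] f v ≤ d v u) → Broadcast T f
  broadcast ecc = (λ v ¬Vv → ⊥-elim (¬Vv (every v))) , λ v _ →
    (λ single → ⊥-elim (multiple single)) , λ _ → let (u , le) = ecc v in u , every u , ≤d⇒¬near le

  broadcast⁻ : ∀ {f} → Broadcast T f → ∀ v → ∃[ u ] f v ≤ d v u
  broadcast⁻ (_ , ecc) v = let (u , _ , ¬near) = proj₂ (ecc v (every v)) multiple in u , ¬near⇒≤d ¬near

  other : ∀ v → ∃[ u ] 0 < d v u
  other v = let (u , far) = farthest v in u , n≢0⇒n>0 λ eq →
    multiple (v , every v , λ w _ → sym (d≡0⇒≡ (n≤0⇒n≡0 (subst (d v w ≤_) eq (far w)))))

  Dominates : (Fin n → ℕ) → Set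
  Dominates f = ∀ x → ∃[ v ] (0 < f v × d v x ≤ f v)

  dominates : ∀ {f} → Dominating T f → Dominates f
  dominates dom x = let (v , _ , pos , near) = dom x (every x) in v , pos , within⇒d≤ near

  -- `F` may exceed eccentricities, as sums of strength functions can. Capping it there costs
  -- nothing and preserves domination, because a ball whose strength is the eccentricity of its
  -- centre already covers the tree.
  gamma-minimal : ∀ {g} F → GammaBcast T g → Dominates F → weight g ≤ weight F
  gamma-minimal F (_ , minimal) dom = ≤-trans (minimal capped (capped-broadcast , capped-dominating)) (weight-mono λ v → m⊓n≤m (F v) (ecc v))
    where
    ecc : Fin n → ℕ
    ecc v = d v (proj₁ (farthest v))
    capped : Fin n → ℕ
    capped v = F v ⊓ ecc v
    capped-broadcast : Broadcast T capped
    capped-broadcast = broadcast λ v → proj₁ (farthest v) , m⊓n≤n (F v) (ecc v)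
    capped-dominating : Dominating T capped
    capped-dominating x _ =
      let (v , pos , le) = dom x ; (u , lt) = other v
      in v , every v , ⊓-glb pos (≤-trans lt (proj₂ (farthest v) u)) , d≤⇒within (⊓-glb le (proj₂ (farthest v) x))

  -- If every other ball is disjoint from the one at c, then the strength at c can be raised by one: a vertex at
  -- distance at most f c + 1 from c lies on or outside the boundary of every ball.
  touching : ∀ {f} → MaxBnIndep T f → ∀ c u₀ → suc (f c) ≤ d c u₀ → ∃[ u ] (u ≢ c × 0 < f u × d u c ≤ f u + f c)
  touching {f} (bc , indep , maximal) c u₀ far
    with anyᶠ? (λ u → ¬? (u ≟ᶠ c) ×-dec (0 <? f u) ×-dec (d u c ≤? f u + f c))
  ... | yes found = found
  ... | no none = ⊥-elim (1+n≢n (trans (sym gc) (maximal g (broadcast g-ecc) g-indep (λ v → m≤m+n (f v) _) c)))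
    where
    g : Fin n → ℕ
    g v = f v + spike c 1 v
    gc : g c ≡ suc (f c)
    gc = trans (cong (f c +_) (spike-centre c 1)) (+-comm (f c) 1)
    g-other : ∀ {v} → v ≢ c → g v ≡ f v
    g-other {v} ne = trans (cong (f v +_) (spike-other ne)) (+-identityʳ (f v))
    g-ecc : ∀ v → ∃[ u ] g v ≤ d v u
    g-ecc v with v ≟ᶠ c
    ... | yes refl = u₀ , subst (_≤ d c u₀) (+-comm 1 (f c)) far
    ... | no ne = let (u , le) = broadcast⁻ bc v in u , subst (_≤ d v u) (sym (+-identityʳ (f v))) le
    separate : ∀ {u} → u ≢ c → 0 < f u → suc (f u + f c) ≤ d u c
    separate ne pos = ≰⇒> λ le → none (_ , ne , pos , le)
    hears-far : ∀ {x v} → v ≢ c → Hears T g x v → d c x ≤ suc (f c) → suc (f c) ≤ d x c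
    hears-far {x} {v} ne (_ , pos , near) le =
      lin 5 (λ vc vx xc fv fc → vc ≲ vx ⊕ xc ⇒ κ 1 ⊕ (fv ⊕ fc) ≲ vc ⇒ vx ≲ fv ⇒ ⊢ κ 1 ⊕ fc ≲ xc)
        (d v c) (d v x) (d x c) (f v) (f c) (d-triangle v x c) (separate ne (subst (0 <_) (g-other ne) pos))
        (subst (d v x ≤_) (g-other ne) (within⇒d≤ near))
    far-from : ∀ {x u} → d c x ≤ suc (f c) → u ≢ c → 0 < f u → f u ≤ d x u
    far-from {x} {u} le ne pos =
      lin 7 (λ uc ux xc cx xu fu fc → uc ≲ ux ⊕ xc ⇒ xc ≐ cx ⇒ ux ≐ xu ⇒ cx ≲ κ 1 ⊕ fc ⇒ κ 1 ⊕ (fu ⊕ fc) ≲ uc ⇒ ⊢ fu ≲ xu)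
        (d u c) (d u x) (d x c) (d c x) (d x u) (f u) (f c) (d-triangle u x c) (d-sym x c) (d-sym u x) le (separate ne pos)
    hears-f : ∀ {x v} → v ≢ c → Hears T g x v → Hears T f x v
    hears-f ne (Vv , pos , near) = Vv , subst (0 <_) (g-other ne) pos , subst (Within T _ _) (g-other ne) near
    not-centre : ∀ {x v} → ¬ d c x ≤ suc (f c) → Hears T g x v → v ≢ c
    not-centre {x} out (_ , _ , near) refl = out (subst (d c x ≤_) gc (within⇒d≤ near))
    one-other : ∀ {v w} → v ≢ w → v ≢ c ⊎ w ≢ c
    one-other {v} v≢w with v ≟ᶠ c
    ... | yes refl = inj₂ λ eq → v≢w (sym eq)
    ... | no ne = inj₁ ne
    g-indep : BnIndep T g
    g-indep x Vx (v , w , v≢w , hv , hw) u Vu pos with d c x ≤? suc (f c) | u ≟ᶠ c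
    ... | yes le | no ne = ≤d⇒¬near (subst (_≤ d x u) (sym (+-identityʳ (f u))) (far-from le ne (subst (0 <_) (+-identityʳ (f u)) pos)))
    ... | yes le | yes refl = ≤d⇒¬near (subst (_≤ d x c) (+-comm 1 (f c))
      (either (λ ne → hears-far ne hv le) (λ ne → hears-far ne hw le) (one-other v≢w)))
    ... | no out | no ne = subst (λ k → ¬ Near T x u k) (sym (+-identityʳ (f u)))
      (indep x Vx (v , w , v≢w , hears-f (not-centre out hv) hv , hears-f (not-centre out hw) hw) u Vu (subst (0 <_) (+-identityʳ (f u)) pos))
    ... | no out | yes refl = ≤d⇒¬near (≤-trans (≤-reflexive (+-comm (f c) 1)) (≤-trans (<⇒≤ (≰⇒> out)) (≤-reflexive (d-sym c x))))

  -- An undominated vertex has strength 0 and counts as a ball of strength 0: by `touching` some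
  -- ball meets it, which means that it is dominated.
  maximal⇒dominating : ∀ {f} → MaxBnIndep T f → Dominating T f
  maximal⇒dominating {f} max x _ with anyᶠ? (λ v → (0 <? f v) ×-dec (d v x ≤? f v))
  ... | yes (v , pos , le) = v , every v , pos , d≤⇒within le
  ... | no none = ⊥-elim (none (proj₁ found , proj₁ (proj₂ (proj₂ found)) ,
                    subst (d (proj₁ found) x ≤_) (trans (cong (f (proj₁ found) +_) fx≡0) (+-identityʳ _)) (proj₂ (proj₂ (proj₂ found)))))
    where
    fx≡0 : f x ≡ 0
    fx≡0 = n≤0⇒n≡0 (≮⇒≥ λ pos → none (x , pos , subst (_≤ f x) (sym (d-refl x)) z≤n))
    found : ∃[ u ] (u ≢ x × 0 < f u × d u x ≤ f u + f x)
    found = touching max x (proj₁ (other x)) (subst (λ k → suc k ≤ d x (proj₁ (other x))) (sym fx≡0) (proj₂ (other x)))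

  -- A larger broadcast cannot exceed `r` at `c`, since `r` is the eccentricity of `c`. A second
  -- broadcasting vertex would hear both itself and `c`, while being at distance 0 from itself,
  -- against bn-independence.
  radial-maximal : ∀ {c r u₀} → 0 < r → r ≤ d c u₀ → (∀ x → d c x ≤ r) → MaxBnIndep T (spike c r)
  radial-maximal {c} {r} {u₀} 0<r far near = broadcast ecc , indep , maximal
    where
    ecc : ∀ v → ∃[ u ] spike c r v ≤ d v u
    ecc v with v ≟ᶠ c
    ... | yes refl = u₀ , far
    ... | no _ = v , z≤n
    indep : BnIndep T (spike c r)
    indep x _ (v , w , v≢w , (_ , pos , _) , (_ , pos′ , _)) = ⊥-elim (v≢w (trans (spike-support pos) (sym (spike-support pos′))))
    maximal : ∀ g → Broadcast T g → BnIndep T g → (∀ v → spike c r v ≤ g v) → ∀ v → g v ≡ spike c r v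
    maximal g bc g-indep ≤g v with v ≟ᶠ c
    ... | yes refl = let (u , le) = broadcast⁻ bc c in ≤-antisym (≤-trans le (near u)) r≤
      where
      r≤ : r ≤ g c
      r≤ = subst (_≤ g c) (spike-centre c r) (≤g c)
    ... | no ne = n≤0⇒n≡0 (≮⇒≥ λ pos → g-indep v (every v)
          (v , c , ne , (every v , pos , d≤⇒within (subst (_≤ g v) (sym (d-refl v)) z≤n)) ,
            (every c , ≤-trans 0<r r≤ , d≤⇒within (≤-trans (near v) r≤)))
          v (every v) pos (v ∷ [] , one (every v) , pos))
      where
      r≤ : r ≤ g c
      r≤ = subst (_≤ g c) (spike-centre c r) (≤g c)

-- Comparison of the two minimum costs

module CostFormula {n : ℕ} (T : Graph n) (tree : IsTree T) {u v : Fin n} {P : List (Fin n)} {D : ℕ}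
               (path : PathL T u v P) (len : length P ≡ suc D)
               (diam : ∀ x y → TreeDistance.d T tree x y ≤ D) (multiple : ¬ Single T) where

  open SplitSets T tree path len diam
  open Broadcasts T tree multiple
  open Balls T tree hiding (Covers)
  open TreeDistance T tree

  -- The tiles come from the merged family; this is what remains true of the balls of `f`
  -- themselves.
  Tiled : (Fin n → ℕ) → List ℕ → Set
  Tiled f ss = ∀ c → 0 < f c → ∃[ l ] ∃[ t ] (Tile 0 ss l t × (∀ {x} → x ∈ᵇ (c , f c) → x within l , l + 2 * t))

  cheap⇒tiled : ∀ {f} → Dominates f → 2 * weight f < D →
                (∀ ss → Filling 0 ss → sum ss ≤ weight f → Tiled f ss → ⊥) → ⊥
  cheap⇒tiled {f} dom cheap K =
    reduction (length C) C ≤-refl (support-positive f (allFin n)) λ C′ irr positive′ refines total≡ →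
      let total-C′ = trans total≡ (support-total f (allFin n))
          cover = λ x → let (c , 0<fc , le) = dom x ; (b , m , sub) = refines (∈-support f (allFin n) (∈-allFin c) 0<fc)
                        in b , m , sub (subst (_≤ f c) (d-sym c x) le)
          (ss , F , sum≤ , tiled) = Tiling.tiling T tree D axis diam C′ irr positive′ cover (subst (λ k → 2 * k < D) (sym total-C′) cheap)
      in K ss F (subst (sum ss ≤_) total-C′ sum≤) λ c 0<fc →
           let (b , m , sub) = refines (∈-support f (allFin n) (∈-allFin c) 0<fc) ; (l , t , tile , sub′) = tiled m
           in l , t , tile , λ x∈ → sub′ (sub x∈)
    where
    C : List Ball
    C = support f (allFin n)

  within? : ∀ z l k → Dec (z within l , k)
  within? z l k = (l ≤? pos z) ×-dec (pos z ≤? k)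

  module _ {ss : List ℕ} (F : Filling 0 ss) {l t : ℕ} (tile : Tile 0 ss l t) where

    private
      k : ℕ
      k = l + 2 * t

      0<t : 0 < t
      0<t = proj₁ (tile-filled F tile)

      k≤D : k ≤ D
      k≤D = proj₁ (proj₂ (tile-filled F tile))

      filled : Filled l t
      filled = proj₂ (proj₂ (tile-filled F tile))

      S : Section (cuts F) l k
      S = tile-section F tile

    tile-component : Graph n
    tile-component = component S

    private
      in? : ∀ z → Dec (z within l , k)
      in? z = within? z l k

      o : Fin n
      o = p (l + t)

      o∈ : V tile-component o
      o∈ = within⇒reach S (centre-within k≤D)

      not-single : ¬ Single tile-component
      not-single (x , _ , all) =
        <⇒≱ (≤-trans 0<t (m≤m+n t _))
          (≤-reflexive (+-cancelˡ-≡ l _ 0 (trans (p-inj k l k≤D (≤-trans (m≤m+n l _) k≤D)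
            (trans (all _ (within⇒reach S (last-within S))) (sym (all _ (within⇒reach S (first-within S)))))) (sym (+-identityʳ l)))))

      component-broadcast : ∀ {f} → (∀ y → ¬ V tile-component y → f y ≡ 0) → (∀ y → V tile-component y → EccGe tile-component y (f y)) →
                            Broadcast tile-component f
      component-broadcast vanish ecc = vanish , λ y Vy → (λ single → ⊥-elim (not-single single)) , λ _ → ecc y Vy

      ecc-zero : ∀ {y} → V tile-component y → EccGe tile-component y 0
      ecc-zero {y} Vy = y , Vy , component-¬near S z≤n

      central : DomBroadcast tile-component (spike o t)
      central = component-broadcast
        (λ y ∉ → spike-other {c = o} {t} {y} (λ eq → ∉ (subst (V tile-component) (sym eq) o∈)))
        (λ y Vy → decide y Vy (y ≟ᶠ o)) ,
        λ x Vx → o , o∈ , subst (0 <_) (sym (spike-centre o t)) 0<t ,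
          component-within S (centre-within k≤D) (reach⇒within S Vx)
            (subst₂ _≤_ (d-sym x o) (sym (spike-centre o t)) (filled x (reach⇒within S Vx)))
        where
        decide : ∀ y → V tile-component y → Dec (y ≡ o) → EccGe tile-component y (spike o t y)
        decide y Vy (yes refl) = subst (EccGe tile-component o) (sym (spike-centre o t)) (proj₂ (component-radius S filled) o Vy)
        decide y Vy (no ne) = subst (EccGe tile-component y) (sym (spike-other ne)) (ecc-zero Vy)

    -- Replacing f inside a uniquely radial tile by the central ball shows that f costs no more than the radius there,
    -- so that f restricted to the tile is the central broadcast.
    single-centre : ∀ {f g c₁ c₂} → Broadcast T f → Dominates f → Tiled f ss → GammaBcast T g → weight f ≡ weight g →
                    UniquelyRadial tile-component → c₁ within l , k → c₂ within l , k → 0 < f c₁ → 0 < f c₂ → c₁ ≡ c₂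
    single-centre {f} {g} {c₁} {c₂} bc dom tiled γ f≡g (radial , unique) c₁-in c₂-in pos₁ pos₂ =
      trans (at-centre c₁-in pos₁) (sym (at-centre c₂-in pos₂))
      where
      h : Fin n → ℕ
      h = inside in? f

      ball-in : ∀ {c x y} → 0 < f c → x ∈ᵇ (c , f c) → x within l , k → y ∈ᵇ (c , f c) → y within l , k
      ball-in {c} {y = y} 0<fc x∈ x-in y∈ =
        let (l′ , t′ , tile′ , sub) = tiled c 0<fc
            (l≡ , t≡) = tile-unique tile′ tile (sub x∈) x-in
        in subst₂ (λ l t → y within l , l + 2 * t) l≡ t≡ (sub y∈)

      self : ∀ {c} → c ∈ᵇ (c , f c)
      self {c} = subst (_≤ f c) (sym (d-refl c)) z≤n

      h-ecc : ∀ y → V tile-component y → EccGe tile-component y (h y)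
      h-ecc y Vy = subst (EccGe tile-component y) (sym (inside-∈ in? f y-in)) (decide (f y ≟ 0))
        where
        y-in = reach⇒within S Vy
        decide : Dec (f y ≡ 0) → EccGe tile-component y (f y)
        decide (yes eq) = subst (EccGe tile-component y) (sym eq) (ecc-zero Vy)
        decide (no ne) =
          -- Some vertex `w` is at distance exactly `f y` from `y`. It belongs to the ball of `y`,
          -- so it is in the same component and witnesses the eccentricity there.
          let (u , le) = broadcast⁻ bc y
              (w , yw , _) = between y u (f y) le
          in w , within⇒reach S (ball-in (n≢0⇒n>0 ne) self y-in (≤-reflexive (trans (d-sym w y) yw))) , component-¬near S (≤-reflexive (sym yw))

      h-dom : Dominating tile-component h
      h-dom x Vx =
        let (c , 0<fc , le) = dom x
            x-in = reach⇒within S Vx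
            c-in = ball-in 0<fc (subst (_≤ f c) (d-sym c x) le) x-in self
        in c , within⇒reach S c-in , subst (0 <_) (sym (inside-∈ in? f c-in)) 0<fc ,
           component-within S c-in x-in (subst (d c x ≤_) (sym (inside-∈ in? f c-in)) le)

      replaced : Fin n → ℕ
      replaced z = spike o t z + outside in? f z

      replaced-dominates : Dominates replaced
      replaced-dominates x = decide (in? x)
        where
        decide : Dec (x within l , k) → ∃[ c ] (0 < replaced c × d c x ≤ replaced c)
        decide (yes x-in) = o ,
          ≤-trans (subst (0 <_) (sym (spike-centre o t)) 0<t) (m≤m+n _ _) ,
          ≤-trans (subst₂ _≤_ (d-sym x o) (sym (spike-centre o t)) (filled x x-in)) (m≤m+n _ _)
        decide (no x∉) =
          let (c , 0<fc , le) = dom x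
              c∉ = λ c-in → x∉ (ball-in 0<fc self c-in (subst (_≤ f c) (d-sym c x) le))
              fc≤ = subst (_≤ replaced c) (outside-∉ in? f c∉) (m≤n+m _ (spike o t c))
          in c , ≤-trans 0<fc fc≤ , ≤-trans le fc≤

      h-cheap : weight h ≤ t
      h-cheap = lin 6 (λ f g i o r t → f ≐ g ⇒ g ≲ r ⇒ r ≐ t ⊕ o ⇒ f ≐ i ⊕ o ⇒ ⊢ i ≲ t)
        (weight f) (weight g) (weight h) (weight (outside in? f)) (weight replaced) t f≡g (gamma-minimal replaced γ replaced-dominates)
        (trans (weight-+ (spike o t) (outside in? f)) (cong (_+ weight (outside in? f)) (weight-spike o t))) (weight-split in? f)

      h-zero : ∀ y → ¬ V tile-component y → h y ≡ 0
      h-zero y ∉ = inside-∉ in? f (λ y-in → ∉ (within⇒reach S y-in))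

      h-gamma : GammaBcast tile-component h
      h-gamma = radial⇒gamma {h = h} radial (component-radius S filled) (component-broadcast {f = h} h-zero h-ecc , h-dom) h-cheap

      central-gamma : GammaBcast tile-component (spike o t)
      central-gamma = radial⇒gamma {h = spike o t} radial (component-radius S filled) central (≤-reflexive (weight-spike o t))

      at-centre : ∀ {c} → c within l , k → 0 < f c → c ≡ o
      at-centre {c} c-in 0<fc = spike-support (subst (0 <_) (trans (sym (inside-∈ in? f c-in)) (unique h (spike o t) h-gamma central-gamma c)) 0<fc)

  spike-covers : ∀ o t (H : Fin n → ℕ) z → (∀ c → spike o t c ≤ H c) → 0 < t → d z o ≤ t → ∃[ c ] (0 < H c × d c z ≤ H c)
  spike-covers o t H z le 0<t near =
    o , ≤-trans 0<t t≤ , ≤-trans (≤-trans (≤-reflexive (d-sym o z)) near) t≤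
    where
    t≤ : t ≤ H o
    t≤ = subst (_≤ H o) (spike-centre o t) (le o)

  HasCentre : ℕ → ℕ → Set
  HasCentre l k = ∃[ t ] (0 < t × k ≡ l + 2 * t × (∀ z → z within l , k → d z (p (l + t)) ≤ t))

  -- A block of length 2 t is a diametrical path of its component, so all vertices there are within
  -- 2 t of both its ends, and `d-centre` places them within t of its middle.
  block-centre : ∀ {M l k} → SplitSet T P M → Block P M l k → k ≤ D → HasCentre l k
  block-centre {M} {l} {k} (_ , _ , _ , _ , blocks) block@(l≤k , left , right , uncut) k≤D =
    let (divides t 2t , positive , diam-path) = blocks l k block
        (_ , _ , _ , _ , near) = diam-path (p l) (at-p (≤-trans l≤k k≤D))
        S : Section M l k
        S = record { l≤k = l≤k ; k≤D = k≤D ; left = left ; right = either {C = k ≡ D ⊎ k ∈ M} (λ eq → inj₁ (suc-injective (trans eq len))) inj₂ right ; uncut = uncut }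
        k≡ = trans (sym (m+[n∸m]≡n l≤k)) (cong (l +_) (trans 2t (*-comm t 2)))
        0<t = lin 2 (λ x t → κ 1 ≲ x ⇒ x ≐ 2 ⊗ t ⇒ ⊢ κ 1 ≲ t) (k ∸ l) t positive (trans 2t (*-comm t 2))
        within-2t = λ y (y-in : y within l , k) z (z-in : z within l , k) →
          subst (d z y ≤_) (trans (length-subpath S) (trans 2t (*-comm t 2)))
            (subst (_≤ length (subpath P l k) ∸ 1) (d-sym y z) (component-d S (near y (within⇒reach S y-in) z (within⇒reach S z-in))))
    in t , 0<t , k≡ , λ z z-in → d-centre (subst (z within l ,_) k≡ z-in) (subst (_≤ D) k≡ k≤D)
         (within-2t (p l) (first-within S) z z-in)
         (subst (λ k → d z (p k) ≤ 2 * t) k≡ (within-2t (p k) (last-within S) z z-in))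

  -- The upper bound (D - m) / 2 for γ_b: `H` is the sum of one central ball for each component of T
  -- - M.
  CentralCost : ℕ → Set
  CentralCost m = ∃[ q ] ∃[ H ] (D ≡ m + 2 * q × weight H ≡ q × Dominates H)

  central-cost₁ : ∀ {i} → HasCentre 0 i → HasCentre (suc i) D → CentralCost 1
  central-cost₁ {i} (t₁ , 0<t₁ , i≡ , near₁) (t₂ , 0<t₂ , D≡ , near₂) =
    t₁ + t₂ , H ,
    lin 4 (λ i D t₁ t₂ → i ≐ 2 ⊗ t₁ ⇒ D ≐ κ 1 ⊕ i ⊕ 2 ⊗ t₂ ⇒ ⊢ D ≐ κ 1 ⊕ 2 ⊗ (t₁ ⊕ t₂)) i D t₁ t₂ i≡ D≡ ,
    trans (weight-+ H₁ H₂) (cong₂ _+_ (weight-spike (p t₁) t₁) (weight-spike (p (suc i + t₂)) t₂)) ,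
    λ z → either
      (λ z≤i → spike-covers (p t₁) t₁ H z (λ c → m≤m+n (H₁ c) (H₂ c)) 0<t₁ (near₁ z (z≤n , z≤i)))
      (λ i<z → spike-covers (p (suc i + t₂)) t₂ H z (λ c → m≤n+m (H₂ c) (H₁ c)) 0<t₂ (near₂ z (i<z , pos≤D z)))
      (≤-<-connex (pos z) i)
    where
    H₁ H₂ H : Fin n → ℕ
    H₁ = spike (p t₁) t₁
    H₂ = spike (p (suc i + t₂)) t₂
    H z = H₁ z + H₂ z

  central-cost₂ : ∀ {i j} → HasCentre 0 i → HasCentre (suc i) j → HasCentre (suc j) D → CentralCost 2
  central-cost₂ {i} {j} (t₁ , 0<t₁ , i≡ , near₁) (t₂ , 0<t₂ , j≡ , near₂) (t₃ , 0<t₃ , D≡ , near₃) =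
    t₁ + t₂ + t₃ , H ,
    lin 6 (λ i j D t₁ t₂ t₃ → i ≐ 2 ⊗ t₁ ⇒ j ≐ κ 1 ⊕ i ⊕ 2 ⊗ t₂ ⇒ D ≐ κ 1 ⊕ j ⊕ 2 ⊗ t₃ ⇒ ⊢ D ≐ κ 2 ⊕ 2 ⊗ (t₁ ⊕ t₂ ⊕ t₃)) i j D t₁ t₂ t₃ i≡ j≡ D≡ ,
    trans (weight-+ (λ z → H₁ z + H₂ z) H₃) (cong₂ _+_ (trans (weight-+ H₁ H₂)
      (cong₂ _+_ (weight-spike (p t₁) t₁) (weight-spike (p (suc i + t₂)) t₂))) (weight-spike (p (suc j + t₃)) t₃)) ,
    λ z → either
      (λ z≤i → spike-covers (p t₁) t₁ H z (λ c → ≤-trans (m≤m+n (H₁ c) (H₂ c)) (m≤m+n (H₁ c + H₂ c) (H₃ c))) 0<t₁ (near₁ z (z≤n , z≤i)))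
      (λ i<z → either
        (λ z≤j → spike-covers (p (suc i + t₂)) t₂ H z (λ c → ≤-trans (m≤n+m (H₂ c) (H₁ c)) (m≤m+n (H₁ c + H₂ c) (H₃ c))) 0<t₂ (near₂ z (i<z , z≤j)))
        (λ j<z → spike-covers (p (suc j + t₃)) t₃ H z (λ c → m≤n+m (H₃ c) (H₁ c + H₂ c)) 0<t₃ (near₃ z (j<z , pos≤D z)))
        (≤-<-connex (pos z) j))
      (≤-<-connex (pos z) i)
    where
    H₁ H₂ H₃ H : Fin n → ℕ
    H₁ = spike (p t₁) t₁
    H₂ = spike (p (suc i + t₂)) t₂
    H₃ = spike (p (suc j + t₃)) t₃
    H z = H₁ z + H₂ z + H₃ z

  central-cost : ∀ {m} M → SplitSet T P M → length M ≡ m → m ≡ 1 ⊎ m ≡ 2 → CentralCost m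
  central-cost (i ∷ []) split@(_ , _ , i<len ∷ [] , _) refl _ =
    let i<D = ≤-pred (subst (suc i <_) len i<len)
    in central-cost₁
      (block-centre split (z≤n , inj₁ refl , inj₂ (here refl) , λ { c (here refl) _ → ≤-refl }) (<⇒≤ i<D))
      (block-centre split (i<D , inj₂ (i , here refl , refl) , inj₁ (sym len) , λ { c (here refl) i<i → ⊥-elim (<⇒≱ i<i ≤-refl) }) ≤-refl)
  central-cost (i ∷ j ∷ []) split@(_ , i<j ∷ _ , _ ∷ j<len ∷ [] , _) refl _ =
    let j<D = ≤-pred (subst (suc j <_) len j<len)
    in central-cost₂
      (block-centre split
        (z≤n , inj₁ refl , inj₂ (here refl) , λ { c (here refl) _ → ≤-refl ; c (there (here refl)) _ → <⇒≤ i<j }) (<⇒≤ (<-trans i<j j<D)))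
      (block-centre split
        (i<j , inj₂ (i , here refl , refl) , inj₂ (there (here refl)) ,
         λ { c (here refl) i<i → ⊥-elim (<⇒≱ i<i ≤-refl) ; c (there (here refl)) _ → ≤-refl }) (<⇒≤ j<D))
      (block-centre split
        (j<D , inj₂ (j , there (here refl) , refl) , inj₁ (sym len) ,
         λ { c (here refl) j<i → ⊥-elim (<-asym i<j j<i) ; c (there (here refl)) j<j → ⊥-elim (<⇒≱ j<j ≤-refl) }) ≤-refl)
  central-cost [] split refl (inj₁ ())
  central-cost [] split refl (inj₂ ())
  central-cost (_ ∷ _ ∷ _ ∷ _) split refl (inj₁ ())
  central-cost (_ ∷ _ ∷ _ ∷ _) split refl (inj₂ ())

  -- At position `r` the end `p 0` is at distance exactly `r`, and D ≤ 2 r brings the other end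
  -- within `r`; hence `r` is the eccentricity of the chosen centre, also when `D` is odd.
  maximal-cost-≤ : ∀ {f r} → IbnBcast T f → 0 < r → r ≤ D → D ≤ 2 * r → weight f ≤ r
  maximal-cost-≤ {f} {r} (_ , minimal) 0<r r≤D D≤2r =
    subst (weight f ≤_) (weight-spike (p r) r) (minimal (spike (p r) r) (radial-maximal {u₀ = p 0} 0<r
      (≤-reflexive (trans (sym (d-p z≤n r≤D)) (d-sym (p 0) (p r)))) near))
    where
    near : ∀ x → d (p r) x ≤ r
    near x = subst (_≤ r) (d-sym x (p r)) (either
      (λ x≤r → lin 4 (λ y a h r → y ⊕ a ≐ h ⊕ r ⇒ h ≲ a ⇒ ⊢ y ≲ r) (d x (p r)) (pos x) (ht x) r (d-right x r x≤r r≤D) (ht≤pos x))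
      (λ r≤x → lin 5 (λ y a h r D → y ⊕ r ≐ h ⊕ a ⇒ h ⊕ a ≲ D ⇒ D ≲ 2 ⊗ r ⇒ ⊢ y ≲ r) (d x (p r)) (pos x) (ht x) r D (d-left x r r≤x) (ht+pos≤D x) D≤2r)
      (≤-total (pos x) r))

  -- The distances from `c` to the two ends of P add up to at least `D`.
  half-far : ∀ c q → 2 * q < D → ∃[ u ] (suc q ≤ d c u)
  half-far c q 2q<D = either
    (λ ≤q → p D , lin 6 (λ c0 cD a h q D → c0 ⊕ κ 0 ≐ h ⊕ a ⇒ cD ⊕ a ≐ h ⊕ D ⇒ c0 ≲ q ⇒ κ 1 ⊕ 2 ⊗ q ≲ D ⇒ ⊢ κ 1 ⊕ q ≲ cD)
      (d c (p 0)) (d c (p D)) (pos c) (ht c) q D (d-left c 0 z≤n) (d-right c D (pos≤D c) ≤-refl) ≤q 2q<D)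
    (λ q< → p 0 , q<)
    (≤-<-connex (d c (p 0)) q)

  common-point : ∀ u c r s → d u c ≤ r + s → ∃[ x ] (x ∈ᵇ (u , r) × x ∈ᵇ (c , s))
  common-point u c r s le =
    -- Go `r` steps from `u` towards `c`, or stop at `c` if it is nearer than that.
    let (x , ux , xc) = between u c (r ⊓ d u c) (m⊓n≤n r (d u c)) in x ,
      subst (_≤ r) (trans (sym ux) (d-sym u x)) (m⊓n≤m r (d u c)) ,
      either
        (λ r≤ → lin 5 (λ m r s xc uc → m ≐ r ⇒ m ⊕ xc ≐ uc ⇒ uc ≲ r ⊕ s ⇒ ⊢ xc ≲ s) (r ⊓ d u c) r s (d x c) (d u c) (m≤n⇒m⊓n≡m r≤) xc le)
        (λ ≤r → lin 4 (λ m s xc uc → m ≐ uc ⇒ m ⊕ xc ≐ uc ⇒ ⊢ xc ≲ s) (r ⊓ d u c) s (d x c) (d u c) (m≥n⇒m⊓n≡n ≤r) xc)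
        (≤-total r (d u c))

  module _ {m q : ℕ} (m≥1 : 1 ≤ m) (D≡ : D ≡ m + 2 * q) (diam-path : IsDiamPath T P)
           (max : ∀ M → SplitSet T P M → length M ≤ m) where

    below : ∀ {k} → k ≤ q → 2 * k < D
    below {k} k≤q = lin 4 (λ k m q D → D ≐ m ⊕ 2 ⊗ q ⇒ κ 1 ≲ m ⇒ k ≲ q ⇒ ⊢ κ 1 ⊕ 2 ⊗ k ≲ D) k m q D D≡ m≥1 k≤q

    tiles-split : ∀ {ss w} (F : Filling 0 ss) → sum ss ≤ w → w ≤ q → SplitSet T P (cuts F) × D ≤ 2 * w + length (cuts F)
    tiles-split {ss} {w} F sum≤ w≤q =
      split-set F diam-path (lin 4 (λ s l w D → κ 0 ⊕ 2 ⊗ s ⊕ l ≐ κ 1 ⊕ D ⇒ s ≲ w ⇒ κ 1 ⊕ 2 ⊗ w ≲ D ⇒ ⊢ κ 2 ≲ l) (sum ss) (length ss) w D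
        (filling-length F) sum≤ (below w≤q)) ,
      lin 5 (λ s l w D k → κ 0 ⊕ 2 ⊗ s ⊕ l ≐ κ 1 ⊕ D ⇒ s ≲ w ⇒ κ 1 ⊕ k ≐ l ⇒ ⊢ D ≲ 2 ⊗ w ⊕ k) (sum ss) (length ss) w D (length (cuts F))
        (filling-length F) sum≤ (cuts-length F)

    -- By `filling-length`, a cost below `q` would leave more than `m` cuts, that is, a split-set
    -- larger than the maximum.
    cost-≥ : ∀ {g} → Dominates g → q ≤ weight g
    cost-≥ {g} dom = decidable-stable (q ≤? weight g) λ ≰ → cheap⇒tiled dom (below (<⇒≤ (≰⇒> ≰))) λ ss F sum≤ _ →
      let (split , D≤) = tiles-split F sum≤ (<⇒≤ (≰⇒> ≰)) in
      ≰ (lin 5 (λ m q w D k → D ≐ m ⊕ 2 ⊗ q ⇒ D ≲ 2 ⊗ w ⊕ k ⇒ k ≲ m ⇒ ⊢ q ≲ w) m q (weight g) D (length (cuts F)) D≡ D≤ (max (cuts F) split))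

    overlapping : ∀ {f} → MaxBnIndep T f → weight f ≤ q →
              ∃[ u ] ∃[ c ] ∃[ x ] (u ≢ c × 0 < f u × 0 < f c × x ∈ᵇ (u , f u) × x ∈ᵇ (c , f c))
    overlapping {f} maximal f≤q = at-ball (dominates (maximal⇒dominating maximal) (p 0))
      where
      meet : ∀ {c} → 0 < f c → ∃[ u ] (u ≢ c × 0 < f u × d u c ≤ f u + f c) →
             ∃[ u ] ∃[ c ] ∃[ x ] (u ≢ c × 0 < f u × 0 < f c × x ∈ᵇ (u , f u) × x ∈ᵇ (c , f c))
      meet {c} 0<fc (u , u≢c , 0<fu , uc) =
        let (x , x∈u , x∈c) = common-point u c (f u) (f c) uc in u , c , x , u≢c , 0<fu , 0<fc , x∈u , x∈c
      at-ball : ∃[ c ] (0 < f c × d c (p 0) ≤ f c) →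
                ∃[ u ] ∃[ c ] ∃[ x ] (u ≢ c × 0 < f u × 0 < f c × x ∈ᵇ (u , f u) × x ∈ᵇ (c , f c))
      at-ball (c , 0<fc , _) =
        let (u₀ , far) = half-far c q (below ≤-refl)
        in meet 0<fc (touching maximal c u₀ (≤-trans (s≤s (≤-trans (≤-weight f c) f≤q)) far))

    -- At cost at most `q` the count D = m + 2 q forces at least `m` cuts. So the split-set is a
    -- maximum one, and the hypothesis on its components applies.
    full-split : ∀ {ss} {f : Fin n → ℕ} (F : Filling 0 ss) → sum ss ≤ weight f → weight f ≤ q → SplitSet T P (cuts F) × length (cuts F) ≡ m
    full-split {f = f} F sum≤ f≤q =
      let (split , D≤) = tiles-split F sum≤ f≤q
      in split , ≤-antisym (max (cuts F) split)
           (lin 5 (λ m q w D k → D ≐ m ⊕ 2 ⊗ q ⇒ D ≲ 2 ⊗ w ⊕ k ⇒ w ≲ q ⇒ ⊢ m ≲ k) m q (weight f) D (length (cuts F)) D≡ D≤ f≤q)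

    self : ∀ (f : Fin n → ℕ) z → z ∈ᵇ (z , f z)
    self f z = subst (_≤ f z) (sym (d-refl z)) z≤n

    common-tile : ∀ {f ss u c x} → Tiled f ss → 0 < f u → 0 < f c → x ∈ᵇ (u , f u) → x ∈ᵇ (c , f c) →
                  ∃[ l ] ∃[ t ] (Tile 0 ss l t × u within l , l + 2 * t × c within l , l + 2 * t)
    common-tile {f} {u = u} {c} tiled 0<fu 0<fc x∈u x∈c =
      let (l , t , tile , u-sub) = tiled u 0<fu
          (l′ , t′ , tile′ , c-sub) = tiled c 0<fc
          (l≡ , t≡) = tile-unique tile′ tile (c-sub x∈c) (u-sub x∈u)
      in l , t , tile , u-sub (self f u) , subst₂ (λ l t → c within l , l + 2 * t) l≡ t≡ (c-sub (self f c))

    maximal-not-gamma : (∀ M → SplitSet T P M → length M ≡ m → ∀ x → UniquelyRadial (Comp (removeCuts T P M) x)) →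
                        ∀ {f g} → MaxBnIndep T f → GammaBcast T g → weight f ≡ weight g → weight g ≤ q → ⊥
    maximal-not-gamma unique {f} {g} maximal γ f≡g g≤q = refute (overlapping maximal f≤q)
      where
      f≤q : weight f ≤ q
      f≤q = subst (_≤ q) (sym f≡g) g≤q
      dom : Dominates f
      dom = dominates (maximal⇒dominating maximal)
      refute : ∃[ u ] ∃[ c ] ∃[ x ] (u ≢ c × 0 < f u × 0 < f c × x ∈ᵇ (u , f u) × x ∈ᵇ (c , f c)) → ⊥
      refute (u , c , x , u≢c , 0<fu , 0<fc , x∈u , x∈c) = cheap⇒tiled dom (below f≤q) λ ss F sum≤ tiled →
        let (l , t , tile , u-in , c-in) = common-tile tiled 0<fu 0<fc x∈u x∈c
            (split , full) = full-split {f = f} F sum≤ f≤q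
        in u≢c (single-centre F tile (proj₁ maximal) dom tiled γ f≡g (unique (cuts F) split full (p l)) u-in c-in 0<fu 0<fc)

    cost-formula : m ≤ 2 → (∀ M → SplitSet T P M → length M ≡ m → ∀ x → UniquelyRadial (Comp (removeCuts T P M) x)) →
                   ∀ {f g H} → weight H ≡ q → Dominates H → GammaBcast T g → IbnBcast T f → weight f ≡ suc (weight g)
    cost-formula m≤2 unique {f} {g} {H} H≡q H-dom γ ibn =
      let g≤q = subst (weight g ≤_) H≡q (gamma-minimal H γ H-dom)
          q≤g = cost-≥ (dominates (proj₂ (proj₁ γ)))
          g≤f = proj₂ γ f (proj₁ (proj₁ ibn) , maximal⇒dominating (proj₁ ibn))
          -- The value q + 1 is admissible because `D` is 1 + 2 q or 2 + 2 q: it is at least D / 2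
          -- exactly when `m` is at most 2.
          f≤ = maximal-cost-≤ {f} {suc q} ibn (s≤s z≤n)
                 (lin 3 (λ m q D → D ≐ m ⊕ 2 ⊗ q ⇒ κ 1 ≲ m ⇒ ⊢ κ 1 ⊕ q ≲ D) m q D D≡ m≥1)
                 (lin 3 (λ m q D → D ≐ m ⊕ 2 ⊗ q ⇒ m ≲ κ 2 ⇒ ⊢ D ≲ 2 ⊗ (κ 1 ⊕ q)) m q D D≡ m≤2)
      in ≤-antisym (≤-trans f≤ (s≤s q≤g)) (≤∧≢⇒< g≤f λ eq → maximal-not-gamma unique (proj₁ ibn) γ (sym eq) g≤q)

theorem2p6 : (n : ℕ) (T : Graph n) → IsTree T →
    (m : ℕ) → (m ≡ 1 ⊎ m ≡ 2) → MaxSplitCard T m →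
    (∀ (P : List (Fin n)) (M : List ℕ) → SplitSet T P M → length M ≡ m →
    ∀ x → UniquelyRadial (Comp (removeCuts T P M) x)) →
    ∀ (f g : Fin n → ℕ) → GammaBcast T g → IbnBcast T f →
    cost T f ≡ suc (cost T g)
theorem2p6 n T tree m m≡ ((P , M , split@(diam-path@(u , v , path , _ , ecc) , _ , cut-bounds , _) , len-M) , max) unique f g γ ibn =
  let open TreeDistance T tree
      len = walk-nonempty (proj₁ path)
      diam = λ x y → within⇒d≤ (ecc x (proj₁ tree x) y (proj₁ tree y))
      0<D = positive-length M cut-bounds len-M m≡
      multiple = λ (single : Single T) → two-points path len 0<D single
      (q , H , D≡ , H≡q , H-dom) = CostFormula.central-cost T tree path len diam multiple M split len-M m≡
  in CostFormula.cost-formula T tree path len diam multiple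
       (either {C = 1 ≤ m} (λ { refl → s≤s z≤n }) (λ { refl → s≤s z≤n }) m≡) D≡ diam-path (λ M → max P M)
       (either {C = m ≤ 2} (λ { refl → s≤s z≤n }) (λ { refl → s≤s (s≤s z≤n) }) m≡) (unique P) {f} {g} {H} H≡q H-dom γ ibn
  where
  positive-length : ∀ M → All (λ c → suc c < length P) M → length M ≡ m → m ≡ 1 ⊎ m ≡ 2 → 0 < length P ∸ 1
  positive-length (c ∷ M) (lt ∷ _) _ _ = m<n⇒0<n∸m (≤-trans (s≤s (s≤s z≤n)) lt)
  positive-length [] _ refl (inj₁ ())
  positive-length [] _ refl (inj₂ ())

  two-points : ∀ {P u v D} → PathL T u v P → length P ≡ suc D → 0 < D → ¬ Single T
  two-points path len 0<D (x , _ , all) =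
    let open TreeDistance T tree
        open Line (line path len)
    in <⇒≢ 0<D (p-inj 0 _ z≤n ≤-refl (trans (all _ (proj₁ tree _)) (sym (all _ (proj₁ tree _)))))
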